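{- There is a polynomial-time $2$-approximation algorithm for All-Pairs Temporal Connectivity (MTC) on any temporal cycle $C_n$.
   Context: A temporal graph $\mathcal{G}(V,E,L)$ with lifetime $L$ is a sequence of undirected edge-weighted graphs $(G_t(V,E_t,w_t))_{t\in\{1,\dots,L\}}$ with $E_t\subseteq E$; $w(e,t)=w_t(e)\ge 0$ is the weight of the temporal edge $(e,t)$, for $e\in E_t$. The underlying graph is $G(V,E)$; $\mathcal{G}$ is a temporal cycle $C_n$ if $G$ is a cycle on $n$ vertices. A temporal path from $v_1$ to $v_{k+1}$ is a sequence $(v_1,(e_1,t_1),v_2,\dots,(e_k,t_k),v_{k+1})$ with $e_i=\{v_i,v_{i+1}\}\in E_{t_i}$ and $t_1\le\cdots\le t_k$. A temporal graph is (temporally) connected if there is a temporal path from $u$ to $v$ for every ordered pair $(u,v)\in V\times V$. A spanning subgraph is obtained by taking subsets $E'_t\subseteq E_t$ on the same vertex set; its total weight is $\sum_t\sum_{e\in E'_t}w(e,t)$. MTC: given a temporal graph, compute a temporally connected spanning subgraph of minimum total weight. A $2$-approximation algorithm outputs, on every instance, a feasible solution of total weight at most $2$ times the optimum. One may assume that at least one temporal edge is available at each time unit, so $L$ is at most the number of temporal edges. -}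

module Defs where

open import Data.Bool.Base using (Bool; true; false; if_then_else_)
open import Data.Fin.Base using (Fin; toℕ)
open import Data.Fin.Subset using (Subset; _∈_; _⊆_)
import Data.Integer.Base as ℤ
open import Data.List.Base as List using (List; []; _∷_)
open import Data.Nat.Base as ℕ using (ℕ; suc; _≤_; _+_; _*_; _^_; _∸_)
open import Data.Nat.Logarithm using (⌊log₂_⌋)
open import Data.Product.Base using (∃-syntax; _×_; _,_)
open import Data.Rational.Base as ℚ using (ℚ; 0ℚ; ↥_; ↧ₙ_)
open import Data.Rational.Properties using (+-0-commutativeMonoid)
open import Data.Sum.Base using (_⊎_; inj₁; inj₂)
open import Data.Unit.Base using (⊤; tt)
import Data.Vec.Base as Vec
open import Function.Bundles using (_⤖_; module Bijection)
open import Relation.Binary.PropositionalEquality.Core using (_≡_; _≢_)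
open import Algebra.Properties.CommutativeMonoid.Sum +-0-commutativeMonoid
  using () renaming (sum to sumℚ)

------------------------------------------------------------------------
-- Graphs

-- Finite simple undirected graphs with vertex set Fin n and edge set Fin m.
-- The order of the endpoints src e, tgt e carries no meaning.
record Graph (n m : ℕ) : Set where
  field
    src tgt : Fin m → Fin n

  Joins : Fin m → Fin n → Fin n → Set
  Joins e u v = (src e ≡ u × tgt e ≡ v) ⊎ (src e ≡ v × tgt e ≡ u)

  field
    loopless    : ∀ e → src e ≢ tgt e
    no-parallel : ∀ {e e′ u v} → Joins e u v → Joins e′ u v → e ≡ e′

-- j is the successor of i modulo n.
CyclicSuc : ∀ {n} → Fin n → Fin n → Set
CyclicSuc {n} i j =
  (toℕ j ≡ suc (toℕ i)) ⊎ (suc (toℕ i) ≡ n × toℕ j ≡ 0)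

-- V = {v₀,…,vₙ₋₁}, E = {e₀,…,eₙ₋₁} and eᵢ = {vᵢ , vᵢ₊₁}, indices modulo n.
-- The orders in which Fin n and Fin m list V and E are arbitrary.
record IsCycle {n m : ℕ} (G : Graph n m) : Set where
  open Graph G
  field
    3≤n    : 3 ≤ n
    vertex : Fin n ⤖ Fin n
    edge   : Fin n ⤖ Fin m
    joins  : ∀ {i j} → CyclicSuc i j →
             Joins (Bijection.to edge i) (Bijection.to vertex i)
                   (Bijection.to vertex j)

------------------------------------------------------------------------
-- Temporal graphs

-- The time units 1,…,L are represented by Fin L.
TemporalEdges : (m L : ℕ) → Set
TemporalEdges m L = Fin L → Subset m

-- Only the values w t e with e ∈ E t are meaningful.
record TemporalGraph (n m L : ℕ) : Set where
  field
    underlying : Graph n m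
    E          : TemporalEdges m L
    w          : Fin L → Fin m → ℚ
    w-nonneg   : ∀ {t e} → e ∈ E t → 0ℚ ℚ.≤ w t e

  open Graph underlying public

IsTemporalCycle : ∀ {n m L} → TemporalGraph n m L → Set
IsTemporalCycle 𝒢 = IsCycle (TemporalGraph.underlying 𝒢)

module _ {n m L : ℕ} (𝒢 : TemporalGraph n m L) where
  open TemporalGraph 𝒢

  -- TemporalPath F τ u v: temporal paths from u to v that use temporal edges
  -- in F only and whose first time label is at least τ.
  data TemporalPath (F : TemporalEdges m L) : ℕ → Fin n → Fin n → Set where
    stop : ∀ {τ v} → TemporalPath F τ v v
    step : ∀ {τ u v x} (e : Fin m) (t : Fin L) →
           Joins e u v → e ∈ F t → τ ≤ toℕ t →
           TemporalPath F (toℕ t) v x → TemporalPath F τ u x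

  Connects : TemporalEdges m L → Set
  Connects F = ∀ u v → TemporalPath F 0 u v

  TemporallyConnected : Set
  TemporallyConnected = Connects E

  record Feasible (F : TemporalEdges m L) : Set where
    field
      subgraph  : ∀ t → F t ⊆ E t
      connected : Connects F

  totalWeight : TemporalEdges m L → ℚ
  totalWeight F =
    sumℚ λ t → sumℚ λ e → if Vec.lookup (F t) e then w t e else 0ℚ

  record Optimal (F : TemporalEdges m L) : Set where
    field
      feasible : Feasible F
      minimum  : ∀ F′ → Feasible F′ → totalWeight F ℚ.≤ totalWeight F′

------------------------------------------------------------------------
-- Model of computation: a Turing-complete language over immutable first-order
-- data, with unit cost per instruction.
--
-- Compound values are shared pointers, so every structural instruction takes
-- constant time.  The only arithmetic is addition, subtraction and comparison:
-- k instructions produce numbers of bit length polynomial in k and in the bit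
-- length of the input.  Hence unit-cost time is polynomially related to
-- Turing-machine time on binary encodings.

infixr 6 _⊕_
infixr 7 _⊗_

data Ty : Set where
  unit bool nat rat : Ty
  _⊕_ _⊗_           : Ty → Ty → Ty
  list              : Ty → Ty

El : Ty → Set
El unit     = ⊤
El bool     = Bool
El nat      = ℕ
El rat      = ℚ
El (A ⊕ B)  = El A ⊎ El B
El (A ⊗ B)  = El A × El B
El (list A) = List (El A)

-- Length of a binary encoding, up to a constant factor.
size : ∀ A → El A → ℕ
size unit     _        = 1
size bool     _        = 1
size nat      k        = suc ⌊log₂ k ⌋
size rat      q        = suc ⌊log₂ ℤ.∣ ↥ q ∣ ⌋ + suc ⌊log₂ ↧ₙ q ⌋
size (A ⊕ B)  (inj₁ x) = suc (size A x)
size (A ⊕ B)  (inj₂ y) = suc (size B y)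
size (A ⊗ B)  (x , y)  = suc (size A x + size B y)
size (list A) xs       = suc (List.sum (List.map (size A) xs))

data Prim : Ty → Ty → Set where
  copy             : ∀ {A} → Prim A A
  const            : ∀ {A B} → El B → Prim A B
  fst              : ∀ {A B} → Prim (A ⊗ B) A
  snd              : ∀ {A B} → Prim (A ⊗ B) B
  inl              : ∀ {A B} → Prim A (A ⊕ B)
  inr              : ∀ {A B} → Prim B (A ⊕ B)
  cons             : ∀ {A} → Prim (A ⊗ list A) (list A)
  uncons           : ∀ {A} → Prim (list A) (unit ⊕ A ⊗ list A)
  natAdd natSub    : Prim (nat ⊗ nat) nat
  natLeq           : Prim (nat ⊗ nat) bool
  ratAdd ratSub    : Prim (rat ⊗ rat) rat
  ratLeq           : Prim (rat ⊗ rat) bool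

⟦_⟧ : ∀ {A B} → Prim A B → El A → El B
⟦ copy ⟧    x        = x
⟦ const y ⟧ _        = y
⟦ fst ⟧     (x , _)  = x
⟦ snd ⟧     (_ , y)  = y
⟦ inl ⟧     x        = inj₁ x
⟦ inr ⟧     y        = inj₂ y
⟦ cons ⟧    (x , xs) = x ∷ xs
⟦ uncons ⟧  []       = inj₁ tt
⟦ uncons ⟧  (x ∷ xs) = inj₂ (x , xs)
⟦ natAdd ⟧  (a , b)  = a + b
⟦ natSub ⟧  (a , b)  = a ∸ b
⟦ natLeq ⟧  (a , b)  = a ℕ.≤ᵇ b
⟦ ratAdd ⟧  (p , q)  = p ℚ.+ q
⟦ ratSub ⟧  (p , q)  = p ℚ.- q
⟦ ratLeq ⟧  (p , q)  = p ℚ.≤ᵇ q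

infixr 5 _⨾_

-- match and cond keep a context C available to both branches; loop repeats its
-- body until the body returns a right injection, and need not terminate.
data Prog : Ty → Ty → Set where
  prim  : ∀ {A B} → Prim A B → Prog A B
  _⨾_   : ∀ {A B C} → Prog A B → Prog B C → Prog A C
  pair  : ∀ {A B C} → Prog A B → Prog A C → Prog A (B ⊗ C)
  match : ∀ {A B C D} → Prog (A ⊗ C) D → Prog (B ⊗ C) D → Prog ((A ⊕ B) ⊗ C) D
  cond  : ∀ {C D} → Prog C D → Prog C D → Prog (bool ⊗ C) D
  loop  : ∀ {A B} → Prog A (A ⊕ B) → Prog A B

infix 4 _∙_⇓_⟨_⟩

-- p ∙ x ⇓ y ⟨ k ⟩: on input x, program p halts with output y after k steps.
data _∙_⇓_⟨_⟩ : ∀ {A B} → Prog A B → El A → El B → ℕ → Set where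
  prim  : ∀ {A B} {f : Prim A B} {x} → prim f ∙ x ⇓ ⟦ f ⟧ x ⟨ 1 ⟩
  seq   : ∀ {A B C} {p : Prog A B} {q : Prog B C} {x y z k l} →
          p ∙ x ⇓ y ⟨ k ⟩ → q ∙ y ⇓ z ⟨ l ⟩ → (p ⨾ q) ∙ x ⇓ z ⟨ suc (k + l) ⟩
  pair  : ∀ {A B C} {p : Prog A B} {q : Prog A C} {x y z k l} →
          p ∙ x ⇓ y ⟨ k ⟩ → q ∙ x ⇓ z ⟨ l ⟩ →
          pair p q ∙ x ⇓ (y , z) ⟨ suc (k + l) ⟩
  left  : ∀ {A B C D} {p : Prog (A ⊗ C) D} {q : Prog (B ⊗ C) D} {a c y k} →
          p ∙ (a , c) ⇓ y ⟨ k ⟩ → match p q ∙ (inj₁ a , c) ⇓ y ⟨ suc k ⟩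
  right : ∀ {A B C D} {p : Prog (A ⊗ C) D} {q : Prog (B ⊗ C) D} {b c y k} →
          q ∙ (b , c) ⇓ y ⟨ k ⟩ → match p q ∙ (inj₂ b , c) ⇓ y ⟨ suc k ⟩
  then  : ∀ {C D} {p q : Prog C D} {c y k} →
          p ∙ c ⇓ y ⟨ k ⟩ → cond p q ∙ (true , c) ⇓ y ⟨ suc k ⟩
  else  : ∀ {C D} {p q : Prog C D} {c y k} →
          q ∙ c ⇓ y ⟨ k ⟩ → cond p q ∙ (false , c) ⇓ y ⟨ suc k ⟩
  exit  : ∀ {A B} {p : Prog A (A ⊕ B)} {x y k} →
          p ∙ x ⇓ inj₂ y ⟨ k ⟩ → loop p ∙ x ⇓ y ⟨ suc k ⟩
  again : ∀ {A B} {p : Prog A (A ⊕ B)} {x x′ y k l} →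
          p ∙ x ⇓ inj₁ x′ ⟨ k ⟩ → loop p ∙ x′ ⇓ y ⟨ l ⟩ →
          loop p ∙ x ⇓ y ⟨ suc (k + l) ⟩

------------------------------------------------------------------------
-- Approximation algorithms for MTC

-- The number of vertices, the list of edges as pairs of endpoints, and for each
-- time unit the list over all edges of the weight, or inj₁ tt if unavailable.
Instance : Ty
Instance = nat ⊗ list (nat ⊗ nat) ⊗ list (list (unit ⊕ rat))

encode : ∀ {n m L} → TemporalGraph n m L → El Instance
encode {n} 𝒢 =
    n
  , List.tabulate (λ e → toℕ (src e) , toℕ (tgt e))
  , List.tabulate (λ t → List.tabulate (λ e →
      if Vec.lookup (E t) e then inj₂ (w t e) else inj₁ tt))
  where open TemporalGraph 𝒢

Solution : Ty
Solution = list (list bool)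

encodeSolution : ∀ {m L} → TemporalEdges m L → El Solution
encodeSolution F = List.tabulate (λ t → Vec.toList (F t))

GraphClass : Set₁
GraphClass = ∀ {n m L} → TemporalGraph n m L → Set

PolynomialTimeOn : GraphClass → Prog Instance Solution → Set
PolynomialTimeOn 𝒞 p =
  ∃[ c ] ∃[ d ] (∀ {n m L} (𝒢 : TemporalGraph n m L) → 𝒞 𝒢 →
    ∃[ y ] ∃[ k ] (p ∙ encode 𝒢 ⇓ y ⟨ k ⟩
                   × k ≤ c * size Instance (encode 𝒢) ^ d + c))

-- A temporal graph has a feasible solution iff it is temporally connected, so
-- only temporally connected members of the class are instances of MTC.
ApproximatesMTCOn : GraphClass → ℚ → Prog Instance Solution → Set
ApproximatesMTCOn 𝒞 α p =
  ∀ {n m L} (𝒢 : TemporalGraph n m L) → 𝒞 𝒢 → TemporallyConnected 𝒢 →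
    ∃[ F ] ∃[ k ] (p ∙ encode 𝒢 ⇓ encodeSolution F ⟨ k ⟩
                   × Feasible 𝒢 F
                   × (∀ F* → Optimal 𝒢 F* →
                        totalWeight 𝒢 F ℚ.≤ α ℚ.* totalWeight 𝒢 F*))

{-# OPTIONS --safe #-}
module Submission where

-- On a cycle, every temporal path may be replaced by one that runs monotonically
-- clockwise or counterclockwise.  A subgraph is therefore temporally connected
-- iff at each vertex the clockwise and the counterclockwise reach add up to at
-- least n − 1.  The algorithm buys clockwise and counterclockwise paths
-- separately: in an optimal subgraph, consider for each direction the paths of
-- maximal reach, one for each run of vertices with the same end point.  Two such
-- paths of the same direction share no temporal edge, since otherwise one could
-- switch at it and reach further.  So each direction costs at most the optimum,
-- and together they cost at most twice the optimum.  (If a direction allows paths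
-- of three laps, two laps of it suffice, and each lap costs at most the optimum.)
-- The cheapest such family of paths is a closed walk of minimum weight through n
-- layers of states, one layer for each vertex; a state consists of the reach in
-- either direction and of whether the path is bought here or inherited from the
-- neighbouring vertex.

open import Defs
import Algebra.Solver.CommutativeMonoid as CMSolver
open import Data.Bool.Base using (Bool; true; false; if_then_else_; _∧_; not)
open import Data.Bool.ListAction using (any)
open import Data.Bool.Properties using (T-≡)
open import Data.Empty using (⊥; ⊥-elim)
open import Data.Fin.Base using (Fin; fromℕ<; toℕ; zero; suc)
import Data.Fin.Properties as Finₚ
open import Data.Fin.Properties using (toℕ-fromℕ<; toℕ-injective; toℕ<n)
open import Data.Fin.Subset using (_∈_; _⊆_)
open import Data.Fin.Subset.Properties using (_∈?_)
import Data.Integer.Base as ℤ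
open import Data.List.Base
  using (List; []; _∷_; _++_; length; foldl; foldr; concatMap; reverse; map; tabulate; iterate; _ʳ++_)
open import Data.List.Membership.Propositional using (find; lose) renaming (_∈_ to _∈ˡ_)
open import Data.List.Membership.Propositional.Properties
  using (∈-concatMap⁺; ∈-concatMap⁻; ∈-tabulate⁺; ∈-tabulate⁻; ∈-map⁺; ∈-map⁻)
open import Data.List.Properties
  using (foldl-ʳ++; map-tabulate; tabulate-cong; length-tabulate; length-map; length-++; length-reverse;
         reverse-involutive; map-++; ++-identityʳ)
open import Data.List.Relation.Unary.All as All using (All; []; _∷_)
import Data.List.Relation.Unary.All.Properties as Allₚ
open import Data.List.Relation.Unary.AllPairs as AllPairs using (AllPairs; []; _∷_)
import Data.List.Relation.Unary.AllPairs.Properties as AllPairsₚ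
open import Data.List.Relation.Unary.Any using (here; there)
open import Data.List.Relation.Unary.Any.Properties using (any⁺; any⁻)
open import Data.List.Relation.Unary.Unique.Propositional using (Unique)
import Data.List.Relation.Unary.Unique.Propositional.Properties as Uniqueₚ
open import Data.Nat.Base as ℕ
  using (ℕ; zero; suc; _≤_; _<_; _+_; _*_; _^_; _∸_; _⊔_; z≤n; s≤s; NonZero)
open import Data.Nat.DivMod
  using (_%_; _mod_; m≡m%n+[m/n]*n; [m+kn]%n≡m%n; m<n⇒m%n≡m; m%n<n; n%n≡0)
open import Data.Nat.Properties as ℕₚ hiding (_≟_)
open import Data.Nat.Tactic.RingSolver using (solve-∀)
open import Data.Product using (∃-syntax; _×_; _,_; proj₁; proj₂)
open import Data.Rational.Base as ℚ using (ℚ; 0ℚ)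
import Data.Rational.Properties as ℚₚ
open import Algebra.Properties.CommutativeMonoid.Sum ℚₚ.+-0-commutativeMonoid
  using (∑-distrib-+; sum-cong-≗) renaming (sum to sumℚ)
open import Data.Sum.Base as Sum using (_⊎_; inj₁; inj₂; [_,_]′)
open import Data.Unit.Base using (tt)
import Data.Vec.Base as Vec
open import Data.Vec.Properties using (lookup⇒[]=; []=⇒lookup; lookup∘tabulate)
open import Function.Base using (_∘_; id; case_of_)
open import Function.Bundles using (_⤖_; module Bijection; module Equivalence)
open import Relation.Binary.PropositionalEquality
  using (_≡_; _≢_; refl; sym; trans; cong; cong₂; subst; subst₂; _≗_; module ≡-Reasoning)
open import Relation.Nullary using (¬_; Dec; yes; no; does)
open import Relation.Nullary.Decidable using (_×-dec_; map′; dec-true)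

-- An inherited path is checked by its length alone, so a walk might claim paths that nobody bought.
-- Closing the walk excludes this: along inherited paths the length falls by one per vertex, and
-- inheriting all the way round would give i = n + i. Hence each direction buys at least one path,
-- and every claimed length is backed by a real one.
--
-- The walk minimises the sum of all purchases, repetitions included, whereas the output is a set;
-- nonnegative weights make the sum an upper bound for the set. Conversely, a feasible subgraph
-- bounds such a sum only if the purchases repeat no label, and maximal paths exist only if the
-- reach is bounded. The threshold is three turns: a path of that length from any vertex contains
-- two turns from vertex 0, whose tails give every vertex at least one turn, so the other direction
-- buys only empty paths. This case distinction belongs to the analysis; the algorithm searches
-- walks that include both kinds of plan.
--
-- For the running time, every function is built together with its program, and list lengths control
-- both the cost and the growth of the results.

private variable
  Γ X Y Z W : Ty

-- Polynomial boundedness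

infix 4 _≲_

-- Base 2 + m x instead of m x, so that sums and products are again single powers.
_≲_ : {S : Set} → (S → ℕ) → (S → ℕ) → Set
g ≲ m = ∃[ d ] (∀ x → g x ≤ (2 + m x) ^ d)

1≤pow : ∀ a d → 1 ≤ (2 + a) ^ d
1≤pow a d = m^n>0 (2 + a) d

n≤2^n : ∀ n → n ≤ 2 ^ n
n≤2^n zero    = z≤n
n≤2^n (suc n) = begin
  1 + n              ≤⟨ +-mono-≤ (1≤pow 0 n) (n≤2^n n) ⟩
  2 ^ n + 2 ^ n      ≡⟨ cong (2 ^ n +_) (sym (+-identityʳ _)) ⟩
  2 ^ suc n          ∎
  where open ≤-Reasoning

module _ {S : Set} {m : S → ℕ} where
  private
    pow-≤ : ∀ x {d e} → d ≤ e → (2 + m x) ^ d ≤ (2 + m x) ^ e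
    pow-≤ x = ^-monoʳ-≤ (2 + m x)

  ≲-weaken : {g h : S → ℕ} → (∀ x → g x ≤ h x) → h ≲ m → g ≲ m
  ≲-weaken g≤h (d , b) = d , λ x → ≤-trans (g≤h x) (b x)

  ≲-const : ∀ c → (λ (_ : S) → c) ≲ m
  ≲-const c = c , λ x → ≤-trans (n≤2^n c) (^-monoˡ-≤ c (m≤m+n 2 (m x)))

  ≲-refl : m ≲ m
  ≲-refl = 1 , λ x → ≤-trans (m≤n+m (m x) 2) (≤-reflexive (sym (*-identityʳ _)))

  ≲-+ : {g h : S → ℕ} → g ≲ m → h ≲ m → (λ x → g x + h x) ≲ m
  ≲-+ {g} {h} (d , b) (e , c) = 1 + (d + e) , λ x → begin
    g x + h x                                  ≤⟨ +-mono-≤ (b x) (c x) ⟩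
    (2 + m x) ^ d + (2 + m x) ^ e              ≤⟨ +-mono-≤ (pow-≤ x (m≤m+n d e)) (pow-≤ x (m≤n+m e d)) ⟩
    (2 + m x) ^ (d + e) + (2 + m x) ^ (d + e)  ≡⟨ cong ((2 + m x) ^ (d + e) +_) (sym (+-identityʳ _)) ⟩
    2 * (2 + m x) ^ (d + e)                    ≤⟨ *-monoˡ-≤ ((2 + m x) ^ (d + e)) (m≤m+n 2 (m x)) ⟩
    (2 + m x) ^ (1 + (d + e))                  ∎
    where open ≤-Reasoning

  ≲-* : {g h : S → ℕ} → g ≲ m → h ≲ m → (λ x → g x * h x) ≲ m
  ≲-* {g} {h} (d , b) (e , c) = d + e , λ x →
    ≤-trans (*-mono-≤ (b x) (c x)) (≤-reflexive (sym (^-distribˡ-+-* (2 + m x) d e)))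

  ≲-⊔ : {g h : S → ℕ} → g ≲ m → h ≲ m → (λ x → g x ⊔ h x) ≲ m
  ≲-⊔ {g} {h} p q = ≲-weaken (λ x → m⊔n≤m+n (g x) (h x)) (≲-+ p q)

  ≲-pow : {h : S → ℕ} → h ≲ m → ∀ d → (λ x → (2 + h x) ^ d) ≲ m
  ≲-pow p zero    = ≲-const 1
  ≲-pow p (suc d) = ≲-* (≲-+ (≲-const 2) p) (≲-pow p d)

  ≲-∘ : {R : Set} {g m′ : R → ℕ} {f : S → R} → g ≲ m′ → (m′ ∘ f) ≲ m → (g ∘ f) ≲ m
  ≲-∘ {f = f} (d , b) p = ≲-weaken (λ x → b (f x)) (≲-pow p d)

-- Computable functions

-- The largest list length within a value, up to nesting depth.  Running times
-- are controlled by list lengths alone.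
μ : ∀ Y → El Y → ℕ
μ unit     _        = 0
μ bool     _        = 0
μ nat      _        = 0
μ rat      _        = 0
μ (Y ⊕ Z)  (inj₁ x) = μ Y x
μ (Y ⊕ Z)  (inj₂ y) = μ Z y
μ (Y ⊗ Z)  (x , y)  = μ Y x ⊔ μ Z y
μ (list Y) []       = 0
μ (list Y) (x ∷ xs) = μ Y x ⊔ suc (μ (list Y) xs)

-- `grow≲` is what makes polynomial cost closed under composition: the second program runs on an
-- intermediate value, whose size must be polynomial in the original input.
record Computable (Y Z : Ty) (f : El Y → El Z) : Set where
  field
    prog  : Prog Y Z
    cost  : El Y → ℕ
    run   : ∀ x → prog ∙ x ⇓ f x ⟨ cost x ⟩
    cost≲ : cost ≲ μ Y
    grow≲ : (λ x → μ Z (f x)) ≲ μ Y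

open Computable

-- Programs are assembled from folds; this lets the functions they compute be stated with the usual
-- list operations.
ext : {f g : El Y → El Z} → f ≗ g → Computable Y Z f → Computable Y Z g
ext {Z = Z} f≗g F = record
  { prog  = prog F
  ; cost  = cost F
  ; run   = λ x → subst (λ y → prog F ∙ x ⇓ y ⟨ cost F x ⟩) (f≗g x) (run F x)
  ; cost≲ = cost≲ F
  ; grow≲ = ≲-weaken (λ x → ≤-reflexive (cong (μ Z) (sym (f≗g x)))) (grow≲ F)
  }

infixr 5 _⟫_

_⟫_ : {f : El Y → El Z} {g : El Z → El W} →
      Computable Y Z f → Computable Z W g → Computable Y W (λ x → g (f x))
_⟫_ {f = f} F G = record
  { prog  = prog F ⨾ prog G
  ; cost  = λ x → suc (cost F x + cost G (f x))
  ; run   = λ x → seq (run F x) (run G (f x))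
  ; cost≲ = ≲-+ (≲-const 1) (≲-+ (cost≲ F) (≲-∘ (cost≲ G) (grow≲ F)))
  ; grow≲ = ≲-∘ (grow≲ G) (grow≲ F)
  }

infixr 4 _,,_

_,,_ : {f : El Γ → El Y} {g : El Γ → El Z} →
       Computable Γ Y f → Computable Γ Z g → Computable Γ (Y ⊗ Z) (λ x → f x , g x)
F ,, G = record
  { prog  = pair (prog F) (prog G)
  ; cost  = λ x → suc (cost F x + cost G x)
  ; run   = λ x → pair (run F x) (run G x)
  ; cost≲ = ≲-+ (≲-const 1) (≲-+ (cost≲ F) (cost≲ G))
  ; grow≲ = ≲-⊔ (grow≲ F) (grow≲ G)
  }

primC : (f : Prim Y Z) → (∀ x → μ Z (⟦ f ⟧ x) ≤ suc (μ Y x)) → Computable Y Z ⟦ f ⟧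
primC f b = record
  { prog  = prim f
  ; cost  = λ _ → 1
  ; run   = λ _ → prim
  ; cost≲ = ≲-const 1
  ; grow≲ = ≲-weaken b (≲-+ (≲-const 1) ≲-refl)
  }

idC : Computable Y Y id
idC = primC copy (λ _ → n≤1+n _)

fstC : Computable (Y ⊗ Z) Y proj₁
fstC {Y} {Z} = primC fst (λ (x , y) → m≤n⇒m≤1+n (m≤m⊔n (μ Y x) (μ Z y)))

sndC : Computable (Y ⊗ Z) Z proj₂
sndC {Y} {Z} = primC snd (λ (x , y) → m≤n⇒m≤1+n (m≤n⊔m (μ Y x) (μ Z y)))

inrC : Computable Z (Y ⊕ Z) inj₂
inrC = primC inr (λ _ → n≤1+n _)

constC : (y : El Z) → Computable Y Z (λ _ → y)
constC {Z} y = record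
  { prog  = prim (const y)
  ; cost  = λ _ → 1
  ; run   = λ _ → prim
  ; cost≲ = ≲-const 1
  ; grow≲ = ≲-const (μ Z y)
  }

consC : {f : El Γ → El Y} {g : El Γ → El (list Y)} →
        Computable Γ Y f → Computable Γ (list Y) g → Computable Γ (list Y) (λ x → f x ∷ g x)
consC {Y = Y} F G = (F ,, G) ⟫ primC cons λ (x , xs) →
  ⊔-lub (m≤n⇒m≤1+n (m≤m⊔n (μ Y x) _)) (s≤s (m≤n⊔m (μ Y x) _))

sucC : {f : El Γ → ℕ} → Computable Γ nat f → Computable Γ nat (λ x → suc (f x))
sucC F = (constC 1 ,, F) ⟫ primC natAdd (λ _ → z≤n)

addC : {f g : El Γ → ℕ} → Computable Γ nat f → Computable Γ nat g → Computable Γ nat (λ x → f x + g x)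
addC F G = (F ,, G) ⟫ primC natAdd (λ _ → z≤n)

subC : {f g : El Γ → ℕ} → Computable Γ nat f → Computable Γ nat g → Computable Γ nat (λ x → f x ∸ g x)
subC F G = (F ,, G) ⟫ primC natSub (λ _ → z≤n)

leqC : {f g : El Γ → ℕ} → Computable Γ nat f → Computable Γ nat g → Computable Γ bool (λ x → f x ℕ.≤ᵇ g x)
leqC F G = (F ,, G) ⟫ primC natLeq (λ _ → z≤n)

addℚC : {f g : El Γ → ℚ} → Computable Γ rat f → Computable Γ rat g → Computable Γ rat (λ x → f x ℚ.+ g x)
addℚC F G = (F ,, G) ⟫ primC ratAdd (λ _ → z≤n)

leqℚC : {f g : El Γ → ℚ} → Computable Γ rat f → Computable Γ rat g → Computable Γ bool (λ x → f x ℚ.≤ᵇ g x)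
leqℚC F G = (F ,, G) ⟫ primC ratLeq (λ _ → z≤n)

unconsC : Computable (list Y) (unit ⊕ Y ⊗ list Y) ⟦ uncons ⟧
unconsC {Y} = primC uncons λ where
  []       → z≤n
  (x ∷ xs) → ⊔-lub (m≤n⇒m≤1+n (m≤m⊔n (μ Y x) _))
                   (m≤n⇒m≤1+n (≤-trans (n≤1+n _) (m≤n⊔m (μ Y x) _)))

caseC : {s : El Γ → El (Y ⊕ Z)} {f : El (Y ⊗ Γ) → El W} {g : El (Z ⊗ Γ) → El W} →
        Computable Γ (Y ⊕ Z) s → Computable (Y ⊗ Γ) W f → Computable (Z ⊗ Γ) W g →
        Computable Γ W (λ γ → [ (λ a → f (a , γ)) , (λ b → g (b , γ)) ]′ (s γ))
caseC {Γ} {Y} {Z} {W} {s} {f} {g} S F G = record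
  { prog  = pair (prog S) (prim copy) ⨾ match (prog F) (prog G)
  ; cost  = λ γ → suc (suc (cost S γ + 1) + suc (branch (cost F) (cost G) γ))
  ; run   = λ γ → seq (pair (run S γ) prim) (runs γ)
  ; cost≲ = ≲-+ (≲-const 1) (≲-+ (≲-+ (≲-const 1) (≲-+ (cost≲ S) (≲-const 1)))
                                 (≲-+ (≲-const 1) (branch≲ (cost≲ F) (cost≲ G))))
  ; grow≲ = ≲-weaken (λ γ → branch-μ (s γ)) (branch≲ (grow≲ F) (grow≲ G))
  }
  where
  branch : (El (Y ⊗ Γ) → ℕ) → (El (Z ⊗ Γ) → ℕ) → El Γ → ℕ
  branch p q γ = [ (λ a → p (a , γ)) , (λ b → q (b , γ)) ]′ (s γ)

  branch≲ : ∀ {p q} → p ≲ μ (Y ⊗ Γ) → q ≲ μ (Z ⊗ Γ) → branch p q ≲ μ Γ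
  branch≲ {p} {q} (d , b) (e , c) =
    ≲-weaken (λ γ → lem γ (s γ)) (≲-+ (≲-pow h d) (≲-pow h e))
    where
    h : (λ γ → μ (Y ⊕ Z) (s γ) ⊔ μ Γ γ) ≲ μ Γ
    h = ≲-⊔ (grow≲ S) ≲-refl
    lem : ∀ γ z → [ (λ a → p (a , γ)) , (λ b → q (b , γ)) ]′ z ≤
          (2 + (μ (Y ⊕ Z) z ⊔ μ Γ γ)) ^ d + (2 + (μ (Y ⊕ Z) z ⊔ μ Γ γ)) ^ e
    lem γ (inj₁ a) = ≤-trans (b (a , γ)) (m≤m+n _ _)
    lem γ (inj₂ a) = ≤-trans (c (a , γ)) (m≤n+m _ _)

  branch-μ : ∀ {γ} z → μ W ([ (λ a → f (a , γ)) , (λ b → g (b , γ)) ]′ z) ≤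
             [ (λ a → μ W (f (a , γ))) , (λ b → μ W (g (b , γ))) ]′ z
  branch-μ (inj₁ _) = ≤-refl
  branch-μ (inj₂ _) = ≤-refl

  runs : ∀ γ → match (prog F) (prog G) ∙ (s γ , γ) ⇓
         [ (λ a → f (a , γ)) , (λ b → g (b , γ)) ]′ (s γ) ⟨ suc (branch (cost F) (cost G) γ) ⟩
  runs γ with s γ
  ... | inj₁ a = left (run F (a , γ))
  ... | inj₂ b = right (run G (b , γ))

ifC : {b : El Γ → Bool} {f g : El Γ → El W} →
      Computable Γ bool b → Computable Γ W f → Computable Γ W g →
      Computable Γ W (λ γ → if b γ then f γ else g γ)
ifC {Γ} {W} {b} {f} {g} S F G = record
  { prog  = pair (prog S) (prim copy) ⨾ cond (prog F) (prog G)
  ; cost  = λ γ → suc (suc (cost S γ + 1) + suc (if b γ then cost F γ else cost G γ))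
  ; run   = λ γ → seq (pair (run S γ) prim) (runs γ)
  ; cost≲ = ≲-+ (≲-const 1) (≲-+ (≲-+ (≲-const 1) (≲-+ (cost≲ S) (≲-const 1)))
                                 (≲-+ (≲-const 1) (≲-weaken (λ γ → if-≤ (b γ)) (≲-+ (cost≲ F) (cost≲ G)))))
  ; grow≲ = ≲-weaken (λ γ → if-μ (b γ)) (≲-+ (grow≲ F) (grow≲ G))
  }
  where
  if-≤ : ∀ c {x y} → (if c then x else y) ≤ x + y
  if-≤ true  = m≤m+n _ _
  if-≤ false = m≤n+m _ _

  if-μ : ∀ c {x y} → μ W (if c then x else y) ≤ μ W x + μ W y
  if-μ true  = m≤m+n _ _
  if-μ false = m≤n+m _ _

  runs : ∀ γ → cond (prog F) (prog G) ∙ (b γ , γ) ⇓ (if b γ then f γ else g γ)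
         ⟨ suc (if b γ then cost F γ else cost G γ) ⟩
  runs γ with b γ
  ... | true  = then (run F γ)
  ... | false = else (run G γ)

-- Iteration over a list is polynomial as soon as one step enlarges the
-- accumulator by an amount that does not depend on the accumulator.
record Growth (Γ X Y : Ty) (h : El (Γ ⊗ X ⊗ Y) → El Y) : Set where
  field
    exponent : ℕ
    increase : ∀ γ x a → μ Y (h (γ , x , a)) ≤ μ Y a + (2 + (μ Γ γ ⊔ μ X x)) ^ exponent

open Growth

module _ {h : El (Γ ⊗ X ⊗ Y) → El Y} (H : Computable (Γ ⊗ X ⊗ Y) Y h) (growth : Growth Γ X Y h) where
  private
    State : Ty
    State = Γ ⊗ (Y ⊗ list X)

    body : Prog State (State ⊕ Y)
    body = pair (prim snd ⨾ prim snd ⨾ prim uncons) (prim copy)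
         ⨾ match (prim snd ⨾ prim snd ⨾ prim fst ⨾ prim inr)
                 (pair (prim snd ⨾ prim fst)
                       (pair (pair (prim snd ⨾ prim fst)
                                   (pair (prim fst ⨾ prim fst) (prim snd ⨾ prim snd ⨾ prim fst))
                              ⨾ prog H)
                             (prim fst ⨾ prim snd))
                  ⨾ prim inl)

    exits : ∀ γ a → body ∙ (γ , a , []) ⇓ inj₂ a ⟨ 16 ⟩
    exits γ a = seq (pair (seq prim (seq prim prim)) prim) (left (seq prim (seq prim (seq prim prim))))

    -- 29 counts the fixed instructions of one round; the form `cost + 3 + 1` is the shape in which
    -- the nested derivation accumulates its counter.
    steps : ∀ γ a x xs → body ∙ (γ , a , x ∷ xs) ⇓ inj₁ (γ , h (γ , x , a) , xs) ⟨ 29 + (cost H (γ , x , a) + 3 + 1) ⟩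
    steps γ a x xs =
      seq (pair (seq prim (seq prim prim)) prim)
          (right (seq (pair (seq prim prim)
                            (pair (seq (pair (seq prim prim) (pair (seq prim prim) (seq prim (seq prim prim))))
                                       (run H (γ , x , a)))
                                  (seq prim prim)))
                      prim))

    foldCost : El Γ → El Y → El (list X) → ℕ
    foldCost γ a []       = 17
    foldCost γ a (x ∷ xs) = suc (29 + (cost H (γ , x , a) + 3 + 1) + foldCost γ (h (γ , x , a)) xs)

    loops : ∀ γ a xs → loop body ∙ (γ , a , xs) ⇓ foldl (λ a x → h (γ , x , a)) a xs ⟨ foldCost γ a xs ⟩
    loops γ a []       = exit (exits γ a)
    loops γ a (x ∷ xs) = again (steps γ a x xs) (loops γ (h (γ , x , a)) xs)

    d = exponent growth
    e = proj₁ (cost≲ H)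

    size-bound : ℕ → ℕ → ℕ → ℕ
    size-bound g a l = a + l * (2 + (g ⊔ l)) ^ d

    length≤ : ∀ xs → length xs ≤ μ (list X) xs
    length≤ []       = z≤n
    length≤ (x ∷ xs) = ≤-trans (s≤s (length≤ xs)) (m≤n⊔m (μ X x) _)

    -- The fixed bound `l` on the list makes the increment per element the same number throughout
    -- the recursion.
    foldl-μ : ∀ γ a l xs → μ (list X) xs ≤ l →
              μ Y (foldl (λ a x → h (γ , x , a)) a xs) ≤ μ Y a + length xs * (2 + (μ Γ γ ⊔ l)) ^ d
    foldl-μ γ a l []       _   = m≤m+n _ _
    foldl-μ γ a l (x ∷ xs) b = begin
      μ Y (foldl (λ a x → h (γ , x , a)) (h (γ , x , a)) xs)
        ≤⟨ foldl-μ γ (h (γ , x , a)) l xs (≤-trans (n≤1+n _) (m⊔n≤o⇒n≤o (μ X x) _ b)) ⟩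
      μ Y (h (γ , x , a)) + length xs * q
        ≤⟨ +-monoˡ-≤ _ (increase growth γ x a) ⟩
      μ Y a + (2 + (μ Γ γ ⊔ μ X x)) ^ d + length xs * q
        ≤⟨ +-monoˡ-≤ (length xs * q) (+-monoʳ-≤ (μ Y a)
             (^-monoˡ-≤ d (s≤s (s≤s (⊔-monoʳ-≤ (μ Γ γ) (m⊔n≤o⇒m≤o _ _ b)))))) ⟩
      μ Y a + q + length xs * q
        ≡⟨ +-assoc (μ Y a) q _ ⟩
      μ Y a + (q + length xs * q) ∎
      where
      open ≤-Reasoning
      q = (2 + (μ Γ γ ⊔ l)) ^ d

    -- `s` bounds the accumulator at every stage: it leaves room for the increments of all remaining
    -- elements, so the hypothesis passes to the tail and each round costs at most the same amount.
    foldCost-≤ : ∀ γ a l s xs → μ (list X) xs ≤ l → μ Y a + length xs * (2 + (μ Γ γ ⊔ l)) ^ d ≤ s →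
                 foldCost γ a xs ≤ 17 + length xs * (34 + (2 + (μ Γ γ ⊔ (l ⊔ s))) ^ e)
    foldCost-≤ γ a l s []       b c = ≤-refl
    foldCost-≤ γ a l s (x ∷ xs) b c = begin
      suc (29 + (cost H (γ , x , a) + 3 + 1) + foldCost γ a′ xs)
        ≤⟨ s≤s (+-mono-≤ (+-monoʳ-≤ 29 (+-monoˡ-≤ 1 (+-monoˡ-≤ 3 (≤-trans (proj₂ (cost≲ H) _)
              (^-monoˡ-≤ e (s≤s (s≤s (⊔-monoʳ-≤ (μ Γ γ)
                 (⊔-mono-≤ (m⊔n≤o⇒m≤o (μ X x) _ b) (m+n≤o⇒m≤o (μ Y a) c))))))))))
              (foldCost-≤ γ a′ l s xs (≤-trans (n≤1+n _) (m⊔n≤o⇒n≤o (μ X x) _ b)) c′)) ⟩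
      suc (29 + (Q + 3 + 1) + (17 + length xs * (34 + Q)))
        ≡⟨ lem Q (length xs) ⟩
      17 + (34 + Q + length xs * (34 + Q)) ∎
      where
      open ≤-Reasoning
      a′ = h (γ , x , a)
      q = (2 + (μ Γ γ ⊔ l)) ^ d
      Q = (2 + (μ Γ γ ⊔ (l ⊔ s))) ^ e
      lem : ∀ Q n → suc (29 + (Q + 3 + 1) + (17 + n * (34 + Q))) ≡ 17 + (34 + Q + n * (34 + Q))
      lem = solve-∀
      c′ : μ Y a′ + length xs * q ≤ s
      c′ = begin
        μ Y a′ + length xs * q
          ≤⟨ +-monoˡ-≤ _ (≤-trans (increase growth γ x a) (+-monoʳ-≤ (μ Y a)
               (^-monoˡ-≤ d (s≤s (s≤s (⊔-monoʳ-≤ (μ Γ γ) (m⊔n≤o⇒m≤o _ _ b))))))) ⟩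
        μ Y a + q + length xs * q
          ≡⟨ +-assoc (μ Y a) q _ ⟩
        μ Y a + (q + length xs * q)
          ≤⟨ c ⟩
        s ∎

  foldlC : {f : El Γ → El Y} {g : El Γ → El (list X)} →
           Computable Γ Y f → Computable Γ (list X) g →
           Computable Γ Y (λ γ → foldl (λ a x → h (γ , x , a)) (f γ) (g γ))
  foldlC {f} {g} F G = record
    { prog  = pair (prim copy) (pair (prog F) (prog G)) ⨾ loop body
    ; cost  = λ γ → suc (suc (1 + suc (cost F γ + cost G γ)) + foldCost γ (f γ) (g γ))
    ; run   = λ γ → seq (pair prim (pair (run F γ) (run G γ))) (loops γ (f γ) (g γ))
    ; cost≲ = ≲-+ (≲-const 1) (≲-+ (≲-+ (≲-const 3) (≲-+ (cost≲ F) (cost≲ G)))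
                (≲-weaken (λ γ → ≤-trans
                    (foldCost-≤ γ (f γ) _ (total γ) (g γ) ≤-refl (+-monoʳ-≤ _ (*-monoˡ-≤ _ (length≤ (g γ)))))
                    (+-monoʳ-≤ 17 (*-monoˡ-≤ _ (length≤ (g γ)))))
                  (≲-+ (≲-const 17) (≲-* (grow≲ G)
                     (≲-+ (≲-const 34) (≲-pow (≲-⊔ ≲-refl (≲-⊔ (grow≲ G) total≲)) e))))))
    ; grow≲ = ≲-weaken (λ γ → ≤-trans (foldl-μ γ (f γ) _ (g γ) ≤-refl)
                                      (+-monoʳ-≤ _ (*-monoˡ-≤ _ (length≤ (g γ))))) total≲
    }
    where
    total : El Γ → ℕ
    total γ = size-bound (μ Γ γ) (μ Y (f γ)) (μ (list X) (g γ))
    total≲ : total ≲ μ Γ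
    total≲ = ≲-+ (grow≲ F) (≲-* (grow≲ G) (≲-pow (≲-⊔ ≲-refl (grow≲ G)) d))

grows : {h : El (Γ ⊗ X ⊗ Y) → El Y} {q : El (Γ ⊗ X) → ℕ} → q ≲ μ (Γ ⊗ X) →
        (∀ γ x a → μ Y (h (γ , x , a)) ≤ μ Y a + q (γ , x)) → Growth Γ X Y h
grows {Y = Y} (d , b) g = record
  { exponent = d
  ; increase = λ γ x a → ≤-trans (g γ x a) (+-monoʳ-≤ (μ Y a) (b (γ , x)))
  }

μ-∷ : ∀ x xs → μ (list Y) (x ∷ xs) ≤ μ (list Y) xs + suc (μ Y x)
μ-∷ {Y} x xs = ⊔-lub (m≤n⇒m≤o+n (μ (list Y) xs) (n≤1+n (μ Y x)))
                     (≤-trans (s≤s (m≤m+n _ (μ Y x))) (≤-reflexive (sym (+-suc _ _))))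

μ-++ : ∀ xs ys → μ (list Y) (xs ++ ys) ≤ μ (list Y) ys + μ (list Y) xs
μ-++     []       ys = m≤m+n _ 0
μ-++ {Y} (x ∷ xs) ys = ⊔-lub (m≤n⇒m≤o+n (μ (list Y) ys) (m≤m⊔n (μ Y x) _)) (begin
  suc (μ (list Y) (xs ++ ys))                             ≤⟨ s≤s (μ-++ xs ys) ⟩
  suc (μ (list Y) ys + μ (list Y) xs)                     ≡⟨ sym (+-suc _ _) ⟩
  μ (list Y) ys + suc (μ (list Y) xs)                     ≤⟨ +-monoʳ-≤ (μ (list Y) ys) (m≤n⊔m (μ Y x) _) ⟩
  μ (list Y) ys + (μ Y x ⊔ suc (μ (list Y) xs))           ∎)
  where open ≤-Reasoning

module _ {f : El (Γ ⊗ X) → El Y} (F : Computable (Γ ⊗ X) Y f) where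

  cons-growth : Growth Γ X (list Y) (λ (γ , x , a) → f (γ , x) ∷ a)
  cons-growth = grows (≲-+ (≲-const 1) (grow≲ F)) λ γ x a → μ-∷ (f (γ , x)) a

  private
    projections : Computable (Γ ⊗ X ⊗ list Y) (Γ ⊗ X) (λ (γ , x , a) → γ , x)
    projections = fstC ,, (sndC ⟫ fstC)

  cons-step : Computable (Γ ⊗ X ⊗ list Y) (list Y) (λ (γ , x , a) → f (γ , x) ∷ a)
  cons-step = consC (projections ⟫ F) (sndC ⟫ sndC)

reverseC : {g : El Γ → El (list X)} → Computable Γ (list X) g → Computable Γ (list X) (λ γ → reverse (g γ))
reverseC G = foldlC (cons-step sndC) (cons-growth sndC) (constC []) G

foldrC : {h : El (Γ ⊗ X ⊗ Y) → El Y} → Computable (Γ ⊗ X ⊗ Y) Y h → Growth Γ X Y h →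
         {f : El Γ → El Y} {g : El Γ → El (list X)} →
         Computable Γ Y f → Computable Γ (list X) g →
         Computable Γ Y (λ γ → foldr (λ x a → h (γ , x , a)) (f γ) (g γ))
foldrC H growth {f} {g} F G =
  ext (λ γ → foldl-ʳ++ _ (f γ) (g γ)) (foldlC H growth F (reverseC G))

appendC : {f g : El Γ → El (list X)} → Computable Γ (list X) f → Computable Γ (list X) g →
          Computable Γ (list X) (λ γ → f γ ++ g γ)
appendC {f = f} {g} F G =
  ext (λ γ → lemma (f γ) (g γ)) (foldrC (cons-step sndC) (cons-growth sndC) G F)
  where
  lemma : ∀ {S : Set} (xs ys : List S) → foldr _∷_ ys xs ≡ xs ++ ys
  lemma []       ys = refl
  lemma (x ∷ xs) ys = cong (x ∷_) (lemma xs ys)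

mapC : {f : El (Γ ⊗ X) → El Y} {g : El Γ → El (list X)} →
       Computable (Γ ⊗ X) Y f → Computable Γ (list X) g →
       Computable Γ (list Y) (λ γ → map (λ x → f (γ , x)) (g γ))
mapC {f = f} {g} F G =
  ext (λ γ → lemma (λ x → f (γ , x)) (g γ)) (foldrC (cons-step F) (cons-growth F) (constC []) G)
  where
  lemma : ∀ {S R : Set} (f : S → R) xs → foldr (λ x a → f x ∷ a) [] xs ≡ map f xs
  lemma f []       = refl
  lemma f (x ∷ xs) = cong (f x ∷_) (lemma f xs)

concatMapC : {f : El (Γ ⊗ X) → El (list Y)} {g : El Γ → El (list X)} →
             Computable (Γ ⊗ X) (list Y) f → Computable Γ (list X) g →
             Computable Γ (list Y) (λ γ → concatMap (λ x → f (γ , x)) (g γ))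
concatMapC {f = f} {g} F G =
  ext (λ γ → lemma (λ x → f (γ , x)) (g γ))
      (foldrC (appendC ((fstC ,, (sndC ⟫ fstC)) ⟫ F) (sndC ⟫ sndC))
              (grows (grow≲ F) λ γ x a → μ-++ (f (γ , x)) a) (constC []) G)
  where
  lemma : ∀ {S R : Set} (f : S → List R) xs → foldr (λ x a → f x ++ a) [] xs ≡ concatMap f xs
  lemma f []       = refl
  lemma f (x ∷ xs) = cong (f x ++_) (lemma f xs)

andC : {f g : El Γ → Bool} → Computable Γ bool f → Computable Γ bool g → Computable Γ bool (λ γ → f γ ∧ g γ)
andC {f = f} {g} F G = ext (λ γ → lemma (f γ) (g γ)) (ifC F G (constC false))
  where
  lemma : ∀ a b → (if a then b else false) ≡ a ∧ b
  lemma true  _ = refl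
  lemma false _ = refl

anyC : {f : El (Γ ⊗ X) → Bool} {g : El Γ → El (list X)} →
       Computable (Γ ⊗ X) bool f → Computable Γ (list X) g →
       Computable Γ bool (λ γ → any (λ x → f (γ , x)) (g γ))
anyC {f = f} {g} F G =
  ext (λ γ → lemma (λ x → f (γ , x)) (g γ))
      (foldrC (ifC ((fstC ,, (sndC ⟫ fstC)) ⟫ F) (constC true) (sndC ⟫ sndC))
              (grows (≲-const 0) (λ _ _ _ → z≤n)) (constC false) G)
  where
  lemma : ∀ {S : Set} (f : S → Bool) xs → foldr (λ x a → if f x then true else a) false xs ≡ any f xs
  lemma f []       = refl
  lemma f (x ∷ xs) with f x
  ... | true  = refl
  ... | false = lemma f xs

infix 4 _==_

-- The machine compares naturals only by `natLeq`, so equality is two comparisons.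
_==_ : ℕ → ℕ → Bool
a == b = (a ℕ.≤ᵇ b) ∧ (b ℕ.≤ᵇ a)

eqC : {f g : El Γ → ℕ} → Computable Γ nat f → Computable Γ nat g → Computable Γ bool (λ γ → f γ == g γ)
eqC F G = andC (leqC F G) (leqC G F)

-- Shifting the whole tail at each element takes quadratic time, but keeps the enumeration a single
-- `foldr`.
enumerate : {S : Set} → List S → List (ℕ × S)
enumerate = foldr (λ x a → (0 , x) ∷ map (λ (i , y) → suc i , y) a) []

enumerateC : Computable (list X) (list (nat ⊗ X)) enumerate
enumerateC {X} = foldrC
  (consC (constC 0 ,, (sndC ⟫ fstC)) (mapC (sucC (sndC ⟫ fstC) ,, (sndC ⟫ sndC)) (sndC ⟫ sndC)))
  (grows {q = λ (_ , x) → suc (μ X x)} (≲-+ (≲-const 1) (≲-weaken (λ (γ , x) → m≤n⊔m (μ (list X) γ) (μ X x)) ≲-refl))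
    λ _ x a → ≤-trans (μ-∷ (0 , x) (map (λ (i , y) → suc i , y) a)) (+-monoˡ-≤ _ (shift-μ a)))
  (constC []) idC
  where
  shift-μ : ∀ a → μ (list (nat ⊗ X)) (map (λ (i , y) → suc i , y) a) ≤ μ (list (nat ⊗ X)) a
  shift-μ []            = z≤n
  shift-μ ((_ , y) ∷ a) = ⊔-monoʳ-≤ (μ X y) (s≤s (shift-μ a))

-- Cheapest walks through a sequence of layers of weighted nodes

Node Entry : Ty → Ty → Ty
Node  K P = K ⊗ rat ⊗ P
Entry K P = Node K (list P)

-- An entry records a walk: the key of its last node, its total weight, and the
-- payloads of its nodes.
module Walks (K P : Ty) (adj : El K → El K → Bool) where

  pick : El K → El (Entry K P) → El (unit ⊕ Entry K P) → El (unit ⊕ Entry K P)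
  pick k e acc = if adj (proj₁ e) k
    then [ (λ _ → inj₂ e) , (λ e₀ → if proj₁ (proj₂ e) ℚ.≤ᵇ proj₁ (proj₂ e₀) then inj₂ e else acc) ]′ acc
    else acc

  best : El K → El (list (Entry K P)) → El (unit ⊕ Entry K P)
  best k = foldr (pick k) (inj₁ tt)

  -- Whether a walk can be prolonged depends on its last key only, so nothing is lost by keeping the
  -- cheapest predecessor. A table therefore has at most one entry per node of its layer, however
  -- many walks there are.
  extend : El (list (Entry K P)) → El (Node K P) → El (list (Entry K P))
  extend tbl (k , w , p) = [ (λ _ → []) , (λ (_ , c , ps) → (k , w ℚ.+ c , p ∷ ps) ∷ []) ]′ (best k tbl)

  advance : El (list (Entry K P)) → El (list (Node K P)) → El (list (Entry K P))
  advance tbl = concatMap (extend tbl)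

  private
    E = Entry K P

    pick-μ : ∀ k e acc → μ (unit ⊕ E) (pick k e acc) ≤ μ E e ⊔ μ (unit ⊕ E) acc
    pick-μ k e acc with adj (proj₁ e) k
    ... | false = m≤n⊔m (μ E e) _
    ... | true  with acc
    ...   | inj₁ tt = m≤m⊔n (μ E e) 0
    ...   | inj₂ e₀ with proj₁ (proj₂ e) ℚ.≤ᵇ proj₁ (proj₂ e₀)
    ...     | true  = m≤m⊔n (μ E e) _
    ...     | false = m≤n⊔m (μ E e) _

    best-μ : ∀ k tbl → μ (unit ⊕ E) (best k tbl) ≤ μ (list E) tbl
    best-μ k []        = z≤n
    best-μ k (e ∷ tbl) = ≤-trans (pick-μ k e (best k tbl))
      (⊔-monoʳ-≤ (μ E e) (m≤n⇒m≤1+n (best-μ k tbl)))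

  -- At most one entry per node survives and each payload grows by one element. The increase is thus
  -- bounded by the layer alone, as iteration over the layers demands.
  advance-μ : ∀ tbl layer → μ (list E) (advance tbl layer) ≤
              μ (list E) tbl + (1 + μ (list (Node K P)) layer + μ (list (Node K P)) layer)
  advance-μ tbl layer = ≤-trans (go (μ (list (Node K P)) layer) layer ≤-refl)
    (≤-reflexive (lem (μ (list E) tbl) (μ (list (Node K P)) layer)))
    where
    lem : ∀ t l → l + (1 + t + l) ≡ t + (1 + l + l)
    lem = solve-∀
    go : ∀ l layer → μ (list (Node K P)) layer ≤ l →
         μ (list E) (advance tbl layer) ≤ μ (list (Node K P)) layer + (1 + μ (list E) tbl + l)
    go l []                     _ = z≤n
    go l ((k , w , p) ∷ layer) b with best k tbl | best-μ k tbl
    ... | inj₁ tt           | _ = ≤-trans (go l layer (≤-trans (n≤1+n _) (m⊔n≤o⇒n≤o _ _ b)))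
            (+-monoˡ-≤ _ (≤-trans (n≤1+n _) (m≤n⊔m (μ K k ⊔ μ P p) _)))
    ... | inj₂ (k′ , c , ps) | b′ = ⊔-lub
            (≤-trans (⊔-lub (m≤n⇒m≤o+n (suc (μ (list E) tbl)) (≤-trans (m≤m⊔n (μ K k) (μ P p)) b₁))
                            (⊔-lub (m≤n⇒m≤o+n (suc (μ (list E) tbl)) (≤-trans (m≤n⊔m (μ K k) (μ P p)) b₁))
                                   (m≤n⇒m≤n+o l (s≤s (≤-trans (m≤n⊔m (μ K k′) _) b′)))))
                     (m≤n+m _ (μ (list (Node K P)) ((k , w , p) ∷ layer))))
            (≤-trans (s≤s (go l layer (≤-trans (n≤1+n _) (m⊔n≤o⇒n≤o _ _ b))))
                     (+-monoˡ-≤ _ (m≤n⊔m (μ K k ⊔ μ P p) _)))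
      where
      b₁ : μ K k ⊔ μ P p ≤ l
      b₁ = m⊔n≤o⇒m≤o _ _ b

  module _ (adjC : Computable (K ⊗ K) bool (λ (k , k′) → adj k k′)) where

    bestC : Computable (K ⊗ list E) (unit ⊕ E) (λ (k , tbl) → best k tbl)
    bestC = foldrC
      (ifC (((sndC ⟫ fstC ⟫ fstC) ,, (fstC ⟫ fstC)) ⟫ adjC)
        (caseC (sndC ⟫ sndC) (sndC ⟫ sndC ⟫ fstC ⟫ inrC)
          (ifC (leqℚC (sndC ⟫ sndC ⟫ fstC ⟫ sndC ⟫ fstC) (fstC ⟫ sndC ⟫ fstC))
            (sndC ⟫ sndC ⟫ fstC ⟫ inrC) (sndC ⟫ sndC ⟫ sndC)))
        (sndC ⟫ sndC))
      (grows {q = λ (_ , e) → μ E e} (≲-weaken (λ (γ , e) → m≤n⊔m (μ (K ⊗ list E) γ) (μ E e)) ≲-refl)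
        λ (k , _) e acc → ≤-trans (pick-μ k e acc) (≤-trans (m⊔n≤m+n (μ E e) _) (≤-reflexive (+-comm (μ E e) _))))
      (constC (inj₁ tt)) sndC

    advanceC : Computable (list E ⊗ list (Node K P)) (list E) (λ (tbl , layer) → advance tbl layer)
    advanceC = concatMapC
      (caseC (((sndC ⟫ fstC) ,, (fstC ⟫ fstC)) ⟫ bestC) (constC [])
        (consC ((sndC ⟫ sndC ⟫ fstC) ,, addℚC (sndC ⟫ sndC ⟫ sndC ⟫ fstC) (fstC ⟫ sndC ⟫ fstC)
                 ,, consC (sndC ⟫ sndC ⟫ sndC ⟫ sndC) (fstC ⟫ sndC ⟫ sndC))
               (constC [])))
      sndC

-- The algorithm

-- A temporal edge is labelled by its time unit and its edge, in this order.
Label Option Plan Position : Ty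
Label    = nat ⊗ nat
Option   = Node (nat ⊗ bool) (list Label)
Plan     = Node ((nat ⊗ bool) ⊗ (nat ⊗ bool)) (list Label ⊗ list Label)
Position = list (list (Node nat Label)) ⊗ list (list (Node nat Label))

labelledEdge : ℕ → ℕ → El (unit ⊕ rat) → El (list (Node nat Label))
labelledEdge t e = [ (λ _ → []) , (λ w → (t , w , (t , e)) ∷ []) ]′

labelledEdges : El (list (list (unit ⊕ rat))) → El (list (Node nat Label))
labelledEdges rows =
  concatMap (λ (t , row) → concatMap (λ (e , a) → labelledEdge t e a) (enumerate row)) (enumerate rows)

labelledEdgesC : Computable (list (list (unit ⊕ rat))) (list (Node nat Label)) labelledEdges
labelledEdgesC = concatMapC
  (concatMapC
    (caseC (sndC ⟫ sndC) (constC [])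
      (consC ((sndC ⟫ fstC ⟫ sndC ⟫ fstC) ,, fstC ,, (sndC ⟫ fstC ⟫ sndC ⟫ fstC) ,, (sndC ⟫ sndC ⟫ fstC))
             (constC [])))
    (sndC ⟫ sndC ⟫ enumerateC))
  enumerateC

column : El (list (list (unit ⊕ rat))) → ℕ → El (list (Node nat Label))
column rows e = concatMap (λ nd → if proj₂ (proj₂ (proj₂ nd)) == e then nd ∷ [] else []) (labelledEdges rows)

columnC : Computable (list (list (unit ⊕ rat)) ⊗ nat) (list (Node nat Label)) (λ (rows , e) → column rows e)
columnC = concatMapC
  (ifC (eqC (sndC ⟫ sndC ⟫ sndC ⟫ sndC) (fstC ⟫ sndC)) (consC sndC (constC [])) (constC []))
  (fstC ⟫ labelledEdgesC)

followStep : ℕ × ℕ → ℕ × ℕ × ℕ → ℕ × ℕ → ℕ × ℕ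
followStep (v , e₀) (e , a , b) next =
  if e == e₀ then next else if a == v then (b , e) else if b == v then (a , e) else next

-- The other edge at v, and its other endpoint.
follow : El (list (nat ⊗ nat)) → ℕ × ℕ → ℕ × ℕ
follow es (v , e₀) = foldr (followStep (v , e₀)) (v , e₀) (enumerate es)

followC : Computable (list (nat ⊗ nat) ⊗ nat ⊗ nat) (nat ⊗ nat) (λ (es , s) → follow es s)
followC = foldrC
  (ifC (eqC (sndC ⟫ fstC ⟫ fstC) (fstC ⟫ sndC ⟫ sndC)) (sndC ⟫ sndC)
    (ifC (eqC (sndC ⟫ fstC ⟫ sndC ⟫ fstC) (fstC ⟫ sndC ⟫ fstC))
      ((sndC ⟫ fstC ⟫ sndC ⟫ sndC) ,, (sndC ⟫ fstC ⟫ fstC))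
      (ifC (eqC (sndC ⟫ fstC ⟫ sndC ⟫ sndC) (fstC ⟫ sndC ⟫ fstC))
        ((sndC ⟫ fstC ⟫ sndC ⟫ fstC) ,, (sndC ⟫ fstC ⟫ fstC))
        (sndC ⟫ sndC))))
  (grows (≲-const 0) (λ _ _ _ → z≤n))
  sndC (fstC ⟫ enumerateC)

-- The state is the vertex reached and the edge just traversed. Treating edge 0 as traversed towards
-- its second endpoint fixes the sense of the tour; the default is never met on a cycle.
start : El (list (nat ⊗ nat)) → ℕ × ℕ
start es = [ (λ _ → 0 , 0) , (λ ((_ , b) , _) → b , 0) ]′ (⟦ uncons ⟧ es)

startC : Computable (list (nat ⊗ nat)) (nat ⊗ nat) start
startC = caseC unconsC (constC (0 , 0)) ((fstC ⟫ fstC ⟫ sndC) ,, constC 0)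

tourStep : El (list (nat ⊗ nat)) → (ℕ × ℕ) × List ℕ → (ℕ × ℕ) × List ℕ
tourStep es (s , out) = follow es s , (proj₂ (follow es s) ∷ out)

-- The folded list serves as a counter: one step per edge.
tour : El (list (nat ⊗ nat)) → List ℕ
tour es = reverse (proj₂ (foldl (λ s _ → tourStep es s) (start es , []) es))

tourC : Computable (list (nat ⊗ nat)) (list nat) tour
tourC = reverseC (foldlC
  (((fstC ,, (sndC ⟫ sndC ⟫ fstC)) ⟫ followC)
    ,, consC ((fstC ,, (sndC ⟫ sndC ⟫ fstC)) ⟫ followC ⟫ sndC) (sndC ⟫ sndC ⟫ sndC))
  (grows (≲-const 1) (λ _ _ (_ , out) → ≤-reflexive (+-comm 1 (μ (list nat) out))))
  (startC ,, constC []) idC ⟫ sndC)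

-- Keys are time labels: a temporal path along consecutive edges is a walk through their columns
-- with nondecreasing keys.
module Paths = Walks nat Label ℕ._≤ᵇ_

Tables : Ty
Tables = list (nat ⊗ list (Entry nat Label))

pathStep : El (nat ⊗ list (Entry nat Label) ⊗ Tables) → El (list (Node nat Label)) →
           El (nat ⊗ list (Entry nat Label) ⊗ Tables)
pathStep (k , tbl , all) c = suc k , Paths.advance tbl c , (suc k , Paths.advance tbl c) ∷ all

-- The empty path has key 0, so any time label may follow it.
noPath : El (list (Entry nat Label))
noPath = (0 , 0ℚ , []) ∷ []

-- For every k, the cheapest temporal paths over the first k columns.
tables : El (list (list (Node nat Label))) → El Tables
tables cs = proj₂ (proj₂ (foldl pathStep (0 , noPath , (0 , noPath) ∷ []) cs))

tablesC : Computable (list (list (Node nat Label))) Tables tables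
tablesC = foldlC {h = λ (_ , c , acc) → pathStep acc c}
  (sucC (sndC ⟫ sndC ⟫ fstC) ,, nextC ,, consC (sucC (sndC ⟫ sndC ⟫ fstC) ,, nextC) (sndC ⟫ sndC ⟫ sndC ⟫ sndC))
  (grows {q = λ (_ , c) → 1 + (1 + μ (list (Node nat Label)) c + μ (list (Node nat Label)) c)}
    (≲-+ (≲-const 1) (≲-+ (≲-+ (≲-const 1) column≲) column≲)) increases)
  (constC (0 , noPath , (0 , noPath) ∷ [])) idC ⟫ sndC ⟫ sndC
  where
  nextC = ((sndC ⟫ sndC ⟫ sndC ⟫ fstC) ,, (sndC ⟫ fstC)) ⟫ Paths.advanceC (leqC fstC sndC)
  column≲ : (λ (_ , c) → μ (list (Node nat Label)) c) ≲ μ (list (list (Node nat Label)) ⊗ list (Node nat Label))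
  column≲ = ≲-weaken (λ (γ , c) → m≤n⊔m (μ (list (list (Node nat Label))) γ) _) ≲-refl
  increases : ∀ (γ : El (list (list (Node nat Label)))) c acc →
    μ (nat ⊗ list (Entry nat Label) ⊗ Tables) (pathStep acc c) ≤
    μ (nat ⊗ list (Entry nat Label) ⊗ Tables) acc + (1 + (1 + μ (list (Node nat Label)) c + μ (list (Node nat Label)) c))
  increases _ c (k , tbl , all) = ⊔-lub next (⊔-lub next (≤-trans (s≤s (m≤n⊔m (μ (list (Entry nat Label)) tbl) _))
      (≤-trans (≤-reflexive (+-comm 1 _)) (+-monoʳ-≤ (μ (list (Entry nat Label)) tbl ⊔ μ Tables all) (s≤s z≤n)))))
    where
    next : μ (list (Entry nat Label)) (Paths.advance tbl c) ≤
           (μ (list (Entry nat Label)) tbl ⊔ μ Tables all) + (1 + (1 + μ (list (Node nat Label)) c + μ (list (Node nat Label)) c))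
    next = ≤-trans (Paths.advance-μ tbl c) (+-mono-≤ (m≤m⊔n _ (μ Tables all)) (n≤1+n _))

-- A path may be bought, or used for free when an earlier purchase contains it.
variants : ℕ → El (Entry nat Label) → El (list Option)
variants k (_ , c , ps) = ((k , false) , c , ps) ∷ ((k , true) , 0ℚ , []) ∷ []

tableOptions : El (nat ⊗ list (Entry nat Label)) → El (list Option)
tableOptions (k , tbl) = concatMap (variants k) tbl

options : El (list (list (Node nat Label))) → El (list Option)
options cs = concatMap tableOptions (tables cs)

optionsC : Computable (list (list (Node nat Label))) (list Option) options
optionsC = concatMapC
  (concatMapC
    (consC (((fstC ⟫ sndC ⟫ fstC) ,, constC false) ,, (sndC ⟫ sndC ⟫ fstC) ,, (sndC ⟫ sndC ⟫ sndC))
      (consC (((fstC ⟫ sndC ⟫ fstC) ,, constC true) ,, constC 0ℚ ,, constC [])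
        (constC [])))
    (sndC ⟫ sndC))
  tablesC

-- A position is a zipper: passing an edge takes its column from the clockwise side to the
-- counterclockwise one.
move : El Position → El Position
move (behind , ahead) = [ (λ _ → behind , ahead) , (λ (c , cs) → c ∷ behind , cs) ]′ (⟦ uncons ⟧ ahead)

moveC : Computable Position Position move
moveC = caseC (sndC ⟫ unconsC) sndC (consC (fstC ⟫ fstC) (sndC ⟫ fstC) ,, (fstC ⟫ sndC))

move-μ : ∀ p → μ Position (move p) ≤ suc (μ Position p)
move-μ (behind , [])    = n≤1+n _
move-μ (behind , c ∷ cs) = ⊔-lub
  (⊔-lub (m≤n⇒m≤1+n (≤-trans (m≤m⊔n x (suc y)) (m≤n⊔m z (x ⊔ suc y)))) (s≤s (m≤m⊔n z (x ⊔ suc y))))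
  (m≤n⇒m≤1+n (≤-trans (n≤1+n y) (≤-trans (m≤n⊔m x (suc y)) (m≤n⊔m z (x ⊔ suc y)))))
  where
  x = μ (list (Node nat Label)) c
  y = μ (list (list (Node nat Label))) cs
  z = μ (list (list (Node nat Label))) behind

-- Four turns of the cycle to either side of the first vertex.
origin : El (list (list (Node nat Label))) → El Position
origin cs = reverse (cs ++ cs ++ cs ++ cs) , cs ++ cs ++ cs ++ cs

positionStep : El (Position ⊗ list Position) → El (Position ⊗ list Position)
positionStep (p , out) = move p , p ∷ out

positions : El (list (list (Node nat Label))) → El (list Position)
positions cs = reverse (proj₂ (foldl (λ s _ → positionStep s) (origin cs , []) cs))

positionsC : Computable (list (list (Node nat Label))) (list Position) positions
positionsC = reverseC (foldlC {h = λ (_ , _ , s) → positionStep s}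
  ((sndC ⟫ sndC ⟫ fstC ⟫ moveC) ,, consC (sndC ⟫ sndC ⟫ fstC) (sndC ⟫ sndC ⟫ sndC))
  (grows (≲-const 1) λ _ _ (p , out) → ≤-trans
    (⊔-lub (≤-trans (move-μ p) (s≤s (m≤m⊔n (μ Position p) _)))
           (⊔-lub (m≤n⇒m≤1+n (m≤m⊔n (μ Position p) _)) (s≤s (m≤n⊔m (μ Position p) _))))
    (≤-reflexive (+-comm 1 (μ Position p ⊔ μ (list Position) out))))
  ((reverseC turns ,, turns) ,, constC []) idC ⟫ sndC)
  where turns = appendC idC (appendC idC (appendC idC idC))

combine : ℕ → El Option → El Option → El (list Plan)
combine n (k , c , p) (k′ , c′ , p′) =
  if n ∸ 1 ℕ.≤ᵇ proj₁ k + proj₁ k′ then ((k , k′) , c ℚ.+ c′ , (p , p′)) ∷ [] else []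

plans : ℕ → El Position → El (list Plan)
plans n (behind , ahead) = concatMap (λ a → concatMap (combine n a) (options behind)) (options ahead)

plansC : Computable (nat ⊗ Position) (list Plan) (λ (n , p) → plans n p)
plansC = concatMapC
  (concatMapC
    (ifC (leqC (subC (fstC ⟫ fstC ⟫ fstC) (constC 1)) (addC (fstC ⟫ sndC ⟫ fstC ⟫ fstC) (sndC ⟫ fstC ⟫ fstC)))
      (consC (((fstC ⟫ sndC ⟫ fstC) ,, (sndC ⟫ fstC))
               ,, addℚC (fstC ⟫ sndC ⟫ sndC ⟫ fstC) (sndC ⟫ sndC ⟫ fstC)
               ,, (fstC ⟫ sndC ⟫ sndC ⟫ sndC) ,, (sndC ⟫ sndC ⟫ sndC))
             (constC []))
      (constC []))
    (fstC ⟫ sndC ⟫ fstC ⟫ optionsC))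
  (sndC ⟫ sndC ⟫ optionsC)

-- Clockwise paths are inherited by the next vertex, counterclockwise ones by
-- the previous vertex.
compatible : El ((nat ⊗ bool) ⊗ (nat ⊗ bool)) → El ((nat ⊗ bool) ⊗ (nat ⊗ bool)) → Bool
compatible ((i , _) , (j , q)) ((i′ , p′) , (j′ , _)) =
  (if p′ then i == suc i′ else true) ∧ (if q then j′ == suc j else true)

compatibleC : Computable (((nat ⊗ bool) ⊗ (nat ⊗ bool)) ⊗ ((nat ⊗ bool) ⊗ (nat ⊗ bool))) bool
                         (λ (k , k′) → compatible k k′)
compatibleC = andC
  (ifC (sndC ⟫ fstC ⟫ sndC) (eqC (fstC ⟫ fstC ⟫ fstC) (sucC (sndC ⟫ fstC ⟫ fstC))) (constC true))
  (ifC (fstC ⟫ sndC ⟫ sndC) (eqC (sndC ⟫ sndC ⟫ fstC) (sucC (fstC ⟫ sndC ⟫ fstC))) (constC true))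

PlanKey PlanPayload : Ty
PlanKey     = (nat ⊗ bool) ⊗ (nat ⊗ bool)
PlanPayload = list Label ⊗ list Label

module Tours  = Walks PlanKey PlanPayload compatible
-- With all keys adjacent, `best` is a plain minimum over the table, and the key it is given is a
-- dummy.
module Select = Walks PlanKey PlanPayload (λ _ _ → true)

travel : El (list (Entry PlanKey PlanPayload)) → El (list (list Plan)) → El (list (Entry PlanKey PlanPayload))
travel = foldl Tours.advance

-- Fixing the first plan turns the search for closed walks into one for open walks: the walk runs
-- through the remaining layers, and `best k` admits only last keys from which the first plan can
-- follow again.
closedTours : El (list (list Plan)) → El Plan → El (list (Entry PlanKey PlanPayload))
closedTours layers (k , w , p) =
  [ (λ _ → []) , (λ e → e ∷ []) ]′ (Tours.best k (travel ((k , w , p ∷ []) ∷ []) layers))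

candidates : El (list (list Plan)) → El (list (Entry PlanKey PlanPayload))
candidates layers = [ (λ _ → []) , (λ (l , ls) → concatMap (closedTours ls) l) ]′ (⟦ uncons ⟧ layers)

candidatesC : Computable (list (list Plan)) (list (Entry PlanKey PlanPayload)) candidates
candidatesC = caseC unconsC (constC []) (concatMapC
  (caseC (((sndC ⟫ fstC) ,, foldlC
              (((sndC ⟫ sndC) ,, (sndC ⟫ fstC)) ⟫ Tours.advanceC compatibleC)
              (grows (≲-+ (≲-+ (≲-const 1) layer≲) layer≲) λ _ layer tbl → Tours.advance-μ tbl layer)
              (consC ((sndC ⟫ fstC) ,, (sndC ⟫ sndC ⟫ fstC) ,, consC (sndC ⟫ sndC ⟫ sndC) (constC []))
                     (constC []))
              (fstC ⟫ fstC ⟫ sndC))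
          ⟫ Tours.bestC compatibleC)
    (constC []) (consC fstC (constC [])))
  (fstC ⟫ fstC))
  where
  layer≲ : ∀ {Γ} → (λ (_ , l) → μ (list Plan) l) ≲ μ (Γ ⊗ list Plan)
  layer≲ {Γ} = ≲-weaken (λ (γ , l) → m≤n⊔m (μ Γ γ) _) ≲-refl

both : El PlanPayload → El (list Label)
both (p , p′) = p ++ p′

purchases : El (unit ⊕ Entry PlanKey PlanPayload) → El (list Label)
purchases = [ (λ _ → []) , (λ (_ , _ , ps) → concatMap both ps) ]′

choice : El (list (list Plan)) → El (unit ⊕ Entry PlanKey PlanPayload)
choice layers = Select.best ((0 , false) , (0 , false)) (candidates layers)

choiceC : Computable (list (list Plan)) (unit ⊕ Entry PlanKey PlanPayload) choice
choiceC = (constC ((0 , false) , (0 , false)) ,, candidatesC) ⟫ Select.bestC (constC true)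

isLabel : ℕ → ℕ → El Label → Bool
isLabel t e (t′ , e′) = (t′ == t) ∧ (e′ == e)

planLayers : El Instance → El (list (list Plan))
planLayers (n , es , rows) = map (plans n) (positions (map (column rows) (tour es)))

-- The choice is recomputed for every entry of the output, which costs only a polynomial factor.
solve : El Instance → El Solution
solve (n , es , rows) =
  map (λ (t , row) → map (λ (e , _) → any (isLabel t e) (purchases (choice (planLayers (n , es , rows)))))
                         (enumerate row))
      (enumerate rows)

planLayersC : Computable Instance (list (list Plan)) planLayers
planLayersC = mapC (((fstC ⟫ fstC) ,, sndC) ⟫ plansC)
  (mapC (((fstC ⟫ sndC ⟫ sndC) ,, sndC) ⟫ columnC) (sndC ⟫ fstC ⟫ tourC) ⟫ positionsC)

solveC : Computable Instance Solution solve
solveC = mapC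
  (mapC
    (anyC (andC (eqC (sndC ⟫ fstC) (fstC ⟫ fstC ⟫ sndC ⟫ fstC)) (eqC (sndC ⟫ sndC) (fstC ⟫ sndC ⟫ fstC)))
      (fstC ⟫ fstC ⟫ planLayersC ⟫ choiceC ⟫
        caseC idC (constC []) (concatMapC (appendC (sndC ⟫ fstC) (sndC ⟫ sndC)) (fstC ⟫ sndC ⟫ sndC))))
    (sndC ⟫ sndC ⟫ enumerateC))
  (sndC ⟫ sndC ⟫ enumerateC)

-- From list lengths to the length of the encoding

μ≤size : ∀ Y x → μ Y x ≤ size Y x
μ≤size unit     _        = z≤n
μ≤size bool     _        = z≤n
μ≤size nat      _        = z≤n
μ≤size rat      _        = z≤n
μ≤size (Y ⊕ Z)  (inj₁ x) = m≤n⇒m≤1+n (μ≤size Y x)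
μ≤size (Y ⊕ Z)  (inj₂ y) = m≤n⇒m≤1+n (μ≤size Z y)
μ≤size (Y ⊗ Z)  (x , y)  = m≤n⇒m≤1+n (≤-trans (m⊔n≤m+n (μ Y x) (μ Z y)) (+-mono-≤ (μ≤size Y x) (μ≤size Z y)))
μ≤size (list Y) []       = z≤n
μ≤size (list Y) (x ∷ xs) = ⊔-lub
  (m≤n⇒m≤1+n (m≤n⇒m≤n+o _ (μ≤size Y x)))
  (s≤s (≤-trans (μ≤size (list Y) xs) (+-monoˡ-≤ _ (1≤size Y x))))
  where
  1≤size : ∀ Y x → 1 ≤ size Y x
  1≤size unit     _        = s≤s z≤n
  1≤size bool     _        = s≤s z≤n
  1≤size nat      _        = s≤s z≤n
  1≤size rat      _        = s≤s z≤n
  1≤size (Y ⊕ Z)  (inj₁ _) = s≤s z≤n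
  1≤size (Y ⊕ Z)  (inj₂ _) = s≤s z≤n
  1≤size (Y ⊗ Z)  _        = s≤s z≤n
  1≤size (list Y) _        = s≤s z≤n

^-distribʳ-* : ∀ d a b → (a * b) ^ d ≡ a ^ d * b ^ d
^-distribʳ-* zero    a b = refl
^-distribʳ-* (suc d) a b = trans (cong (a * b *_) (^-distribʳ-* d a b)) (lemma a b (a ^ d) (b ^ d))
  where
  lemma : ∀ a b x y → a * b * (x * y) ≡ a * x * (b * y)
  lemma = solve-∀

computable-polynomialTime : ∀ {f} (F : Computable Instance Solution f) (𝒞 : GraphClass) →
                            PolynomialTimeOn 𝒞 (prog F)
computable-polynomialTime {f} F 𝒞 = 3 ^ d , d , λ 𝒢 _ →
  let μ≤N = μ≤size Instance (encode 𝒢) in f (encode 𝒢) , cost F (encode 𝒢) , run F (encode 𝒢) , (begin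
  cost F (encode 𝒢)                               ≤⟨ proj₂ (cost≲ F) (encode 𝒢) ⟩
  (2 + μ Instance (encode 𝒢)) ^ d                 ≤⟨ ^-monoˡ-≤ d (+-mono-≤ (+-mono-≤ (1≤N 𝒢) (1≤N 𝒢)) μ≤N) ⟩
  (N 𝒢 + N 𝒢 + N 𝒢) ^ d                           ≡⟨ cong (_^ d) (triple (N 𝒢)) ⟩
  (3 * N 𝒢) ^ d                                   ≡⟨ ^-distribʳ-* d 3 (N 𝒢) ⟩
  3 ^ d * N 𝒢 ^ d                                 ≤⟨ m≤m+n _ _ ⟩
  3 ^ d * N 𝒢 ^ d + 3 ^ d                         ∎)
  where
  open ≤-Reasoning
  d = proj₁ (cost≲ F)
  N : ∀ {n m L} → TemporalGraph n m L → ℕ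
  N 𝒢 = size Instance (encode 𝒢)
  1≤N : ∀ {n m L} (𝒢 : TemporalGraph n m L) → 1 ≤ N 𝒢
  1≤N 𝒢 = s≤s z≤n
  triple : ∀ k → k + k + k ≡ 3 * k
  triple = solve-∀

-- Congruence modulo n

infix 4 _~[_]_

-- A multiple of n may be added on either side, so congruence is symmetric without subtraction and
-- its laws are ring identities in ℕ.
_~[_]_ : ℕ → ℕ → ℕ → Set
j ~[ n ] k = ∃[ p ] ∃[ q ] j + p * n ≡ k + q * n

module _ {n : ℕ} where

  ~-reflexive : ∀ {j k} → j ≡ k → j ~[ n ] k
  ~-reflexive j≡k = 0 , 0 , cong (_+ 0) j≡k

  ~-sym : ∀ {j k} → j ~[ n ] k → k ~[ n ] j
  ~-sym (p , q , eq) = q , p , sym eq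

  ~-trans : ∀ {i j k} → i ~[ n ] j → j ~[ n ] k → i ~[ n ] k
  ~-trans {i} {j} {k} (p , q , eq) (r , s , eq′) = p + r , s + q , (begin
    i + (p + r) * n      ≡⟨ lem₁ i p r n ⟩
    i + p * n + r * n    ≡⟨ cong (_+ r * n) eq ⟩
    j + q * n + r * n    ≡⟨ lem₂ j q r n ⟩
    j + r * n + q * n    ≡⟨ cong (_+ q * n) eq′ ⟩
    k + s * n + q * n    ≡⟨ lem₁ k s q n ⟨
    k + (s + q) * n      ∎)
    where
    open ≡-Reasoning
    lem₁ : ∀ i p r n → i + (p + r) * n ≡ i + p * n + r * n
    lem₁ = solve-∀
    lem₂ : ∀ j q r n → j + q * n + r * n ≡ j + r * n + q * n
    lem₂ = solve-∀

  ~-+ : ∀ {i j k l} → i ~[ n ] j → k ~[ n ] l → i + k ~[ n ] j + l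
  ~-+ {i} {j} {k} {l} (p , q , eq) (r , s , eq′) = p + r , q + s , (begin
    i + k + (p + r) * n          ≡⟨ lem i k p r n ⟩
    (i + p * n) + (k + r * n)    ≡⟨ cong₂ _+_ eq eq′ ⟩
    (j + q * n) + (l + s * n)    ≡⟨ lem j l q s n ⟨
    j + l + (q + s) * n          ∎)
    where
    open ≡-Reasoning
    lem : ∀ i k p r n → i + k + (p + r) * n ≡ (i + p * n) + (k + r * n)
    lem = solve-∀

  ~-cancelˡ : ∀ i {j k} → i + j ~[ n ] i + k → j ~[ n ] k
  ~-cancelˡ i {j} {k} (p , q , eq) = p , q , +-cancelˡ-≡ i _ _ (begin
    i + (j + p * n)    ≡⟨ +-assoc i j _ ⟨
    i + j + p * n      ≡⟨ eq ⟩
    i + k + q * n      ≡⟨ +-assoc i k _ ⟩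
    i + (k + q * n)    ∎)
    where open ≡-Reasoning

  ~-suc : ∀ {j k} → j ~[ n ] k → suc j ~[ n ] suc k
  ~-suc = ~-+ {1} {1} (~-reflexive refl)

  ~-pred : ∀ {j k} → suc j ~[ n ] suc k → j ~[ n ] k
  ~-pred = ~-cancelˡ 1

  ~-turn : ∀ k → n + k ~[ n ] k
  ~-turn k = 0 , 1 , trans (+-identityʳ (n + k)) (trans (+-comm n k) (cong (k +_) (sym (+-identityʳ n))))

  module _ .{{_ : NonZero n}} where

    ~⇒%≡ : ∀ {j k} → j ~[ n ] k → j % n ≡ k % n
    ~⇒%≡ {j} {k} (p , q , eq) = begin
      j % n               ≡⟨ [m+kn]%n≡m%n j p n ⟨
      (j + p * n) % n     ≡⟨ cong (_% n) eq ⟩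
      (k + q * n) % n     ≡⟨ [m+kn]%n≡m%n k q n ⟩
      k % n               ∎
      where open ≡-Reasoning

    %-~ : ∀ k → k ~[ n ] k % n
    %-~ k = 0 , k ℕ./ n , trans (+-identityʳ k) (m≡m%n+[m/n]*n k n)

    %≡⇒~ : ∀ {j k} → j % n ≡ k % n → j ~[ n ] k
    %≡⇒~ {j} {k} eq = ~-trans (%-~ j) (~-trans (~-reflexive eq) (~-sym (%-~ k)))

    ~0⇒≡0 : ∀ {k} → k ~[ n ] 0 → k < n → k ≡ 0
    ~0⇒≡0 {k} k~0 k<n = trans (sym (m<n⇒m%n≡m k<n)) (trans (~⇒%≡ k~0) (m<n⇒m%n≡m (≤-trans (s≤s z≤n) k<n)))

    suc-pred-n : suc (n ∸ 1) ≡ n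
    suc-pred-n = m+[n∸m]≡n (ℕ.>-nonZero⁻¹ n)

    -- k * (n ∸ 1) represents − k.
    neg-+ : ∀ k → k + k * (n ∸ 1) ≡ k * n
    neg-+ k = trans (sym (*-suc k (n ∸ 1))) (cong (k *_) suc-pred-n)

    neg-~ : ∀ k → k + k * (n ∸ 1) ~[ n ] 0
    neg-~ k = 0 , k , trans (+-identityʳ _) (neg-+ k)

    ~-negˡ : ∀ {a b} → a + b ~[ n ] 0 → a ~[ n ] b * (n ∸ 1)
    ~-negˡ {a} {b} h = ~-cancelˡ b (~-trans (~-reflexive (+-comm b a)) (~-trans h (~-sym (neg-~ b))))

    ~-negʳ : ∀ {a b} → a ~[ n ] b * (n ∸ 1) → a + b ~[ n ] 0
    ~-negʳ {a} {b} h = ~-trans (~-reflexive (+-comm a b)) (~-trans (~-+ {b} {b} (~-reflexive refl) h) (neg-~ b))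

    neg-cong : ∀ {a b} → a ~[ n ] b → a * (n ∸ 1) ~[ n ] b * (n ∸ 1)
    neg-cong {a} {b} h = ~-negˡ (~-trans (~-+ {a * (n ∸ 1)} {a * (n ∸ 1)} (~-reflexive refl) (~-sym h))
      (~-trans (~-reflexive (+-comm (a * (n ∸ 1)) a)) (neg-~ a)))

    neg-injective : ∀ {a b} → a * (n ∸ 1) ~[ n ] b * (n ∸ 1) → a ~[ n ] b
    neg-injective {a} {b} h = ~-sym (~-cancelˡ (a * (n ∸ 1))
      (~-trans (~-negʳ h) (~-sym (~-trans (~-reflexive (+-comm (a * (n ∸ 1)) a)) (neg-~ a)))))

-- Cycles unrolled to ℕ

-- Indices are natural numbers up to congruence: the successor is plain `suc`, and a path may wind
-- around several times without any reduction modulo n.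
record Ring {n m : ℕ} (G : Graph n m) : Set where
  open Graph G
  field
    V : ℕ → Fin n
    A : ℕ → Fin m
    V-cong  : ∀ {j k} → j ~[ n ] k → V j ≡ V k
    V-inj   : ∀ {j k} → V j ≡ V k → j ~[ n ] k
    V-onto  : ∀ v → ∃[ k ] V k ≡ v
    A-cong  : ∀ {j k} → j ~[ n ] k → A j ≡ A k
    A-inj   : ∀ {j k} → A j ≡ A k → j ~[ n ] k
    A-onto  : ∀ e → ∃[ k ] A k ≡ e
    joins   : ∀ k → Joins (A k) (V k) (V (suc k))

open Ring

module _ {n m : ℕ} {G : Graph n m} where
  open Graph G

  Joins-sym : ∀ {e u v} → Joins e u v → Joins e v u
  Joins-sym (inj₁ p) = inj₂ p
  Joins-sym (inj₂ p) = inj₁ p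

  fromCycle : .{{_ : NonZero n}} → IsCycle G → Ring G
  fromCycle cyc = record
    { V      = λ k → to vertex (k mod n)
    ; A      = λ k → to edge (k mod n)
    ; V-cong = λ h → cong (to vertex) (mod-cong h)
    ; V-inj  = λ h → mod-injective (Bijection.injective vertex h)
    ; V-onto = λ v → onto vertex v
    ; A-cong = λ h → cong (to edge) (mod-cong h)
    ; A-inj  = λ h → mod-injective (Bijection.injective edge h)
    ; A-onto = λ e → onto edge e
    ; joins  = λ k → IsCycle.joins cyc (successor k)
    }
    where
    open IsCycle cyc using (vertex; edge)
    open Bijection using (to)

    toℕ-mod : ∀ k → toℕ (k mod n) ≡ k % n
    toℕ-mod k = toℕ-fromℕ< (m%n<n k n)

    mod-cong : ∀ {j k} → j ~[ n ] k → j mod n ≡ k mod n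
    mod-cong {j} {k} h = toℕ-injective (trans (toℕ-mod j) (trans (~⇒%≡ h) (sym (toℕ-mod k))))

    mod-injective : ∀ {j k} → j mod n ≡ k mod n → j ~[ n ] k
    mod-injective {j} {k} h = %≡⇒~ (trans (sym (toℕ-mod j)) (trans (cong toℕ h) (toℕ-mod k)))

    toℕ-mod-inverse : ∀ i → toℕ i mod n ≡ i
    toℕ-mod-inverse i = toℕ-injective (trans (toℕ-mod (toℕ i)) (m<n⇒m%n≡m (toℕ<n i)))

    onto : ∀ {m} (f : Fin n ⤖ Fin m) y → ∃[ k ] to f (k mod n) ≡ y
    onto f y with Bijection.strictlySurjective f y
    ... | i , eq = toℕ i , trans (cong (to f) (toℕ-mod-inverse i)) eq

    successor : ∀ k → CyclicSuc (k mod n) (suc k mod n)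
    successor k with m≤n⇒m<n∨m≡n (m%n<n k n)
    ... | inj₁ h = inj₁ (begin
      toℕ (suc k mod n)   ≡⟨ toℕ-mod (suc k) ⟩
      suc k % n           ≡⟨ ~⇒%≡ (~-suc (%-~ k)) ⟩
      suc (k % n) % n     ≡⟨ m<n⇒m%n≡m h ⟩
      suc (k % n)         ≡⟨ cong suc (toℕ-mod k) ⟨
      suc (toℕ (k mod n)) ∎)
      where open ≡-Reasoning
    ... | inj₂ h = inj₂ (trans (cong suc (toℕ-mod k)) h , (begin
      toℕ (suc k mod n)   ≡⟨ toℕ-mod (suc k) ⟩
      suc k % n           ≡⟨ ~⇒%≡ (~-suc (%-~ k)) ⟩
      suc (k % n) % n     ≡⟨ cong (_% n) h ⟩
      n % n               ≡⟨ n%n≡0 n ⟩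
      0                   ∎))
      where open ≡-Reasoning

  shift : .{{_ : NonZero n}} → ℕ → Ring G → Ring G
  shift s R = record
    { V      = λ k → V R (s + k)
    ; A      = λ k → A R (s + k)
    ; V-cong = λ h → V-cong R (~-+ {i = s} (~-reflexive refl) h)
    ; V-inj  = λ h → ~-cancelˡ s (V-inj R h)
    ; V-onto = onto (V R) (V-cong R) (V-onto R)
    ; A-cong = λ h → A-cong R (~-+ {i = s} (~-reflexive refl) h)
    ; A-inj  = λ h → ~-cancelˡ s (A-inj R h)
    ; A-onto = onto (A R) (A-cong R) (A-onto R)
    ; joins  = λ k → subst (Joins _ _) (cong (V R) (sym (+-suc s k))) (joins R (s + k))
    }
    where
    onto : ∀ {k} (f : ℕ → Fin k) → (∀ {i j} → i ~[ n ] j → f i ≡ f j) →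
           (∀ y → ∃[ i ] f i ≡ y) → ∀ y → ∃[ i ] f (s + i) ≡ y
    onto f f-cong f-onto y with f-onto y
    ... | i , eq = i + s * (n ∸ 1) , trans (f-cong around) eq
      where
      around : s + (i + s * (n ∸ 1)) ~[ n ] i
      around = ~-trans (~-reflexive (trans (sym (+-assoc s i _)) (trans (cong (_+ s * (n ∸ 1)) (+-comm s i)) (+-assoc i s _))))
        (~-trans (~-+ {i = i} (~-reflexive refl) (neg-~ s)) (~-reflexive (+-identityʳ i)))

  module _ .{{_ : NonZero n}} where

    -- Edge k of the reversed ring joins the old vertices -k and -k - 1, hence is the old edge -(k +
    -- 1) and not -k.
    opposite : Ring G → Ring G
    opposite R = record
      { V      = λ k → V R (k * (n ∸ 1))
      ; A      = λ k → A R (suc k * (n ∸ 1))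
      ; V-cong = λ h → V-cong R (neg-cong h)
      ; V-inj  = λ h → neg-injective (V-inj R h)
      ; V-onto = λ v → let k , eq = V-onto R v in k * (n ∸ 1) , trans (V-cong R (twice k)) eq
      ; A-cong = λ h → A-cong R (neg-cong (~-suc h))
      ; A-inj  = λ h → ~-pred (neg-injective (A-inj R h))
      ; A-onto = λ e → let k , eq = A-onto R e in k * (n ∸ 1) + (n ∸ 1) , trans (A-cong R
                   (~-trans (neg-cong (~-trans (~-reflexive (around (k * (n ∸ 1)))) (~-turn (k * (n ∸ 1)))))
                            (twice k))) eq
      ; joins  = λ k → Joins-sym (subst (Joins _ _) (V-cong R (back k)) (joins R (suc k * (n ∸ 1))))
      }
      where
      twice : ∀ k → k * (n ∸ 1) * (n ∸ 1) ~[ n ] k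
      twice k = ~-sym (~-negˡ (neg-~ k))
      around : ∀ j → suc (j + (n ∸ 1)) ≡ n + j
      around j = trans (sym (+-suc j (n ∸ 1))) (trans (cong (j +_) suc-pred-n) (+-comm j n))
      back : ∀ k → suc (suc k * (n ∸ 1)) ~[ n ] k * (n ∸ 1)
      back k = ~-trans (~-reflexive (cong (_+ k * (n ∸ 1)) suc-pred-n)) (~-turn (k * (n ∸ 1)))

-- The same cycle traversed the other way: vertex −b of R is vertex b of R′.
record Opposite {n m : ℕ} {G : Graph n m} (R R′ : Ring G) : Set where
  field
    opp-V : ∀ {a b} → a + b ~[ n ] 0 → V R a ≡ V R′ b
    opp-A : ∀ {a b} → suc a + b ~[ n ] 0 → A R a ≡ A R′ b

open Opposite

module _ {n m : ℕ} {G : Graph n m} where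
  open Graph G

  Opposite-sym : {R R′ : Ring G} → Opposite R R′ → Opposite R′ R
  Opposite-sym {R} {R′} o = record
    { opp-V = λ {a} {b} h → sym (opp-V o (~-trans (~-reflexive (+-comm b a)) h))
    ; opp-A = λ {a} {b} h → sym (opp-A o (~-trans (~-reflexive (cong suc (+-comm b a))) h))
    }

  module _ .{{_ : NonZero n}} where

    opposite-Opposite : ∀ (R : Ring G) → Opposite R (opposite R)
    opposite-Opposite R = record
      { opp-V = λ h → V-cong R (~-negˡ h)
      ; opp-A = λ {a} {b} h → A-cong R (~-negˡ (~-trans (~-reflexive (+-suc a b)) h))
      }

    V-opposite⁻¹ : {R R′ : Ring G} → Opposite R R′ → ∀ {a b} → V R a ≡ V R′ b → a + b ~[ n ] 0
    V-opposite⁻¹ {R} o {a} {b} h =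
      ~-trans (~-+ {i = a} {j = b * (n ∸ 1)} {k = b} {l = b} (V-inj R (trans h (sym (opp-V o −b+b)))) (~-reflexive refl)) −b+b
      where
      −b+b : b * (n ∸ 1) + b ~[ n ] 0
      −b+b = ~-trans (~-reflexive (+-comm (b * (n ∸ 1)) b)) (neg-~ b)

    neighbours : {R R′ : Ring G} → Opposite R R′ → ∀ {a b e v} → a + b ~[ n ] 0 → Joins e (V R a) v →
                 (e ≡ A R a × v ≡ V R (suc a)) ⊎ (e ≡ A R′ b × v ≡ V R′ (suc b))
    neighbours {R} {R′} o {a} {b} {e} {v} h J with A-onto R e
    ... | j , refl = Sum.map forwards backwards (unify J (joins R j))
      where
      unify : ∀ {x y x′ y′} → Joins e x y → Joins e x′ y′ → (x′ ≡ x × y′ ≡ y) ⊎ (y′ ≡ x × x′ ≡ y)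
      unify (inj₁ (refl , refl)) (inj₁ (refl , refl)) = inj₁ (refl , refl)
      unify (inj₁ (refl , refl)) (inj₂ (refl , refl)) = inj₂ (refl , refl)
      unify (inj₂ (refl , refl)) (inj₁ (refl , refl)) = inj₂ (refl , refl)
      unify (inj₂ (refl , refl)) (inj₂ (refl , refl)) = inj₁ (refl , refl)

      forwards : V R j ≡ V R a × V R (suc j) ≡ v → A R j ≡ A R a × v ≡ V R (suc a)
      forwards (p , q) = A-cong R (V-inj R p) , trans (sym q) (V-cong R (~-suc (V-inj R p)))

      backwards : V R (suc j) ≡ V R a × V R j ≡ v → A R j ≡ A R′ b × v ≡ V R′ (suc b)
      backwards (p , q) = opp-A o j+b , trans (sym q) (opp-V o (~-trans (~-reflexive (+-suc j b)) j+b))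
        where
        j+b : suc j + b ~[ n ] 0
        j+b = ~-trans (~-+ {i = suc j} {j = a} {k = b} {l = b} (V-inj R p) (~-reflexive refl)) h

    -- A ring comes with an arbitrary first edge and sense. It is rotated, and reversed if
    -- necessary, to agree with the way the algorithm's tour sets out.
    startingAt : ∀ e → Ring G → ∃[ R ] (A R 0 ≡ e × V R 1 ≡ tgt e)
    startingAt e R₀ with A-onto R₀ e
    ... | s , refl with joins (shift s R₀) 0
    ...   | inj₁ (_ , q) = shift s R₀ , A-cong R₀ (~-reflexive (+-identityʳ s)) , sym (trans (cong tgt (sym A≡)) q)
      where
      A≡ : A R₀ (s + 0) ≡ A R₀ s
      A≡ = A-cong R₀ (~-reflexive (+-identityʳ s))
    -- After reversal, edge 0 has index -1, represented by n - 1, so a rotation by that amount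
    -- brings it back to index 0.
    ...   | inj₂ (_ , q) = shift (n ∸ 1) R′
      , trans (sym A-eq) A≡
      , trans (sym V-eq) (sym (trans (cong tgt (sym A≡)) q))
      where
      A≡ : A R₀ (s + 0) ≡ A R₀ s
      A≡ = A-cong R₀ (~-reflexive (+-identityʳ s))
      R′ = opposite (shift s R₀)
      o : Opposite (shift s R₀) R′
      o = opposite-Opposite (shift s R₀)
      one : suc (n ∸ 1) ~[ n ] 0
      one = 0 , 1 , trans (+-identityʳ _) (trans suc-pred-n (sym (*-identityˡ n)))
      A-eq : A (shift s R₀) 0 ≡ A R′ (n ∸ 1 + 0)
      A-eq = opp-A o (~-trans (~-reflexive (cong suc (+-identityʳ (n ∸ 1)))) one)
      V-eq : V (shift s R₀) 0 ≡ V R′ (n ∸ 1 + 1)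
      V-eq = opp-V o (~-trans (~-reflexive (+-comm (n ∸ 1) 1)) one)

-- Temporal paths along an unrolled cycle

does⇒ : {P : Set} (d : Dec P) → does d ≡ true → P
does⇒ (yes p) _ = p

module Along {n m L : ℕ} (𝒢 : TemporalGraph n m L) .{{_ : NonZero n}} where
  open TemporalGraph 𝒢

  TimedEdge : Set
  TimedEdge = Fin L × Fin m

  InEdges : TemporalEdges m L → TimedEdge → Set
  InEdges F (t , e) = e ∈ F t

  -- Path R F τ a i: temporal paths in F from V a to V (a + i) over the edges
  -- A a, …, A (a + i − 1), with labels at least τ.
  data Path (R : Ring underlying) (F : TemporalEdges m L) : ℕ → ℕ → ℕ → Set where
    done : ∀ {τ a} → Path R F τ a 0
    go   : ∀ {τ a i} (t : Fin L) → τ ≤ toℕ t → A R a ∈ F t →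
           Path R F (toℕ t) (suc a) i → Path R F τ a (suc i)

  labels : ∀ {R F τ a i} → Path R F τ a i → List TimedEdge
  labels done                        = []
  labels {R} {a = a} (go t _ _ P)    = (t , A R a) ∷ labels P

  labels-In : ∀ {R F τ a i} (P : Path R F τ a i) → All (InEdges F) (labels P)
  labels-In done           = []
  labels-In (go t _ t∈F P) = t∈F ∷ labels-In P

  module _ {R : Ring underlying} {F : TemporalEdges m L} where

    later : ∀ {τ τ′ a i} → τ ≤ τ′ → Path R F τ′ a i → Path R F τ a i
    later _    done             = done
    later τ≤τ′ (go t τ′≤t t∈ P) = go t (≤-trans τ≤τ′ τ′≤t) t∈ P

    prefix : ∀ {τ a i j} → j ≤ i → Path R F τ a i → Path R F τ a j
    prefix z≤n       _              = done
    prefix (s≤s j≤i) (go t τ≤t t∈ P) = go t τ≤t t∈ (prefix j≤i P)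

    tail : ∀ {a i} → Path R F 0 a (suc i) → Path R F 0 (suc a) i
    tail (go t _ _ P) = later z≤n P

    drop : ∀ d {a i} → Path R F 0 a (d + i) → Path R F 0 (d + a) i
    drop zero    P = P
    drop (suc d) {a} {i} P = subst (λ b → Path R F 0 b i) (+-suc d a) (drop d (tail P))

    move-to : ∀ {τ a b i} → a ~[ n ] b → Path R F τ a i → Path R F τ b i
    move-to a~b done            = done
    move-to a~b (go t τ≤t t∈ P) = go t τ≤t (subst (_∈ F t) (A-cong R a~b) t∈) (move-to (~-suc a~b) P)

    path? : ∀ τ a i → Dec (Path R F τ a i)
    path? τ a zero    = yes done
    path? τ a (suc i) = map′
      (λ (t , (τ≤t , t∈) , P) → go t τ≤t t∈ P)
      (λ { (go t τ≤t t∈ P) → t , (τ≤t , t∈) , P })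
      (Finₚ.any? λ t → ((τ ≤? toℕ t) ×-dec (A R a ∈? F t)) ×-dec path? (toℕ t) (suc a) i)

    toTemporalPath : ∀ {τ a i} → Path R F τ a i → TemporalPath 𝒢 F τ (V R a) (V R (a + i))
    toTemporalPath {τ} {a} done = subst (λ b → TemporalPath 𝒢 F τ (V R a) (V R b)) (sym (+-identityʳ a)) stop
    toTemporalPath {τ} {a} {suc i} (go t τ≤t t∈ P) =
      subst (λ b → TemporalPath 𝒢 F τ (V R a) (V R b)) (sym (+-suc a i))
        (step (A R a) t (joins R a) t∈ τ≤t (toTemporalPath P))

  -- There is a path from V a to V (a + k) whose labels are at most τ, stated as
  -- what can be appended to it.
  Reaches : Ring underlying → TemporalEdges m L → ℕ → ℕ → ℕ → Set
  Reaches R F a k τ = ∀ {j} → Path R F τ (a + k) j → Path R F 0 a (k + j)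

  module _ {R : Ring underlying} {F : TemporalEdges m L} where

    reaches-zero : ∀ {a} → Reaches R F a 0 0
    reaches-zero {a} {j} P = subst (λ b → Path R F 0 b j) (+-identityʳ a) P

    reaches-later : ∀ {a k τ τ′} → τ ≤ τ′ → Reaches R F a k τ → Reaches R F a k τ′
    reaches-later τ≤τ′ r P = r (later τ≤τ′ P)

    reaches-suc : ∀ {a k τ} (t : Fin L) → τ ≤ toℕ t → A R (a + k) ∈ F t →
                  Reaches R F a k τ → Reaches R F a (suc k) (toℕ t)
    reaches-suc {a} {k} t τ≤t t∈ r {j} P =
      subst (Path R F 0 a) (+-suc k j) (r (go t τ≤t t∈ (subst (λ b → Path R F (toℕ t) b j) (+-suc a k) P)))

    reaches-path : ∀ {a k τ} → Reaches R F a k τ → Path R F 0 a k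
    reaches-path {a} {k} r = subst (Path R F 0 a) (+-identityʳ k) (r done)

  -- An occurrence of a label in a path, as a way to leave the path there.
  record Occurrence {R F τ a i} (P : Path R F τ a i) (x : TimedEdge) : Set where
    field
      p r    : ℕ
      extent : i ≡ p + suc r
      edge   : proj₂ x ≡ A R (a + p)
      splice : ∀ {j} → Path R F (toℕ (proj₁ x)) (suc (a + p)) j → Path R F τ a (suc p + j)
      rest   : Path R F (toℕ (proj₁ x)) (suc (a + p)) r

  occurrence : ∀ {R F τ a i} (P : Path R F τ a i) {x} → x ∈ˡ labels P → Occurrence P x
  occurrence {R} {F} {τ} {a} {suc i} (go t τ≤t t∈ P) (here refl) = record
    { p = 0 ; r = i ; extent = refl ; edge = cong (A R) (sym (+-identityʳ a))
    ; splice = λ {j} Q → go t τ≤t t∈ (subst (λ b → Path R F (toℕ t) (suc b) j) (+-identityʳ a) Q)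
    ; rest = subst (λ b → Path R F (toℕ t) (suc b) i) (sym (+-identityʳ a)) P
    }
  occurrence {R} {F} {τ} {a} {suc i} (go t τ≤t t∈ P) {x} (there x∈) = record
    { p = suc (p o) ; r = r o ; extent = cong suc (extent o)
    ; edge = trans (edge o) (cong (A R) (sym (+-suc a (p o))))
    ; splice = λ {j} Q → go t τ≤t t∈ (splice o (subst (λ b → Path R F (toℕ (proj₁ x)) (suc b) j) (+-suc a (p o)) Q))
    ; rest = subst (λ b → Path R F (toℕ (proj₁ x)) (suc b) (r o)) (sym (+-suc a (p o))) (rest o)
    }
    where
    open Occurrence
    o = occurrence P x∈

  -- Weights

  -- Repeated labels count repeatedly. So `wt` bounds the weight of any subgraph whose temporal
  -- edges it lists from above, but bounds from below only when the list has no repetition.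
  wt : List TimedEdge → ℚ
  wt []             = 0ℚ
  wt ((t , e) ∷ xs) = w t e ℚ.+ wt xs

  wt-++ : ∀ xs ys → wt (xs ++ ys) ≡ wt xs ℚ.+ wt ys
  wt-++ []             ys = sym (ℚₚ.+-identityˡ (wt ys))
  wt-++ ((t , e) ∷ xs) ys = trans (cong (w t e ℚ.+_) (wt-++ xs ys)) (sym (ℚₚ.+-assoc (w t e) (wt xs) (wt ys)))

  private
    at : TimedEdge → Fin L → Fin m → ℚ
    at (t , e) t′ e′ = if does (t Finₚ.≟ t′) then (if does (e Finₚ.≟ e′) then w t e else 0ℚ) else 0ℚ

    -- The weight of a list spread over the grid of all temporal edges, so that lists and subgraphs
    -- can be compared pointwise before summing.
    mass : List TimedEdge → Fin L → Fin m → ℚ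
    mass []       t e = 0ℚ
    mass (x ∷ xs) t e = at x t e ℚ.+ mass xs t e

    sum-zero : ∀ {k} (f : Fin k → ℚ) → (∀ i → f i ≡ 0ℚ) → sumℚ f ≡ 0ℚ
    sum-zero {zero}  f h = refl
    sum-zero {suc k} f h = trans (cong₂ ℚ._+_ (h zero) (sum-zero (f ∘ suc) (h ∘ suc))) refl

    sum-delta : ∀ {k} (i : Fin k) q (f : Fin k → ℚ) → f i ≡ q → (∀ j → i ≢ j → f j ≡ 0ℚ) → sumℚ f ≡ q
    sum-delta zero    q f fi h = trans (cong₂ ℚ._+_ fi (sum-zero (f ∘ suc) (λ j → h (suc j) λ ()))) (ℚₚ.+-identityʳ q)
    sum-delta (suc i) q f fi h = trans (cong₂ ℚ._+_ (h zero λ ())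
      (sum-delta i q (f ∘ suc) fi (λ j i≢j → h (suc j) (i≢j ∘ Finₚ.suc-injective)))) (ℚₚ.+-identityˡ q)

    sum-mono : ∀ {k} (f g : Fin k → ℚ) → (∀ i → f i ℚ.≤ g i) → sumℚ f ℚ.≤ sumℚ g
    sum-mono {zero}  f g h = ℚₚ.≤-refl
    sum-mono {suc k} f g h = ℚₚ.+-mono-≤ (h zero) (sum-mono (f ∘ suc) (g ∘ suc) (h ∘ suc))

    at-same : ∀ t e → at (t , e) t e ≡ w t e
    at-same t e with t Finₚ.≟ t
    ... | no t≢t = ⊥-elim (t≢t refl)
    ... | yes _  with e Finₚ.≟ e
    ...   | no e≢e = ⊥-elim (e≢e refl)
    ...   | yes _  = refl

    at-other : ∀ x t e → x ≢ (t , e) → at x t e ≡ 0ℚ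
    at-other (t′ , e′) t e x≢ with t′ Finₚ.≟ t
    ... | no _     = refl
    ... | yes refl with e′ Finₚ.≟ e
    ...   | no _     = refl
    ...   | yes refl = ⊥-elim (x≢ refl)

    sum-at : ∀ x → sumℚ (λ t → sumℚ λ e → at x t e) ≡ w (proj₁ x) (proj₂ x)
    sum-at (t , e) = sum-delta t (w t e) _
      (sum-delta e (w t e) _ (at-same t e) (λ e′ e≢ → at-other (t , e) t e′ λ { refl → e≢ refl }))
      (λ t′ t≢ → sum-zero _ (λ e′ → at-other (t , e) t′ e′ λ { refl → t≢ refl }))

    sum-mass : ∀ xs → sumℚ (λ t → sumℚ λ e → mass xs t e) ≡ wt xs
    sum-mass []       = sum-zero {L} _ (λ t → sum-zero {m} _ λ e → refl)
    sum-mass (x ∷ xs) = begin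
      sumℚ (λ t → sumℚ λ e → at x t e ℚ.+ mass xs t e)
        ≡⟨ sum-cong-≗ (λ t → ∑-distrib-+ (at x t) (mass xs t)) ⟩
      sumℚ (λ t → sumℚ (at x t) ℚ.+ sumℚ (mass xs t))
        ≡⟨ ∑-distrib-+ (λ t → sumℚ (at x t)) (λ t → sumℚ (mass xs t)) ⟩
      sumℚ (λ t → sumℚ (at x t)) ℚ.+ sumℚ (λ t → sumℚ (mass xs t))
        ≡⟨ cong₂ ℚ._+_ (sum-at x) (sum-mass xs) ⟩
      w (proj₁ x) (proj₂ x) ℚ.+ wt xs ∎
      where open ≡-Reasoning

    mass-∉ : ∀ xs t e → All (_≢ (t , e)) xs → mass xs t e ≡ 0ℚ
    mass-∉ []       t e []         = refl
    mass-∉ (x ∷ xs) t e (x≢ ∷ xs≢) = trans (cong₂ ℚ._+_ (at-other x t e x≢) (mass-∉ xs t e xs≢)) refl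

    indicator : TemporalEdges m L → Fin L → Fin m → ℚ
    indicator F t e = if Vec.lookup (F t) e then w t e else 0ℚ

    indicator-∈ : ∀ F t e → e ∈ F t → indicator F t e ≡ w t e
    indicator-∈ F t e e∈ rewrite []=⇒lookup e∈ = refl

    indicator-cases : ∀ F t e → (e ∈ F t × indicator F t e ≡ w t e) ⊎ indicator F t e ≡ 0ℚ
    indicator-cases F t e with Vec.lookup (F t) e in eq
    ... | true  = inj₁ (lookup⇒[]= e (F t) eq , refl)
    ... | false = inj₂ refl

  module _ {F : TemporalEdges m L} (F⊆E : ∀ t → F t ⊆ E t) where
    private
      indicator-nonneg : ∀ t e → 0ℚ ℚ.≤ indicator F t e
      indicator-nonneg t e with indicator-cases F t e
      ... | inj₁ (e∈ , eq) = ℚₚ.≤-trans (w-nonneg (F⊆E t e∈)) (ℚₚ.≤-reflexive (sym eq))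
      ... | inj₂ eq        = ℚₚ.≤-reflexive (sym eq)

      mass-≤-indicator : ∀ xs → Unique xs → All (InEdges F) xs → ∀ t e → mass xs t e ℚ.≤ indicator F t e
      mass-≤-indicator []              _          _          t e = indicator-nonneg t e
      mass-≤-indicator ((t′ , e′) ∷ xs) (x∉ ∷ u) (x∈F ∷ xs∈F) t e with t′ Finₚ.≟ t | e′ Finₚ.≟ e
      ... | yes refl | yes refl = ℚₚ.≤-reflexive (trans (cong (w t e ℚ.+_) (mass-∉ xs t e (All.map (λ x≢ eq → x≢ (sym eq)) x∉)))
                                    (trans (ℚₚ.+-identityʳ _) (sym (indicator-∈ F t e x∈F))))
      ... | yes refl | no  _    = ℚₚ.≤-trans (ℚₚ.≤-reflexive (ℚₚ.+-identityˡ _)) (mass-≤-indicator xs u xs∈F t e)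
      ... | no  _    | yes _    = ℚₚ.≤-trans (ℚₚ.≤-reflexive (ℚₚ.+-identityˡ _)) (mass-≤-indicator xs u xs∈F t e)
      ... | no  _    | no  _    = ℚₚ.≤-trans (ℚₚ.≤-reflexive (ℚₚ.+-identityˡ _)) (mass-≤-indicator xs u xs∈F t e)

    unique-≤-totalWeight : ∀ {xs} → Unique xs → All (InEdges F) xs → wt xs ℚ.≤ totalWeight 𝒢 F
    unique-≤-totalWeight {xs} u xs∈F = ℚₚ.≤-trans (ℚₚ.≤-reflexive (sym (sum-mass xs)))
      (sum-mono _ _ λ t → sum-mono _ _ λ e → mass-≤-indicator xs u xs∈F t e)

    totalWeight-nonneg : 0ℚ ℚ.≤ totalWeight 𝒢 F
    totalWeight-nonneg = unique-≤-totalWeight [] []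

  totalWeight-≤ : ∀ {F xs} → All (InEdges E) xs → (∀ t e → e ∈ F t → (t , e) ∈ˡ xs) → totalWeight 𝒢 F ℚ.≤ wt xs
  totalWeight-≤ {F} {xs} xs∈E F⊆xs = ℚₚ.≤-trans (sum-mono _ _ λ t → sum-mono _ _ λ e → indicator-≤ t e)
                                                (ℚₚ.≤-reflexive (sum-mass xs))
    where
    at-nonneg : ∀ x t e → InEdges E x → 0ℚ ℚ.≤ at x t e
    at-nonneg (t′ , e′) t e x∈E with t′ Finₚ.≟ t | e′ Finₚ.≟ e
    ... | yes refl | yes refl = w-nonneg x∈E
    ... | yes refl | no  _    = ℚₚ.≤-refl
    ... | no  _    | yes _    = ℚₚ.≤-refl
    ... | no  _    | no  _    = ℚₚ.≤-refl

    mass-nonneg : ∀ {xs} → All (InEdges E) xs → ∀ t e → 0ℚ ℚ.≤ mass xs t e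
    mass-nonneg []         t e = ℚₚ.≤-refl
    mass-nonneg (x∈ ∷ xs∈) t e = ℚₚ.+-mono-≤ {0ℚ} {_} {0ℚ} (at-nonneg _ t e x∈) (mass-nonneg xs∈ t e)

    ≤-mass : ∀ {xs} → All (InEdges E) xs → ∀ t e → (t , e) ∈ˡ xs → w t e ℚ.≤ mass xs t e
    ≤-mass {_ ∷ xs} (_ ∷ xs∈)  t e (here refl) = ℚₚ.≤-trans (ℚₚ.≤-reflexive (sym (ℚₚ.+-identityʳ _)))
      (ℚₚ.+-mono-≤ (ℚₚ.≤-reflexive (sym (at-same t e))) (mass-nonneg xs∈ t e))
    ≤-mass {x ∷ xs} (x∈ ∷ xs∈) t e (there x∈xs) = ℚₚ.≤-trans (ℚₚ.≤-reflexive (sym (ℚₚ.+-identityˡ _)))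
      (ℚₚ.+-mono-≤ (at-nonneg x t e x∈) (≤-mass xs∈ t e x∈xs))

    indicator-≤ : ∀ t e → indicator F t e ℚ.≤ mass xs t e
    indicator-≤ t e with indicator-cases F t e
    ... | inj₁ (e∈ , eq) = ℚₚ.≤-trans (ℚₚ.≤-reflexive eq) (≤-mass xs∈E t e (F⊆xs t e e∈))
    ... | inj₂ eq        = ℚₚ.≤-trans (ℚₚ.≤-reflexive eq) (mass-nonneg xs∈E t e)

  -- Plans for one direction

  -- The path from V k has len k edges.  If free k holds, it is the tail of the
  -- path from the previous vertex.
  record HalfPlan (R : Ring underlying) (F : TemporalEdges m L) : Set where
    field
      len           : ℕ → ℕ
      free          : ℕ → Bool
      len-≤         : ∀ k → len k ≤ n + (n + n)
      len-periodic  : ∀ k → len (n + k) ≡ len k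
      free-periodic : ∀ k → free (n + k) ≡ free k
      path          : ∀ k → Path R F 0 k (len k)
      free-step     : ∀ k → free (suc k) ≡ true → len k ≡ suc (len (suc k))

    paid : ℕ → List TimedEdge
    paid k = if free k then [] else labels (path k)

    paid-free : ∀ {k} → free k ≡ true → paid k ≡ []
    paid-free {k} h = cong (λ c → if c then [] else labels (path k)) h

    paid-bought : ∀ {k} → free k ≡ false → paid k ≡ labels (path k)
    paid-bought {k} h = cong (λ c → if c then [] else labels (path k)) h

    ∈-paid : ∀ k {x} → x ∈ˡ paid k → free k ≡ false × x ∈ˡ labels (path k)
    ∈-paid k x∈ with free k
    ... | false = refl , x∈

    -- Any list of distinct residues is allowed, because one direction meets its indices in
    -- increasing and the other in decreasing order.
    CostsAtMost : ℚ → Set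
    CostsAtMost q = ∀ us → AllPairs (λ j k → ¬ j ~[ n ] k) us → wt (concatMap paid us) ℚ.≤ q

  open HalfPlan

  -- Serves the direction that is idle when the other one makes two laps.
  trivialPlan : ∀ {R F} → HalfPlan R F
  trivialPlan = record
    { len = λ _ → 0 ; free = λ _ → false ; len-≤ = λ _ → z≤n
    ; len-periodic = λ _ → refl ; free-periodic = λ _ → refl
    ; path = λ _ → done ; free-step = λ _ ()
    }

  trivialPlan-cost : ∀ {R F} → CostsAtMost (trivialPlan {R} {F}) 0ℚ
  trivialPlan-cost {R} {F} []       _         = ℚₚ.≤-refl
  trivialPlan-cost {R} {F} (u ∷ us) (_ ∷ us≁) = trivialPlan-cost {R} {F} us us≁

  ~-next : ∀ a b {k} → a ~[ n ] a + suc b → b < k → suc k ≤ n → ⊥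
  ~-next a b a~ b<k k<n with ~0⇒≡0 (~-sym (~-cancelˡ a (~-trans (~-reflexive (+-identityʳ a)) a~))) (≤-trans (s≤s b<k) k<n)
  ... | ()

  -- Within one lap the underlying edges already differ, whatever the times.
  lap-unique : ∀ {R F τ a i} (P : Path R F τ a i) → i ≤ n → Unique (labels P)
  lap-unique done _ = []
  lap-unique {R} {F} {a = a} {suc i} (go t τ≤t t∈ P) i<n =
    All.tabulate (λ x∈ eq → fresh (occurrence P x∈) (cong proj₂ eq)) ∷ lap-unique P (≤-trans (n≤1+n _) i<n)
    where
    open Occurrence
    fresh : ∀ {x} → Occurrence P x → A R a ≢ proj₂ x
    fresh o eq = ~-next a (p o) (~-trans (A-inj R (trans eq (edge o))) (~-reflexive (sym (+-suc a (p o)))))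
      (subst (p o <_) (sym (extent o)) (m<m+n (p o) (s≤s z≤n))) i<n

  split : ∀ {R F τ a} i {j} (P : Path R F τ a (i + j)) →
          ∃[ P₁ ] ∃[ τ′ ] ∃[ b ] ∃[ P₂ ] labels P ≡ labels {R} {F} {τ} {a} {i} P₁ ++ labels {R} {F} {τ′} {b} {j} P₂
  split zero    P = done , _ , _ , P , refl
  split {R} {a = a} (suc i) (go t τ≤t t∈ P) with split i P
  ... | P₁ , τ′ , b , P₂ , eq = go t τ≤t t∈ P₁ , τ′ , b , P₂ , cong ((t , A R a) ∷_) eq

  module _ {F : TemporalEdges m L} (F⊆E : ∀ t → F t ⊆ E t) where

    two-laps-≤ : ∀ {R τ a i} (P : Path R F τ a i) → i ≡ n + n →
                 wt (labels P) ℚ.≤ totalWeight 𝒢 F ℚ.+ totalWeight 𝒢 F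
    two-laps-≤ P refl with split n P
    ... | P₁ , _ , _ , P₂ , eq = ℚₚ.≤-trans (ℚₚ.≤-reflexive (trans (cong wt eq) (wt-++ (labels P₁) (labels P₂))))
      (ℚₚ.+-mono-≤ (unique-≤-totalWeight F⊆E (lap-unique P₁ ≤-refl) (labels-In P₁))
                   (unique-≤-totalWeight F⊆E (lap-unique P₂ ≤-refl) (labels-In P₂)))

    -- Only vertex 0 buys. A vertex with residue k inherits a tail of length 2n - k > n, which
    -- covers the cycle by itself.
    module TwoLaps {R : Ring underlying} (P : Path R F 0 0 (n + n)) where
      private
        %≤2n : ∀ k → k % n ≤ n + n
        %≤2n k = ≤-trans (<⇒≤ (m%n<n k n)) (m≤m+n n n)

        periodic : ∀ k → (n + k) % n ≡ k % n
        periodic k = ~⇒%≡ (~-turn k)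

        isZero : ℕ → Bool
        isZero k = does (k ℕₚ.≟ 0)

        next : ∀ k → not (isZero (suc k % n)) ≡ true → n + n ∸ k % n ≡ suc (n + n ∸ suc k % n)
        next k h with m≤n⇒m<n∨m≡n (m%n<n k n)
        ... | inj₁ h′ rewrite trans (~⇒%≡ (~-suc (%-~ k))) (m<n⇒m%n≡m h′) =
              +-∸-assoc 1 {n + n} {suc (k % n)} (≤-trans (m%n<n k n) (m≤m+n n n))
        ... | inj₂ h′ rewrite trans (~⇒%≡ (~-suc (%-~ k))) (trans (cong (_% n) h′) (n%n≡0 n)) = case h of λ ()

      twoLapsPlan : HalfPlan R F
      twoLapsPlan = record
        { len  = λ k → n + n ∸ k % n
        ; free = λ k → not (isZero (k % n))
        ; len-≤ = λ k → ≤-trans (m∸n≤m (n + n) (k % n)) (m≤n+m (n + n) n)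
        ; len-periodic  = λ k → cong (n + n ∸_) (periodic k)
        ; free-periodic = λ k → cong (λ j → not (isZero j)) (periodic k)
        ; path = λ k → move-to (~-trans (~-reflexive (+-identityʳ (k % n))) (~-sym (%-~ k)))
                   (drop (k % n) (subst (Path R F 0 0) (sym (m+[n∸m]≡n (%≤2n k))) P))
        ; free-step = next
        }

      -- Among pairwise incongruent indices at most one is a multiple of n, and only multiples of n
      -- are charged.
      twoLapsPlan-cost : CostsAtMost twoLapsPlan (totalWeight 𝒢 F ℚ.+ totalWeight 𝒢 F)
      twoLapsPlan-cost [] _ = ℚₚ.+-mono-≤ {0ℚ} {_} {0ℚ} (totalWeight-nonneg F⊆E) (totalWeight-nonneg F⊆E)
      twoLapsPlan-cost (u ∷ us) (u≁ ∷ us≁) = cases (u % n) refl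
        where
        free-suc : ∀ v j → v % n ≡ suc j → paid twoLapsPlan v ≡ []
        free-suc v j eq = paid-free twoLapsPlan {v} (cong (λ i → not (isZero i)) eq)

        nothing : ∀ vs → All (λ v → ¬ u ~[ n ] v) vs → u % n ≡ 0 → concatMap (paid twoLapsPlan) vs ≡ []
        nothing []       _          _  = refl
        nothing (v ∷ vs) (u≁v ∷ u≁) u0 = head (v % n) refl
          where
          head : ∀ j → v % n ≡ j → concatMap (paid twoLapsPlan) (v ∷ vs) ≡ []
          head zero    eq = ⊥-elim (u≁v (%≡⇒~ (trans u0 (sym eq))))
          head (suc j) eq = cong₂ _++_ (free-suc v j eq) (nothing vs u≁ u0)

        cases : ∀ j → u % n ≡ j →
                wt (concatMap (paid twoLapsPlan) (u ∷ us)) ℚ.≤ totalWeight 𝒢 F ℚ.+ totalWeight 𝒢 F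
        cases zero eq = ℚₚ.≤-trans
          (ℚₚ.≤-reflexive (trans (cong wt (cong₂ _++_ (paid-bought twoLapsPlan {u} (cong (λ i → not (isZero i)) eq)) (nothing us u≁ eq)))
                          (trans (wt-++ (labels (path twoLapsPlan u)) []) (ℚₚ.+-identityʳ _))))
          (two-laps-≤ (path twoLapsPlan u) (cong (n + n ∸_) eq))
        cases (suc j) eq = ℚₚ.≤-trans (ℚₚ.≤-reflexive (cong wt (cong (_++ concatMap (paid twoLapsPlan) us) (free-suc u j eq))))
                                      (twoLapsPlan-cost us us≁)

    -- `bounded` makes a search up to three turns find true maxima. Without such a bound the reach
    -- could be infinite, and switching paths at a common label would give no contradiction.
    module Maximal {R : Ring underlying} (bounded : ∀ a → ¬ Path R F 0 a (n + (n + n))) where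
      private
        search : ℕ → ℕ → ℕ
        search a zero    = 0
        search a (suc k) with path? {R} {F} 0 a (suc k)
        ... | yes _ = suc k
        ... | no  _ = search a k

        search-path : ∀ a k → Path R F 0 a (search a k)
        search-path a zero    = done
        search-path a (suc k) with path? {R} {F} 0 a (suc k)
        ... | yes P = P
        ... | no  _ = search-path a k

        search-max : ∀ a k {i} → Path R F 0 a i → i ≤ k → i ≤ search a k
        search-max a zero    P i≤ = i≤
        search-max a (suc k) P i≤ with path? {R} {F} 0 a (suc k)
        ... | yes _ = i≤
        ... | no ¬P with m≤n⇒m<n∨m≡n i≤
        ...   | inj₁ (s≤s i≤k) = search-max a k P i≤k
        ...   | inj₂ refl      = ⊥-elim (¬P P)

        search-≤ : ∀ a k → search a k ≤ k
        search-≤ a zero    = z≤n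
        search-≤ a (suc k) with path? {R} {F} 0 a (suc k)
        ... | yes _ = ≤-refl
        ... | no  _ = m≤n⇒m≤1+n (search-≤ a k)

      reach : ℕ → ℕ
      reach a = search a (n + (n + n))

      reach-path : ∀ a → Path R F 0 a (reach a)
      reach-path a = search-path a (n + (n + n))

      reach-max : ∀ {a i} → Path R F 0 a i → i ≤ reach a
      reach-max {a} {i} P with i ≤? n + (n + n)
      ... | yes i≤ = search-max a (n + (n + n)) P i≤
      ... | no  i≰ = ⊥-elim (bounded a (prefix (<⇒≤ (≰⇒> i≰)) P))

      reach-cong : ∀ {a b} → a ~[ n ] b → reach a ≡ reach b
      reach-cong {a} {b} a~b = ≤-antisym (reach-max (move-to a~b (reach-path a)))
                                         (reach-max (move-to (~-sym a~b) (reach-path b)))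

      -- Removing d edges from a maximal path leaves a path from the vertex d steps on.
      reach-drop : ∀ d a → reach a ≤ d + reach (d + a)
      reach-drop d a with d ≤? reach a
      ... | yes d≤ = ≤-trans (≤-reflexive (sym (m+[n∸m]≡n d≤))) (+-monoʳ-≤ d (reach-max
                       (drop d (subst (Path R F 0 a) (sym (m+[n∸m]≡n d≤)) (reach-path a)))))
      ... | no  d≰ = ≤-trans (<⇒≤ (≰⇒> d≰)) (m≤m+n d _)

      private
        previous : ∀ k → suc (n ∸ 1 + k) ~[ n ] k
        previous k = ~-trans (~-reflexive (cong (_+ k) suc-pred-n)) (~-turn k)

      maximalPlan : HalfPlan R F
      maximalPlan = record
        { len  = reach
        -- `n ∸ 1 + k` represents k - 1. The test says that the maximal paths from both vertices end
        -- at the same place.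
        ; free = λ k → does (reach (n ∸ 1 + k) ℕₚ.≟ suc (reach k))
        ; len-≤ = λ k → search-≤ k (n + (n + n))
        ; len-periodic = λ k → reach-cong (~-turn k)
        ; free-periodic = λ k → cong₂ (λ i j → does (i ℕₚ.≟ suc j))
            (reach-cong (~-+ {i = n ∸ 1} (~-reflexive refl) (~-turn k))) (reach-cong (~-turn k))
        ; path = reach-path
        ; free-step = λ k → free-step′ k
        }
        where
        free-step′ : ∀ k → does (reach (n ∸ 1 + suc k) ℕₚ.≟ suc (reach (suc k))) ≡ true →
                     reach k ≡ suc (reach (suc k))
        free-step′ k h = trans (reach-cong (~-sym (~-trans (~-reflexive (+-suc (n ∸ 1) k)) (previous k))))
          (does⇒ (reach (n ∸ 1 + suc k) ℕₚ.≟ suc (reach (suc k))) h)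

      private
        Paid : ℕ → Set
        Paid k = reach (n ∸ 1 + k) ≢ suc (reach k)

        open Occurrence

        module _ {u v x} (P : Occurrence (reach-path u) x) (Q : Occurrence (reach-path v) x) where

          meet : suc (u + p P) ~[ n ] suc (v + p Q)
          meet = ~-suc (A-inj R (trans (sym (edge P)) (edge Q)))

          -- Switching to the other path at a common label cannot exceed the maximum.
          rest-≤ : r Q ≤ r P
          rest-≤ = +-cancelˡ-≤ (suc (p P)) _ _ (≤-trans (reach-max (splice P (move-to (~-sym meet) (rest Q))))
            (≤-reflexive (trans (extent P) (+-suc (p P) (r P)))))

        equal-ends : ∀ {u v x} (P : Occurrence (reach-path u) x) (Q : Occurrence (reach-path v) x) → r P ≡ r Q
        equal-ends P Q = ≤-antisym (rest-≤ Q P) (rest-≤ P Q)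

        -- If the common label lies d > 0 edges deeper in the path from u, then v lies on that path
        -- and both paths have the same end. All maximal paths from vertices in between are squeezed
        -- to this end too, in particular that of the predecessor of v, so v would not pay.
        paid-first : ∀ {u v x} → Paid v → (P : Occurrence (reach-path u) x) (Q : Occurrence (reach-path v) x) →
                     p Q ≤ p P → u ~[ n ] v
        paid-first {u} {v} paid-v P Q q≤p = cases (p P ∸ p Q) (m∸n+n≡m q≤p)
          where
          u+d~v : ∀ d → d + p Q ≡ p P → d + u ~[ n ] v
          u+d~v d eq = ~-cancelˡ (p Q) (~-trans (~-reflexive (trans (lem (p Q) d u) (cong (u +_) eq)))
            (~-trans (~-pred (meet P Q)) (~-reflexive (+-comm v (p Q)))))
            where
            lem : ∀ q d u → q + (d + u) ≡ u + (d + q)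
            lem = solve-∀
          reach-d : ∀ d → d + p Q ≡ p P → reach u ≡ d + reach v
          reach-d d eq = begin
            reach u                 ≡⟨ extent P ⟩
            p P + suc (r P)         ≡⟨ cong₂ (λ i j → i + suc j) (sym eq) (equal-ends P Q) ⟩
            d + p Q + suc (r Q)     ≡⟨ +-assoc d (p Q) _ ⟩
            d + (p Q + suc (r Q))   ≡⟨ cong (d +_) (sym (extent Q)) ⟩
            d + reach v             ∎
            where open ≡-Reasoning
          cases : ∀ d → d + p Q ≡ p P → u ~[ n ] v
          cases zero    eq = u+d~v 0 eq
          cases (suc d) eq = ⊥-elim (paid-v (trans (reach-cong back) (≤-antisym before after)))
            where
            back : n ∸ 1 + v ~[ n ] d + u
            back = ~-pred (~-trans (previous v) (~-sym (u+d~v (suc d) eq)))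
            before : reach (d + u) ≤ suc (reach v)
            before = ≤-trans (reach-drop 1 (d + u)) (≤-reflexive (cong suc (reach-cong (u+d~v (suc d) eq))))
            after : suc (reach v) ≤ reach (d + u)
            after = +-cancelˡ-≤ d _ _ (≤-trans (≤-reflexive (trans (+-suc d (reach v)) (sym (reach-d (suc d) eq))))
                                               (reach-drop d u))

        paid-disjoint : ∀ {u v x} → Paid u → Paid v → x ∈ˡ labels (reach-path u) → x ∈ˡ labels (reach-path v) →
                        u ~[ n ] v
        paid-disjoint {u} {v} paid-u paid-v x∈u x∈v with occurrence (reach-path u) x∈u | occurrence (reach-path v) x∈v
        ... | P | Q with ≤-total (p Q) (p P)
        ...   | inj₁ q≤p = paid-first paid-v P Q q≤p
        ...   | inj₂ p≤q = ~-sym (paid-first paid-u Q P p≤q)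

        -- A label occurring twice would allow an endless path.
        tail-unique : ∀ {u τ a i} q → (∀ {j} → Path R F τ a j → Path R F 0 u (q + j)) → q + i ≡ reach u →
                      (P : Path R F τ a i) → Unique (labels P)
        tail-unique _ _ _ done = []
        tail-unique {u} {τ} {a} {suc i} q extend eq (go t τ≤t t∈ P) =
          All.tabulate (λ x∈ eq → fresh (occurrence P x∈) eq)
          ∷ tail-unique (suc q) (λ {j} Q → subst (Path R F 0 u) (+-suc q j) (extend (go t τ≤t t∈ Q)))
                        (trans (sym (+-suc q i)) eq) P
          where
          fresh : ∀ {x} → Occurrence P x → (t , A R a) ≢ x
          fresh o refl = <-irrefl refl (begin-strict
            reach u                         ≡⟨ eq ⟨
            q + suc i                       <⟨ +-monoʳ-< q (s≤s (s≤s (m≤n+m i (p o)))) ⟩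
            q + suc (suc (p o) + i)         ≤⟨ reach-max (extend (go t τ≤t t∈ (splice o (move-to (~-suc (A-inj R (edge o))) P)))) ⟩
            reach u                         ∎)
            where open ≤-Reasoning

        paid-unique : ∀ u → Unique (paid maximalPlan u)
        paid-unique u with does (reach (n ∸ 1 + u) ℕₚ.≟ suc (reach u))
        ... | true  = []
        ... | false = tail-unique 0 id refl (reach-path u)

        paid-In : ∀ u → All (InEdges F) (paid maximalPlan u)
        paid-In u with does (reach (n ∸ 1 + u) ℕₚ.≟ suc (reach u))
        ... | true  = []
        ... | false = labels-In (reach-path u)

        bought⇒Paid : ∀ u → free maximalPlan u ≡ false → Paid u
        bought⇒Paid u h eq = case trans (sym (dec-true (_ ℕₚ.≟ _) eq)) h of λ ()

      -- Purchases repeat no label, neither within one path nor across two, so together they weigh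
      -- at most as much as the set that contains them.
      maximalPlan-cost : CostsAtMost maximalPlan (totalWeight 𝒢 F)
      maximalPlan-cost us us≁ = unique-≤-totalWeight F⊆E
        (Uniqueₚ.concat⁺ (Allₚ.map⁺ (All.universal paid-unique us))
          (AllPairsₚ.map⁺ (AllPairs.map (λ {u} {v} u≁v {x} p → u≁v (disjoint {u} {v} {x} (proj₁ p) (proj₂ p))) us≁)))
        (Allₚ.concat⁺ (Allₚ.map⁺ (All.universal paid-In us)))
        where
        disjoint : ∀ {u v x} → x ∈ˡ paid maximalPlan u → x ∈ˡ paid maximalPlan v → u ~[ n ] v
        disjoint {u} {v} x∈u x∈v with ∈-paid maximalPlan u x∈u | ∈-paid maximalPlan v x∈v
        ... | hu , x∈u′ | hv , x∈v′ = paid-disjoint (bought⇒Paid u hu) (bought⇒Paid v hv) x∈u′ x∈v′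

  -- Temporal paths on the cycle

  -- An invariant of temporal paths that start at `V R a`. Such a path may turn back, so the current
  -- vertex is only required to lie somewhere in the two arcs; the arcs themselves never shrink.
  record Walked (R R′ : Ring underlying) (F : TemporalEdges m L) (a b τ : ℕ) (v : Fin n) : Set where
    constructor walked
    field
      hi lo : ℕ
      up    : Reaches R F a hi τ
      down  : Reaches R′ F b lo τ
      place : (∃[ p ] p ≤ hi × v ≡ V R (a + p)) ⊎ (∃[ q ] q ≤ lo × v ≡ V R′ (b + q))

  Walked-swap : ∀ {R R′ F a b τ v} → Walked R R′ F a b τ v → Walked R′ R F b a τ v
  Walked-swap (walked hi lo up down h) = walked lo hi down up (Sum.swap h)

  -- A temporal path stays inside an arc that is monotonically reachable on both sides.
  walk-up : ∀ {R R′ F a b τ v} → Opposite R R′ → a + b ~[ n ] 0 → ∀ hi lo →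
            Reaches R F a hi τ → Reaches R′ F b lo τ → ∀ p → p ≤ hi →
            ∀ e t → Joins e (V R (a + p)) v → e ∈ F t → τ ≤ toℕ t → Walked R R′ F a b (toℕ t) v
  walk-up {R} {R′} {F} {a} {b} {τ} {v} o a+b hi lo up down p p≤hi e t J e∈ τ≤t = cases p refl
    where
    forward : e ≡ A R (a + p) × v ≡ V R (suc (a + p)) → Walked R R′ F a b (toℕ t) v
    forward (refl , refl) with m≤n⇒m<n∨m≡n p≤hi
    ... | inj₁ p<hi = walked hi lo (reaches-later {R} {F} {a} {hi} τ≤t up) (reaches-later {R′} {F} {b} {lo} τ≤t down)
                             (inj₁ (suc p , p<hi , cong (V R) (sym (+-suc a p))))
    ... | inj₂ refl = walked (suc p) lo (reaches-suc {R} {F} {a} {p} t τ≤t e∈ up) (reaches-later {R′} {F} {b} {lo} τ≤t down)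
                             (inj₁ (suc p , ≤-refl , cong (V R) (sym (+-suc a p))))

    cases : ∀ p′ → p ≡ p′ → Walked R R′ F a b (toℕ t) v
    cases zero refl with neighbours o a+b (subst (λ c → Joins e (V R c) v) (+-identityʳ a) J)
    ... | inj₁ (e≡ , v≡) = forward (trans e≡ (cong (A R) (sym (+-identityʳ a)))
                                   , trans v≡ (cong (λ c → V R (suc c)) (sym (+-identityʳ a))))
    -- The step crosses the start into the opposite arc, which grows to length 1 if it was empty and
    -- is unchanged otherwise.
    ... | inj₂ (e≡ , v≡) = walked hi (lo ℕ.⊔ 1) (reaches-later {R} {F} {a} {hi} τ≤t up) (longer lo down)
                                  (inj₂ (1 , m≤n⊔m lo 1 , trans v≡ (cong (V R′) (sym (trans (+-suc b 0) (cong suc (+-identityʳ b)))))))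
      where
      longer : ∀ l → Reaches R′ F b l τ → Reaches R′ F b (l ℕ.⊔ 1) (toℕ t)
      longer zero    r = reaches-suc {R′} {F} {b} {0} t τ≤t (subst (_∈ F t) (trans e≡ (cong (A R′) (sym (+-identityʳ b)))) e∈) r
      longer (suc l) r = subst (λ k → Reaches R′ F b k (toℕ t)) (cong suc (sym (⊔-identityʳ l)))
                           (reaches-later {R′} {F} {b} {suc l} τ≤t r)
    cases (suc p′) refl with neighbours o (neg-~ (a + suc p′)) J
    ... | inj₁ f = forward f
    ... | inj₂ (_ , v≡) = walked hi lo (reaches-later {R} {F} {a} {hi} τ≤t up) (reaches-later {R′} {F} {b} {lo} τ≤t down)
        (inj₁ (p′ , ≤-trans (n≤1+n p′) p≤hi , trans v≡ (sym (opp-V o (~-trans (~-reflexive (lem a p′ _)) (neg-~ (a + suc p′)))))))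
      where
      lem : ∀ a p c → a + p + suc c ≡ a + suc p + c
      lem = solve-∀

  walk : ∀ {R R′ F a b τ u v} → Opposite R R′ → a + b ~[ n ] 0 → Walked R R′ F a b τ u →
         TemporalPath 𝒢 F τ u v → ∃[ τ′ ] Walked R R′ F a b τ′ v
  walk o a+b wk stop = _ , wk
  walk o a+b (walked hi lo up down (inj₁ (p , p≤ , refl))) (step e t J e∈ τ≤t P) =
    walk o a+b (walk-up o a+b hi lo up down p p≤ e t J e∈ τ≤t) P
  walk {a = a} {b} o a+b (walked hi lo up down (inj₂ (q , q≤ , refl))) (step e t J e∈ τ≤t P) =
    walk o a+b (Walked-swap (walk-up (Opposite-sym o) (~-trans (~-reflexive (+-comm b a)) a+b)
                                     lo hi down up q q≤ e t J e∈ τ≤t)) P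

  -- The vertex just beyond both arcs would be unreachable.
  arcs-cover : ∀ {R R′ F a b i j} → Opposite R R′ → Connects 𝒢 F → a + b ~[ n ] 0 →
               (∀ {k} → Path R F 0 a k → k ≤ i) → (∀ {k} → Path R′ F 0 b k → k ≤ j) → n ∸ 1 ≤ i + j
  arcs-cover {R} {R′} {F} {a} {b} {i} {j} o conn a+b max-i max-j with n ∸ 1 ≤? i + j
  ... | yes h = h
  ... | no  h = ⊥-elim (missed (proj₂ (walk o a+b
          (walked 0 0 (reaches-zero {R} {F} {a}) (reaches-zero {R′} {F} {b}) (inj₁ (0 , z≤n , cong (V R) (sym (+-identityʳ a)))))
          (conn (V R a) (V R (a + suc i))))))
    where
    short : suc (i + j) < n
    short = ≤-trans (s≤s (≰⇒> h)) (≤-reflexive suc-pred-n)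

    missed : ∀ {τ} → Walked R R′ F a b τ (V R (a + suc i)) → ⊥
    missed (walked hi lo up down (inj₁ (p , p≤hi , eq))) =
      ~-next (a + p) (i ∸ p) {suc i} back (s≤s (m∸n≤m i p)) (≤-trans (s≤s (s≤s (m≤m+n i j))) short)
      where
      p≤i : p ≤ i
      p≤i = ≤-trans p≤hi (max-i (reaches-path {R} {F} {a} {hi} up))
      back : a + p ~[ n ] a + p + suc (i ∸ p)
      back = ~-trans (~-sym (V-inj R eq)) (~-reflexive (begin
        a + suc i                 ≡⟨ cong (λ k → a + suc k) (m+[n∸m]≡n p≤i) ⟨
        a + suc (p + (i ∸ p))     ≡⟨ cong (a +_) (+-suc p (i ∸ p)) ⟨
        a + (p + suc (i ∸ p))     ≡⟨ +-assoc a p _ ⟨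
        a + p + suc (i ∸ p)       ∎))
        where open ≡-Reasoning
    missed (walked hi lo up down (inj₂ (q , q≤lo , eq))) = case ~0⇒≡0 i+q~0 i+q<n of λ ()
      where
      i+q<n : suc i + q < n
      i+q<n = ≤-trans (s≤s (s≤s (+-monoʳ-≤ i (≤-trans q≤lo (max-j (reaches-path {R′} {F} {b} {lo} down)))))) short
      i+q~0 : suc i + q ~[ n ] 0
      i+q~0 = ~-cancelˡ (a + b) (~-trans (~-reflexive (lem a b (suc i) q))
        (~-trans (V-opposite⁻¹ o eq) (~-sym (~-trans (~-reflexive (+-identityʳ (a + b))) a+b))))
        where
        lem : ∀ a b i q → a + b + (i + q) ≡ a + i + (b + q)
        lem = solve-∀

  Covered : Ring underlying → Ring underlying → TemporalEdges m L → ℕ → Set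
  Covered R R′ F k = ∃[ b ] ∃[ i ] ∃[ j ] (k + b ~[ n ] 0 × Path R F 0 k i × Path R′ F 0 b j × n ∸ 1 ≤ i + j)

  -- A target at clockwise distance d is at counterclockwise distance n - d, and d > i forces n - d
  -- ≤ j.
  covers⇒connects : ∀ {R R′ F} → Opposite R R′ → (∀ k → k < n → Covered R R′ F k) → Connects 𝒢 F
  covers⇒connects {R} {R′} {F} o cover u v with V-onto R u | V-onto R v
  ... | k₀ , refl | k′ , refl with cover (k₀ % n) (m%n<n k₀ n)
  ...   | b , i , j , k+b , P , Q , n≤ = subst₂ (TemporalPath 𝒢 F 0) (V-cong R (~-sym (%-~ k₀))) (V-cong R k+d) (cases (d ≤? i))
    where
    k = k₀ % n
    d = (k′ + k * (n ∸ 1)) % n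
    k+d : k + d ~[ n ] k′
    k+d = ~-trans (~-+ {i = k} (~-reflexive refl) (~-sym (%-~ (k′ + k * (n ∸ 1)))))
      (~-trans (~-reflexive (lem k k′ (k * (n ∸ 1)))) (~-trans (~-+ {i = k′} (~-reflexive refl) (neg-~ k)) (~-reflexive (+-identityʳ k′))))
      where
      lem : ∀ k k′ c → k + (k′ + c) ≡ k′ + (k + c)
      lem = solve-∀
    d<n : d < n
    d<n = m%n<n (k′ + k * (n ∸ 1)) n
    cases : Dec (d ≤ i) → TemporalPath 𝒢 F 0 (V R k) (V R (k + d))
    cases (yes d≤i) = toTemporalPath (prefix d≤i P)
    cases (no  d≰i) = subst₂ (TemporalPath 𝒢 F 0) (sym (opp-V o k+b)) (sym (opp-V o around)) (toTemporalPath (prefix n-d≤j Q))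
      where
      around : (k + d) + (b + (n ∸ d)) ~[ n ] 0
      around = ~-trans (~-reflexive (lem k d b (n ∸ d)))
        (~-trans (~-+ k+b (0 , 1 , cong (_+ 0) (m+[n∸m]≡n (<⇒≤ d<n)) )) (~-reflexive refl))
        where
        lem : ∀ k d b c → k + d + (b + c) ≡ k + b + (d + c)
        lem = solve-∀
      n-d≤j : n ∸ d ≤ j
      n-d≤j = begin
        n ∸ d           ≤⟨ ∸-monoʳ-≤ n (≰⇒> d≰i) ⟩
        n ∸ suc i       ≡⟨ ∸-+-assoc n 1 i ⟨
        n ∸ 1 ∸ i       ≤⟨ ∸-monoˡ-≤ i n≤ ⟩
        i + j ∸ i       ≡⟨ m+n∸m≡n i j ⟩
        j               ∎
        where open ≤-Reasoning

  -- The budget may be split as (W, W), (W + W, 0) or (0, W + W), where W is the weight of `F`; only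
  -- the sum is common to all cases.
  record TwoPlans (R R′ : Ring underlying) (F : TemporalEdges m L) : Set where
    field
      cw    : HalfPlan R F
      ccw   : HalfPlan R′ F
      q q′  : ℚ
      cw-cost  : CostsAtMost cw q
      ccw-cost : CostsAtMost ccw q′
      total : q ℚ.+ q′ ≡ totalWeight 𝒢 F ℚ.+ totalWeight 𝒢 F
      cover : ∀ {a b} → a + b ~[ n ] 0 → n ∸ 1 ≤ len cw a + len ccw b

  module _ {F : TemporalEdges m L} (feasible : Feasible 𝒢 F) where
    open Feasible feasible

    -- Paths depend only on the residue of their start, so n starts are tested. If V i has a path of
    -- three turns, discarding the n - i edges up to V 0 leaves at least two turns.
    long-path? : ∀ R → (Path R F 0 0 (n + n)) ⊎ (∀ a → ¬ Path R F 0 a (n + (n + n)))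
    long-path? R with Finₚ.any? {n} (λ i → path? {R} {F} 0 (toℕ i) (n + (n + n)))
    ... | no  none = inj₂ λ a P → none (a mod n , move-to (~-trans (%-~ a) (~-reflexive (sym (toℕ-fromℕ< _)))) P)
    ... | yes (i , P) = inj₁ (move-to (0 , 1 , cong (_+ 0) (m∸n+n≡m i≤n))
          (drop (n ∸ toℕ i) (prefix (≤-trans (+-monoˡ-≤ (n + n) (m∸n≤m n (toℕ i))) ≤-refl) P)))
      where
      i≤n : toℕ i ≤ n
      i≤n = <⇒≤ (toℕ<n i)

    twoPlans : ∀ {R R′} → Opposite R R′ → TwoPlans R R′ F
    twoPlans {R} {R′} o with long-path? R | long-path? R′
    ... | inj₁ P | _ = record
      { cw = TwoLaps.twoLapsPlan subgraph P ; ccw = trivialPlan {R′} {F}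
      ; cw-cost = TwoLaps.twoLapsPlan-cost subgraph P ; ccw-cost = trivialPlan-cost {R′} {F}
      ; total = ℚₚ.+-identityʳ _
      ; cover = λ {a} _ → ≤-trans (≤-trans (m∸n≤m n 1) (long a)) (m≤m+n _ 0)
      }
      where
      long : ∀ a → n ≤ n + n ∸ a % n
      long a = ≤-trans (≤-reflexive (sym (m+n∸n≡m n n))) (∸-monoʳ-≤ (n + n) (<⇒≤ (m%n<n a n)))
    ... | inj₂ _ | inj₁ P = record
      { cw = trivialPlan ; ccw = TwoLaps.twoLapsPlan subgraph P
      ; cw-cost = trivialPlan-cost {R} {F} ; ccw-cost = TwoLaps.twoLapsPlan-cost subgraph P
      ; total = ℚₚ.+-identityˡ _
      ; cover = λ {_} {b} _ → ≤-trans (m∸n≤m n 1) (long b)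
      }
      where
      long : ∀ a → n ≤ n + n ∸ a % n
      long a = ≤-trans (≤-reflexive (sym (m+n∸n≡m n n))) (∸-monoʳ-≤ (n + n) (<⇒≤ (m%n<n a n)))
    ... | inj₂ bounded | inj₂ bounded′ = record
      { cw = Maximal.maximalPlan subgraph bounded ; ccw = Maximal.maximalPlan subgraph bounded′
      ; cw-cost = Maximal.maximalPlan-cost subgraph bounded ; ccw-cost = Maximal.maximalPlan-cost subgraph bounded′
      ; total = refl
      ; cover = λ a+b → arcs-cover o connected a+b (Maximal.reach-max subgraph bounded) (Maximal.reach-max subgraph bounded′)
      }

-- Specification of the list operations

∈-concatMap-elim : {S R : Set} (f : S → List R) (xs : List S) {y : R} →
                   y ∈ˡ concatMap f xs → ∃[ x ] (x ∈ˡ xs × y ∈ˡ f x)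
∈-concatMap-elim f xs y∈ = find (∈-concatMap⁻ f {xs = xs} y∈)

∈-concatMap-intro : {S R : Set} (f : S → List R) {xs : List S} {x : S} {y : R} →
                    x ∈ˡ xs → y ∈ˡ f x → y ∈ˡ concatMap f xs
∈-concatMap-intro f x∈ y∈ = ∈-concatMap⁺ f (lose x∈ y∈)

≤ᵇ-true : ∀ {a b} → a ≤ b → (a ℕ.≤ᵇ b) ≡ true
≤ᵇ-true a≤b = Equivalence.to T-≡ (≤⇒≤ᵇ a≤b)

≤ᵇ-true⁻¹ : ∀ {a b} → (a ℕ.≤ᵇ b) ≡ true → a ≤ b
≤ᵇ-true⁻¹ {a} {b} eq = ≤ᵇ⇒≤ a b (Equivalence.from T-≡ eq)

∧-true : ∀ {a b} → a ≡ true → b ≡ true → a ∧ b ≡ true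
∧-true refl refl = refl

∧-true⁻¹ : ∀ {a b} → a ∧ b ≡ true → a ≡ true × b ≡ true
∧-true⁻¹ {true} {true} refl = refl , refl

==-refl : ∀ a → (a == a) ≡ true
==-refl a = ∧-true (≤ᵇ-true (≤-refl {a})) (≤ᵇ-true (≤-refl {a}))

==-true : ∀ {a b} → a ≡ b → (a == b) ≡ true
==-true {a} refl = ==-refl a

==-sound : ∀ {a b} → (a == b) ≡ true → a ≡ b
==-sound {a} {b} eq with ∧-true⁻¹ {a ℕ.≤ᵇ b} eq
... | p , q = ≤-antisym (≤ᵇ-true⁻¹ p) (≤ᵇ-true⁻¹ {b} {a} q)

enumerate-tabulate : {S : Set} → ∀ {k} (f : Fin k → S) →
                     enumerate (tabulate f) ≡ tabulate (λ i → toℕ i , f i)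
enumerate-tabulate {k = zero}  f = refl
enumerate-tabulate {k = suc k} f = cong ((0 , f zero) ∷_) (trans
  (cong (map (λ (i , y) → suc i , y)) (enumerate-tabulate (f ∘ suc))) (map-tabulate _ _))

∈-enumerate⁻ : {S : Set} → ∀ {k} (f : Fin k → S) {x} → x ∈ˡ enumerate (tabulate f) → ∃[ i ] x ≡ (toℕ i , f i)
∈-enumerate⁻ f x∈ = ∈-tabulate⁻ (subst (_ ∈ˡ_) (enumerate-tabulate f) x∈)

∈-enumerate⁺ : {S : Set} → ∀ {k} (f : Fin k → S) i → (toℕ i , f i) ∈ˡ enumerate (tabulate f)
∈-enumerate⁺ f i = subst (_ ∈ˡ_) (sym (enumerate-tabulate f)) (∈-tabulate⁺ i)

module WalksSpec (K P : Ty) (adj : El K → El K → Bool) where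
  open Walks K P adj

  best-sound : ∀ k tbl {e} → best k tbl ≡ inj₂ e → e ∈ˡ tbl × adj (proj₁ e) k ≡ true
  best-sound k (e₁ ∷ tbl) eq with adj (proj₁ e₁) k in adj-eq | best k tbl in best-eq
  best-sound k (e₁ ∷ tbl) refl | true | inj₁ _ = here refl , adj-eq
  best-sound k (e₁ ∷ tbl) eq | true | inj₂ e₂ with proj₁ (proj₂ e₁) ℚ.≤ᵇ proj₁ (proj₂ e₂)
  best-sound k (e₁ ∷ tbl) refl | true | inj₂ e₂ | true  = here refl , adj-eq
  best-sound k (e₁ ∷ tbl) refl | true | inj₂ e₂ | false = let p , q = best-sound k tbl best-eq in there p , q
  best-sound k (e₁ ∷ tbl) refl | false | inj₂ e₂ = let p , q = best-sound k tbl best-eq in there p , q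

  best-optimal : ∀ k {tbl e} → e ∈ˡ tbl → adj (proj₁ e) k ≡ true →
                 ∃[ e′ ] (best k tbl ≡ inj₂ e′ × proj₁ (proj₂ e′) ℚ.≤ proj₁ (proj₂ e))
  best-optimal k {e₁ ∷ tbl} (here refl) h with adj (proj₁ e₁) k | best k tbl
  best-optimal k {e₁ ∷ tbl} (here refl) refl | true | inj₁ _ = e₁ , refl , ℚₚ.≤-refl
  best-optimal k {e₁ ∷ tbl} (here refl) refl | true | inj₂ e₂ with proj₁ (proj₂ e₁) ℚ.≤ᵇ proj₁ (proj₂ e₂) in ≤-eq
  ... | true  = e₁ , refl , ℚₚ.≤-refl
  ... | false = e₂ , refl , [ (λ ≤ → case trans (sym ≤-eq) (Equivalence.to T-≡ (ℚₚ.≤⇒≤ᵇ ≤)) of λ ()) , id ]′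
                              (ℚₚ.≤-total (proj₁ (proj₂ e₁)) (proj₁ (proj₂ e₂)))
  best-optimal k {e₁ ∷ tbl} {e} (there e∈) h with adj (proj₁ e₁) k | best k tbl | best-optimal k e∈ h
  ... | false | _ | e₂ , refl , ≤e = e₂ , refl , ≤e
  ... | true  | _ | e₂ , refl , ≤e with proj₁ (proj₂ e₁) ℚ.≤ᵇ proj₁ (proj₂ e₂) in ≤-eq
  ...   | true  = e₁ , refl , ℚₚ.≤-trans (ℚₚ.≤ᵇ⇒≤ (Equivalence.from T-≡ ≤-eq)) ≤e
  ...   | false = e₂ , refl , ≤e

  advance-sound : ∀ {tbl layer e} → e ∈ˡ advance tbl layer →
    ∃[ k ] ∃[ w ] ∃[ p ] ∃[ e₀ ] ((k , w , p) ∈ˡ layer × e₀ ∈ˡ tbl × adj (proj₁ e₀) k ≡ true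
      × e ≡ (k , w ℚ.+ proj₁ (proj₂ e₀) , p ∷ proj₂ (proj₂ e₀)))
  advance-sound {tbl} {layer} e∈ with ∈-concatMap-elim (extend tbl) layer e∈
  ... | (k , w , p) , nd∈ , e∈′ with best k tbl in eq
  advance-sound {tbl} e∈ | (k , w , p) , nd∈ , here refl | inj₂ e₀ =
    k , w , p , e₀ , nd∈ , proj₁ (best-sound k tbl eq) , proj₂ (best-sound k tbl eq) , refl

  advance-optimal : ∀ {tbl layer k w p e₀} → (k , w , p) ∈ˡ layer → e₀ ∈ˡ tbl → adj (proj₁ e₀) k ≡ true →
    ∃[ e ] (e ∈ˡ advance tbl layer × proj₁ e ≡ k × proj₁ (proj₂ e) ℚ.≤ w ℚ.+ proj₁ (proj₂ e₀))
  advance-optimal {tbl} {layer} {k} {w} {p} nd∈ e₀∈ h with best-optimal k e₀∈ h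
  ... | e′ , eq , ≤e₀ = (k , w ℚ.+ proj₁ (proj₂ e′) , p ∷ proj₂ (proj₂ e′))
    , ∈-concatMap-intro (extend tbl) nd∈ in-extend
    , refl , ℚₚ.+-monoʳ-≤ w ≤e₀
    where
    in-extend : (k , w ℚ.+ proj₁ (proj₂ e′) , p ∷ proj₂ (proj₂ e′)) ∈ˡ extend tbl (k , w , p)
    in-extend rewrite eq = here refl

-- Specification of the algorithm

module Spec {n m L : ℕ} (𝒢 : TemporalGraph n m L) .{{_ : NonZero n}} where
  open TemporalGraph 𝒢
  open Along 𝒢

  row : Fin L → El (list (unit ⊕ rat))
  row t = tabulate (λ e → if Vec.lookup (E t) e then inj₂ (w t e) else inj₁ tt)

  rows : El (list (list (unit ⊕ rat)))
  rows = tabulate row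

  edges : El (list (nat ⊗ nat))
  edges = tabulate (λ e → toℕ (src e) , toℕ (tgt e))

  code : TimedEdge → El Label
  code (t , e) = toℕ t , toℕ e

  code-injective : ∀ {x y} → code x ≡ code y → x ≡ y
  code-injective eq = cong₂ _,_ (toℕ-injective (cong proj₁ eq)) (toℕ-injective (cong proj₂ eq))

  node : Fin L → Fin m → El (Node nat Label)
  node t e = toℕ t , w t e , code (t , e)

  labelledEdges-sound : ∀ {nd} → nd ∈ˡ labelledEdges rows → ∃[ t ] ∃[ e ] (e ∈ E t × nd ≡ node t e)
  labelledEdges-sound nd∈
    with ∈-concatMap-elim (λ (t , row) → concatMap (λ (e , a) → labelledEdge t e a) (enumerate row)) (enumerate rows) nd∈
  ... | _ , r∈ , nd∈₁ with ∈-enumerate⁻ row r∈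
  ... | t , refl with ∈-concatMap-elim (λ (e , a) → labelledEdge (toℕ t) e a) (enumerate (row t)) nd∈₁
  ... | _ , a∈ , nd∈₂ with ∈-enumerate⁻ {k = m} _ a∈
  ... | e , refl with Vec.lookup (E t) e in eq
  labelledEdges-sound nd∈ | _ , _ , _ | t , refl | _ , _ , here refl | e , refl | true =
    t , e , lookup⇒[]= e (E t) eq , refl

  labelledEdges-complete : ∀ {t e} → e ∈ E t → node t e ∈ˡ labelledEdges rows
  labelledEdges-complete {t} {e} e∈ = ∈-concatMap-intro _
    (∈-enumerate⁺ row t) (∈-concatMap-intro _ (∈-enumerate⁺ _ e) available)
    where
    available : node t e ∈ˡ labelledEdge (toℕ t) (toℕ e) (if Vec.lookup (E t) e then inj₂ (w t e) else inj₁ tt)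
    available rewrite []=⇒lookup e∈ = here refl

  column-sound : ∀ {e nd} → nd ∈ˡ column rows (toℕ e) → ∃[ t ] (e ∈ E t × nd ≡ node t e)
  column-sound {e} nd∈
    with ∈-concatMap-elim (λ nd → if proj₂ (proj₂ (proj₂ nd)) == toℕ e then nd ∷ [] else []) (labelledEdges rows) nd∈
  ... | nd′ , nd′∈ , nd∈′ with labelledEdges-sound nd′∈
  ... | t , e′ , e′∈ , refl with toℕ e′ == toℕ e in eq
  column-sound {e} nd∈ | _ , _ , here refl | t , e′ , e′∈ , refl | true with toℕ-injective {i = e′} {e} (==-sound eq)
  ... | refl = t , e′∈ , refl

  column-complete : ∀ {t e} → e ∈ E t → node t e ∈ˡ column rows (toℕ e)
  column-complete {t} {e} e∈ = ∈-concatMap-intro _ (labelledEdges-complete e∈) same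
    where
    same : node t e ∈ˡ (if toℕ e == toℕ e then node t e ∷ [] else [])
    same rewrite ==-refl (toℕ e) = here refl

  data Follows (R : Ring underlying) : ℕ → El (list (list (Node nat Label))) → Set where
    []  : ∀ {a} → Follows R a []
    _∷_ : ∀ {a c cs} → c ≡ column rows (toℕ (A R a)) → Follows R (suc a) cs → Follows R a (c ∷ cs)

  module _ {R : Ring underlying} where

    follows-cong : ∀ {a b cs} → a ~[ n ] b → Follows R a cs → Follows R b cs
    follows-cong a~b []         = []
    follows-cong a~b (refl ∷ F) = cong (λ e → column rows (toℕ e)) (A-cong R a~b) ∷ follows-cong (~-suc a~b) F

    follows-++ : ∀ {a b cs ds} → a + length cs ~[ n ] b → Follows R a cs → Follows R b ds → Follows R a (cs ++ ds)
    follows-++ {a} h []              G = follows-cong (~-sym (~-trans (~-reflexive (sym (+-identityʳ a))) h)) G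
    follows-++ {a} h (_∷_ {cs = cs} eq F) G =
      eq ∷ follows-++ (~-trans (~-reflexive (sym (+-suc a (length cs)))) h) F G

  -- Index `a` of one ring and index `length cs + b` of the other denote the vertex between the two
  -- lists. Each column carried across raises the former and lowers the latter by one.
  follows-reverse : ∀ {R R′ a b cs ds} → Opposite R R′ → Follows R a cs → Follows R′ (length cs + b) ds →
                    a + (length cs + b) ~[ n ] 0 → Follows R′ b (cs ʳ++ ds)
  follows-reverse o []                         G h = G
  follows-reverse {a = a} {b} o (_∷_ {cs = cs} eq F) G h =
    follows-reverse o F (trans eq (cong (λ e → column rows (toℕ e)) (opp-A o h′)) ∷ G) h′
    where
    h′ : suc a + (length cs + b) ~[ n ] 0
    h′ = ~-trans (~-reflexive (sym (+-suc a (length cs + b)))) h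

  module FromColumns {R : Ring underlying} (a : ℕ) where
    private module PS = WalksSpec nat Label ℕ._≤ᵇ_

    -- `reaches` is quantified over `F` because the selected subgraph is known only once a whole
    -- tour has been chosen.
    record PathEntry (k : ℕ) (e : El (Entry nat Label)) : Set where
      field
        xs      : List TimedEdge
        payload : proj₂ (proj₂ e) ≡ map code xs
        xs∈E    : All (InEdges E) xs
        weight  : proj₁ (proj₂ e) ≡ wt xs
        reaches : ∀ F → All (InEdges F) xs → Reaches R F a k (proj₁ e)

    Table : Set
    Table = El (list (Entry nat Label))

    tables-sound : ∀ {cs} k (tbl : Table) (all : El Tables) → Follows R (a + k) cs →
      (∀ {e} → e ∈ˡ tbl → PathEntry k e) →
      (∀ {k′ t e} → (k′ , t) ∈ˡ all → e ∈ˡ t → PathEntry k′ e) →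
      ∀ {k′ t e} → (k′ , t) ∈ˡ proj₂ (proj₂ (foldl pathStep (k , tbl , all) cs)) → e ∈ˡ t → PathEntry k′ e
    tables-sound k tbl all []        h₁ h₂ = h₂
    tables-sound k tbl all (refl ∷ F) h₁ h₂ = tables-sound (suc k) _ _ (follows-cong (~-reflexive (sym (+-suc a k))) F) h₁′
      λ { (here refl) → h₁′ ; (there t∈) → h₂ t∈ }
      where
      h₁′ : ∀ {e} → e ∈ˡ Paths.advance tbl (column rows (toℕ (A R (a + k)))) → PathEntry (suc k) e
      h₁′ e∈ with PS.advance-sound {tbl} {column rows (toℕ (A R (a + k)))} e∈
      ... | _ , _ , _ , e₀ , nd∈ , e₀∈ , τ≤t , refl with column-sound {A R (a + k)} nd∈
      ... | t , t∈E , refl = record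
        { xs = (t , A R (a + k)) ∷ xs
        ; payload = cong (_ ∷_) payload
        ; xs∈E = t∈E ∷ xs∈E
        ; weight = cong (w t (A R (a + k)) ℚ.+_) weight
        ; reaches = λ { F (t∈F ∷ xs∈F) → reaches-suc {R} {F} {a} {k} t (≤ᵇ-true⁻¹ τ≤t) t∈F (reaches F xs∈F) }
        }
        where open PathEntry (h₁ e₀∈)

    tables-keep : ∀ cs s {x} → x ∈ˡ proj₂ (proj₂ s) → x ∈ˡ proj₂ (proj₂ (foldl pathStep s cs))
    tables-keep []       s x∈ = x∈
    tables-keep (c ∷ cs) s x∈ = tables-keep cs (pathStep s c) (there x∈)

    module _ {F : TemporalEdges m L} (F⊆E : ∀ t → F t ⊆ E t) where

      -- Exchange argument along `P`: after each edge the table holds an entry ending at the same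
      -- time as `P` and costing no more than what `P` has added to `e₀`. The rest of `P` can be
      -- appended to it, since only the last time matters.
      tables-optimal : ∀ {cs τ b j} k (tbl : Table) (all : El Tables) → Follows R b cs → (k , tbl) ∈ˡ all →
        (P : Path R F τ b j) → j ≤ length cs → ∀ {e₀} → e₀ ∈ˡ tbl → proj₁ e₀ ≤ τ →
        ∃[ t ] ∃[ e ] ((k + j , t) ∈ˡ proj₂ (proj₂ (foldl pathStep (k , tbl , all) cs)) × e ∈ˡ t
          × proj₁ (proj₂ e) ℚ.≤ wt (labels P) ℚ.+ proj₁ (proj₂ e₀))
      tables-optimal {cs} k tbl all F t∈ done j≤ {e₀} e₀∈ _ =
        tbl , e₀ , tables-keep cs (k , tbl , all) (subst (λ i → (i , tbl) ∈ˡ all) (sym (+-identityʳ k)) t∈) , e₀∈ ,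
        ℚₚ.≤-reflexive (sym (ℚₚ.+-identityˡ _))
      tables-optimal {_ ∷ cs} {b = b} {suc j} k tbl all (refl ∷ F) t∈ (go t τ≤t b∈ P) (s≤s j≤) {e₀} e₀∈ e₀≤
        with PS.advance-optimal (column-complete (F⊆E t b∈)) e₀∈ (≤ᵇ-true (≤-trans e₀≤ τ≤t))
      ... | e₁ , e₁∈ , refl , e₁≤ with tables-optimal (suc k) _ _ F (here refl) P j≤ e₁∈ ≤-refl
      ... | t′ , e , t′∈ , e∈ , e≤ = t′ , e , subst (λ i → (i , t′) ∈ˡ final) (sym (+-suc k j)) t′∈ , e∈ , (begin
        proj₁ (proj₂ e)                                               ≤⟨ e≤ ⟩
        wt (labels P) ℚ.+ proj₁ (proj₂ e₁)                            ≤⟨ ℚₚ.+-monoʳ-≤ (wt (labels P)) e₁≤ ⟩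
        wt (labels P) ℚ.+ (w t (A R b) ℚ.+ proj₁ (proj₂ e₀))          ≡⟨ ℚₚ.+-assoc (wt (labels P)) _ _ ⟨
        wt (labels P) ℚ.+ w t (A R b) ℚ.+ proj₁ (proj₂ e₀)            ≡⟨ cong (ℚ._+ _) (ℚₚ.+-comm (wt (labels P)) _) ⟩
        w t (A R b) ℚ.+ wt (labels P) ℚ.+ proj₁ (proj₂ e₀)            ∎)
        where
        open ℚₚ.≤-Reasoning
        final : El Tables
        final = proj₂ (proj₂ (foldl pathStep (pathStep (k , tbl , all) (column rows (toℕ (A R b)))) cs))

    -- A free option claims a length with no path behind it; a path is promised only if it was
    -- bought. The claim is redeemed by the neighbours in a closed tour.
    record OptionSpec (o : El Option) : Set where
      field
        xs      : List TimedEdge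
        payload : proj₂ (proj₂ o) ≡ map code xs
        xs∈E    : All (InEdges E) xs
        weight  : proj₁ (proj₂ o) ≡ wt xs
        bought  : proj₂ (proj₁ o) ≡ false → ∀ F → All (InEdges F) xs → Path R F 0 a (proj₁ (proj₁ o))

    options-sound : ∀ {cs o} → Follows R a cs → o ∈ˡ options cs → OptionSpec o
    options-sound {cs} F o∈ with ∈-concatMap-elim tableOptions (tables cs) o∈
    ... | (k , tbl) , t∈ , o∈′ with ∈-concatMap-elim (variants k) tbl o∈′
    ... | e , e∈ , o∈″ = cases o∈″
      where
      initial : ∀ {e} → e ∈ˡ noPath → PathEntry 0 e
      initial (here refl) = record { xs = [] ; payload = refl ; xs∈E = [] ; weight = refl ; reaches = λ F _ → reaches-zero {R} {F} {a} }
      entry : PathEntry k e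
      entry = tables-sound 0 noPath _ (follows-cong (~-reflexive (sym (+-identityʳ a))) F) initial
                (λ { (here refl) → initial }) t∈ e∈
      open PathEntry entry
      cases : ∀ {o} → o ∈ˡ variants k e → OptionSpec o
      cases (here refl) = record
        { xs = xs ; payload = payload ; xs∈E = xs∈E ; weight = weight
        ; bought = λ _ F xs∈F → reaches-path {R} {F} {a} {k} (reaches F xs∈F) }
      cases (there (here refl)) = record
        { xs = [] ; payload = refl ; xs∈E = [] ; weight = refl ; bought = λ () }

    module _ {F : TemporalEdges m L} (F⊆E : ∀ t → F t ⊆ E t) (H : HalfPlan R F) where
      open HalfPlan H

      options-optimal : ∀ {cs} → Follows R a cs → n + (n + n) ≤ length cs →
        ∃[ c ] ∃[ p ] (((len a , free a) , c , p) ∈ˡ options cs × c ℚ.≤ wt (paid a))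
      options-optimal {cs} G 3n≤ with tables-optimal F⊆E 0 noPath ((0 , noPath) ∷ []) G (here refl) (path a)
                                        (≤-trans (len-≤ a) 3n≤) (here refl) z≤n
      ... | tbl , e , t∈ , e∈ , e≤ with free a
      ... | true  = 0ℚ , []
                  , ∈-concatMap-intro tableOptions t∈ (∈-concatMap-intro (variants (len a)) e∈ (there (here refl)))
                  , ℚₚ.≤-refl
      ... | false = proj₁ (proj₂ e) , proj₂ (proj₂ e)
                  , ∈-concatMap-intro tableOptions t∈ (∈-concatMap-intro (variants (len a)) e∈ (here refl))
                  , ℚₚ.≤-trans e≤ (ℚₚ.≤-reflexive (ℚₚ.+-identityʳ _))

if-true : ∀ {c b} → (c ≡ true → b ≡ true) → (if c then b else true) ≡ true
if-true {true}  h = h refl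
if-true {false} h = refl

if-true⁻¹ : ∀ {c b} → (if c then b else true) ≡ true → c ≡ true → b ≡ true
if-true⁻¹ {true} h refl = h

start-tabulate : ∀ {k} (f : Fin k → ℕ × ℕ) (i : Fin k) → toℕ i ≡ 0 → start (tabulate f) ≡ (proj₂ (f i) , 0)
start-tabulate f zero _ = refl

toList-tabulate : {S : Set} → ∀ {k} (f : Fin k → S) → Vec.toList (Vec.tabulate f) ≡ tabulate f
toList-tabulate {k = zero}  f = refl
toList-tabulate {k = suc k} f = cong (f zero ∷_) (toList-tabulate (f ∘ suc))

edges≡vertices : ∀ {n m} {G : Graph n m} → IsCycle G → m ≡ n
edges≡vertices {n} {m} cyc = ≤-antisym
  (Finₚ.injective⇒≤ {f = λ e → proj₁ (surjective e)} λ {x} {y} eq →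
     trans (sym (proj₂ (surjective x))) (trans (cong (Bijection.to edge) eq) (proj₂ (surjective y))))
  (Finₚ.injective⇒≤ (Bijection.injective edge))
  where
  open IsCycle cyc using (edge)
  surjective = Bijection.strictlySurjective edge

positions-iterate : ∀ cs → positions cs ≡ iterate move (origin cs) (length cs)
positions-iterate cs = trans (cong reverse (go (origin cs) [] cs)) (reverse-involutive _)
  where
  go : ∀ p out (xs : El (list (list (Node nat Label)))) → proj₂ (foldl (λ s _ → positionStep s) (p , out) xs) ≡
       iterate move p (length xs) ʳ++ out
  go p out []       = refl
  go p out (_ ∷ xs) = go (move p) (p ∷ out) xs

-- The algorithm's tour follows the cycle

module Correctness {n m L : ℕ} (𝒢 : TemporalGraph n m L) .{{_ : NonZero n}} (2≤n : 2 ≤ n) where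
  open TemporalGraph 𝒢
  open Along 𝒢
  open Spec 𝒢

  along : Ring underlying → ℕ → ℕ → List ℕ
  along R a zero    = []
  along R a (suc k) = toℕ (A R a) ∷ along R (suc a) k

  length-along : ∀ R a k → length (along R a k) ≡ k
  length-along R a zero    = refl
  length-along R a (suc k) = cong suc (length-along R (suc a) k)

  along-follows : ∀ {R} a k → Follows R a (map (column rows) (along R a k))
  along-follows a zero    = []
  along-follows a (suc k) = refl ∷ along-follows (suc a) k

  along-shift : ∀ R a k → along R (suc a) k ≡ along (shift 1 R) a k
  along-shift R a zero    = refl
  along-shift R a (suc k) = cong (toℕ (A R (suc a)) ∷_) (along-shift R (suc a) k)

  module _ {R : Ring underlying} where

    -- Exactly two edges meet at V (k + 1): A k, which the scan skips as the edge just used, and A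
    -- (k + 1). All other edges pass the result on, so any hit is the target, and A (k + 1) is a
    -- hit.
    follow-correct : ∀ k → follow edges (toℕ (V R (suc k)) , toℕ (A R k)) ≡ (toℕ (V R (suc (suc k))) , toℕ (A R (suc k)))
    follow-correct k = trans
      (cong (foldr (followStep s) s) (enumerate-tabulate (λ e → toℕ (src e) , toℕ (tgt e))))
      (scan id (A R (suc k) , refl))
      where
      s target : ℕ × ℕ
      s = toℕ (V R (suc k)) , toℕ (A R k)
      target = toℕ (V R (suc (suc k))) , toℕ (A R (suc k))

      entry : Fin m → ℕ × ℕ × ℕ
      entry e = toℕ e , toℕ (src e) , toℕ (tgt e)

      distinct : A R k ≢ A R (suc k)
      distinct eq = ~-next k 0 (~-trans (A-inj R eq) (~-reflexive (+-comm 1 k))) (s≤s z≤n) 2≤n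

      incident : ∀ {e v} → e ≢ A R k → Joins e (V R (suc k)) v → (toℕ v , toℕ e) ≡ target
      incident e≢ J with neighbours (opposite-Opposite R) (neg-~ (suc k)) J
      ... | inj₁ (refl , refl) = refl
      ... | inj₂ (refl , _)    = ⊥-elim (e≢ (sym (opp-A (opposite-Opposite R) (neg-~ (suc k)))))

      ends : src (A R (suc k)) ≡ V R (suc k) ⊎ tgt (A R (suc k)) ≡ V R (suc k)
      ends with joins R (suc k)
      ... | inj₁ (p , _) = inj₁ p
      ... | inj₂ (_ , p) = inj₂ p

      step-cases : ∀ e next → (e ≢ A R (suc k) × followStep s (entry e) next ≡ next) ⊎ followStep s (entry e) next ≡ target
      step-cases e next with toℕ e == toℕ (A R k) in eq₁
      ... | true = inj₁ ((λ { refl → distinct (sym (toℕ-injective (==-sound eq₁))) }) , refl)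
      ... | false with toℕ (src e) == toℕ (V R (suc k)) in eq₂
      ...   | true = inj₂ (incident (λ e≡ → case trans (sym eq₁) (==-true (cong toℕ e≡)) of λ ())
                                    (inj₁ (toℕ-injective (==-sound eq₂) , refl)))
      ...   | false with toℕ (tgt e) == toℕ (V R (suc k)) in eq₃
      ...     | true = inj₂ (incident (λ e≡ → case trans (sym eq₁) (==-true (cong toℕ e≡)) of λ ())
                                      (inj₂ (refl , toℕ-injective (==-sound eq₃))))
      ...     | false = inj₁ ((λ { refl → [ (λ p → case trans (sym eq₂) (==-true (cong toℕ p)) of λ ())
                                          , (λ p → case trans (sym eq₃) (==-true (cong toℕ p)) of λ ()) ]′ ends }) , refl)

      scan : ∀ {j} (g : Fin j → Fin m) → ∃[ i ] g i ≡ A R (suc k) → foldr (followStep s) s (tabulate (entry ∘ g)) ≡ target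
      scan {suc j} g (i , eq) with step-cases (g zero) (foldr (followStep s) s (tabulate (entry ∘ g ∘ suc)))
      ... | inj₂ found = found
      scan {suc j} g (zero , eq)  | inj₁ (≢ , _)    = ⊥-elim (≢ eq)
      scan {suc j} g (suc i , eq) | inj₁ (_ , skip) = trans skip (scan (g ∘ suc) (i , eq))

    tour-along : ∀ e → toℕ e ≡ 0 → A R 0 ≡ e → V R 1 ≡ tgt e → tour edges ≡ along R 1 m
    tour-along e e≡0 A≡ V≡ = begin
      tour edges                                        ≡⟨ cong (λ s → reverse (walked-from s)) start≡ ⟩
      reverse (walked-from (toℕ (V R 1) , toℕ (A R 0))) ≡⟨ cong reverse (scan 0 [] edges) ⟩
      reverse (reverse (along R 1 (length edges)))      ≡⟨ reverse-involutive _ ⟩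
      along R 1 (length edges)                          ≡⟨ cong (along R 1) (length-tabulate _) ⟩
      along R 1 m                                       ∎
      where
      open ≡-Reasoning
      walked-from : ℕ × ℕ → List ℕ
      walked-from s = proj₂ (foldl (λ s _ → tourStep edges s) (s , []) edges)
      start≡ : start edges ≡ (toℕ (V R 1) , toℕ (A R 0))
      start≡ = trans (start-tabulate _ e e≡0) (cong₂ _,_ (cong toℕ (sym V≡)) (trans (sym e≡0) (cong toℕ (sym A≡))))
      scan : ∀ k out (xs : List (ℕ × ℕ)) →
           proj₂ (foldl (λ s _ → tourStep edges s) ((toℕ (V R (suc k)) , toℕ (A R k)) , out) xs) ≡
           along R (suc k) (length xs) ʳ++ out
      scan k out []       = refl
      scan k out (_ ∷ xs) = trans (cong (λ s → proj₂ (foldl (λ s _ → tourStep edges s) (s , proj₂ s ∷ out) xs)) (follow-correct k))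
                                (scan (suc k) (toℕ (A R (suc k)) ∷ out) xs)

  tour-correct : IsTemporalCycle 𝒢 →
    ∃[ R ] (Follows R 0 (map (column rows) (tour edges)) × length (map (column rows) (tour edges)) ≡ n)
  tour-correct cyc with startingAt e₀ (fromCycle cyc)
    where
    e₀ : Fin m
    e₀ = fromℕ< {0} (≤-trans (≤-trans (n≤1+n 1) 2≤n) (≤-reflexive (sym (edges≡vertices cyc))))
  -- The tour records the edge after edge 0 first, hence a rotation by one.
  ... | R , A≡ , V≡ = shift 1 R
    , subst (Follows (shift 1 R) 0) (cong (map (column rows)) (sym order)) (along-follows 0 m)
    , trans (length-map _ (tour edges)) (trans (cong length order) (trans (length-along (shift 1 R) 0 m) (edges≡vertices cyc)))
    where
    order : tour edges ≡ along (shift 1 R) 0 m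
    order = trans (tour-along _ (toℕ-fromℕ< _) A≡ V≡) (along-shift R 0 m)

  -- Positions around the cycle and the plans available there

  module Oriented {R R′ : Ring underlying} (o : Opposite R R′) where

    -- Index u of R and index b of R′ denote the same vertex.
    record At (u b : ℕ) (p : El Position) : Set where
      field
        index          : u + b ~[ n ] 0
        ahead-follows  : Follows R u (proj₂ p)
        behind-follows : Follows R′ b (proj₁ p)
        ahead-long     : n + (n + n) ≤ length (proj₂ p)
        behind-long    : n + (n + n) ≤ length (proj₁ p)

    -- Three turns, the largest length allowed in a plan. Visiting the n positions consumes at most
    -- one of the four turns laid out ahead, so this many columns always remain.
    B : ℕ
    B = n + (n + n)

    -- The counterclockwise index falls while `u` rises; writing it as the number of remaining
    -- positions plus `B` avoids subtraction.
    data Located : ℕ → ℕ → El (list Position) → Set where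
      []  : ∀ {u} → Located u 0 []
      _∷_ : ∀ {u l p ps} → At u (suc l + B) p → Located (suc u) l ps → Located u (suc l) (p ∷ ps)

    At-move : ∀ {u k p} → At u (suc k + B) p → length (proj₂ p) ≡ suc k + B →
              At (suc u) (k + B) (move p) × length (proj₂ (move p)) ≡ k + B
    At-move {u} {k} {behind , c ∷ cs} at eq with At.ahead-follows at
    ... | c≡ ∷ F = record
      { index = index′
      ; ahead-follows = F
      ; behind-follows = trans c≡ (cong (λ e → column rows (toℕ e)) (opp-A o index′)) ∷ behind-follows
      ; ahead-long = ≤-trans (m≤n+m B k) (≤-reflexive (sym (suc-injective eq)))
      ; behind-long = m≤n⇒m≤1+n behind-long
      } , suc-injective eq
      where
      open At at
      index′ : suc u + (k + B) ~[ n ] 0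
      index′ = ~-trans (~-reflexive (sym (+-suc u (k + B)))) index

    iterate-located : ∀ k {u p} → At u (k + B) p → length (proj₂ p) ≡ k + B → Located u k (iterate move p k)
    iterate-located zero    at eq = []
    iterate-located (suc k) at eq = at ∷ iterate-located k (proj₁ (At-move {k = k} at eq)) (proj₂ (At-move {k = k} at eq))

    positions-located : ∀ {cs} → Follows R 0 cs → length cs ≡ n → Located 0 n (positions cs)
    positions-located {cs} F len≡ = subst (Located 0 n)
      (sym (trans (positions-iterate cs) (cong (iterate move (origin cs)) len≡)))
      (iterate-located n (record
        { index = nB~0
        ; ahead-follows = F⁴
        ; behind-follows = follows-reverse o F⁴ [] (~-trans (~-+ (~-trans (~-reflexive turns≡) nB~0) nB~0) (~-reflexive refl))
        ; ahead-long = ≤-trans (m≤n+m B n) (≤-reflexive (sym turns≡))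
        ; behind-long = ≤-trans (m≤n+m B n) (≤-reflexive (sym (trans (length-reverse turns) turns≡)))
        }) turns≡)
      where
      turns = cs ++ cs ++ cs ++ cs
      lap : length cs ~[ n ] 0
      lap = 0 , 1 , trans (+-identityʳ _) (trans len≡ (sym (+-identityʳ n)))
      F⁴ : Follows R 0 turns
      F⁴ = follows-++ lap F (follows-++ lap F (follows-++ lap F F))
      turns≡ : length turns ≡ n + B
      turns≡ = trans (length-++ cs) (cong₂ _+_ len≡
        (trans (length-++ cs) (cong₂ _+_ len≡ (trans (length-++ cs) (cong₂ _+_ len≡ len≡)))))
      nB~0 : n + B ~[ n ] 0
      nB~0 = 0 , 4 , lem n
        where
        lem : ∀ n → n + (n + (n + n)) + 0 ≡ n + (n + (n + (n + 0)))
        lem = solve-∀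

    Key : Set
    Key = El PlanKey

    cwLength ccwLength : Key → ℕ
    cwLength  ((i , _) , _) = i
    ccwLength (_ , (j , _)) = j

    record Fact (F : TemporalEdges m L) (u b : ℕ) (K : Key) : Set where
      field
        cw-bought  : proj₂ (proj₁ K) ≡ false → Path R F 0 u (cwLength K)
        ccw-bought : proj₂ (proj₂ K) ≡ false → Path R′ F 0 b (ccwLength K)
        cover      : n ∸ 1 ≤ cwLength K + ccwLength K

    record PlanSpec (u b : ℕ) (nd : El Plan) : Set where
      field
        zs      : List TimedEdge
        payload : both (proj₂ (proj₂ nd)) ≡ map code zs
        zs∈E    : All (InEdges E) zs
        weight  : proj₁ (proj₂ nd) ≡ wt zs
        fact    : ∀ F → All (InEdges F) zs → Fact F u b (proj₁ nd)

    plans-sound : ∀ {u b p nd} → At u b p → nd ∈ˡ plans n p → PlanSpec u b nd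
    plans-sound {u} {b} {behind , ahead} at nd∈
      with ∈-concatMap-elim (λ a → concatMap (combine n a) (options behind)) (options ahead) nd∈
    ... | o₁ , o₁∈ , nd∈₁ with ∈-concatMap-elim (combine n o₁) (options behind) nd∈₁
    ... | o₂ , o₂∈ , nd∈₂ with n ∸ 1 ℕ.≤ᵇ proj₁ (proj₁ o₁) + proj₁ (proj₁ o₂) in eq
    plans-sound {u} {b} {behind , ahead} at nd∈ | o₁ , o₁∈ , _ | o₂ , o₂∈ , here refl | true = record
      { zs = S₁.xs ++ S₂.xs
      ; payload = trans (cong₂ _++_ S₁.payload S₂.payload) (sym (map-++ code S₁.xs S₂.xs))
      ; zs∈E = Allₚ.++⁺ S₁.xs∈E S₂.xs∈E
      ; weight = trans (cong₂ ℚ._+_ S₁.weight S₂.weight) (sym (wt-++ S₁.xs S₂.xs))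
      ; fact = λ F all → record
          { cw-bought  = λ h → S₁.bought h F (Allₚ.++⁻ˡ S₁.xs all)
          ; ccw-bought = λ h → S₂.bought h F (Allₚ.++⁻ʳ S₁.xs all)
          ; cover = ≤ᵇ-true⁻¹ eq
          }
      }
      where
      module S₁ = FromColumns.OptionSpec (FromColumns.options-sound {R} u (At.ahead-follows at) o₁∈)
      module S₂ = FromColumns.OptionSpec (FromColumns.options-sound {R′} b (At.behind-follows at) o₂∈)

    private
      module TS = WalksSpec PlanKey PlanPayload compatible

    -- The indices charged along l positions. The falling list stops at `suc b`: for l = n the index
    -- `b` would be the first vertex again.
    ups downs : ℕ → ℕ → List ℕ
    ups u zero    = []
    ups u (suc l) = u ∷ ups (suc u) l
    downs b zero    = []
    downs b (suc l) = suc l + b ∷ downs b l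

    ups-All : ∀ {P : ℕ → Set} u l → (∀ c → c < l → P (c + u)) → All P (ups u l)
    ups-All u zero    h = []
    ups-All {P} u (suc l) h = h 0 (s≤s z≤n) ∷ ups-All (suc u) l (λ c c<l → subst P (sym (+-suc c u)) (h (suc c) (s≤s c<l)))

    downs-All : ∀ {P : ℕ → Set} b l → (∀ c → c < l → P (suc c + b)) → All P (downs b l)
    downs-All b zero    h = []
    downs-All b (suc l) h = h l ≤-refl ∷ downs-All b l (λ c c<l → h c (m≤n⇒m≤1+n c<l))

    ups-distinct : ∀ u l → l ≤ n → AllPairs (λ j k → ¬ j ~[ n ] k) (ups u l)
    ups-distinct u zero    _   = []
    ups-distinct u (suc l) l<n = ups-All (suc u) l (λ c c<l u~ → ~-next u c (~-trans u~ (~-reflexive (lem c u))) c<l l<n)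
                               ∷ ups-distinct (suc u) l (<⇒≤ l<n)
      where
      lem : ∀ c u → c + suc u ≡ u + suc c
      lem = solve-∀

    downs-distinct : ∀ b l → l ≤ n → AllPairs (λ j k → ¬ j ~[ n ] k) (downs b l)
    downs-distinct b zero    _   = []
    downs-distinct b (suc l) l<n = downs-All b l (λ c c<l b~ → ~-next (suc c + b) (l ∸ suc c)
        (~-trans (~-sym b~) (~-reflexive (shift-index c c<l))) (gap c c<l) l<n)
      ∷ downs-distinct b l (<⇒≤ l<n)
      where
      gap : ∀ c → c < l → suc (l ∸ suc c) ≤ l
      gap c c<l = ≤-trans (≤-reflexive (sym (+-∸-assoc 1 c<l))) (m∸n≤m l c)
      shift-index : ∀ c → c < l → suc l + b ≡ suc c + b + suc (l ∸ suc c)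
      shift-index c c<l = trans (cong (λ k → suc k + b) (sym (m+[n∸m]≡n c<l))) (lem c b (l ∸ suc c))
        where
        lem : ∀ c b d → suc (suc c + d) + b ≡ suc c + b + suc d
        lem = solve-∀

    -- Some closed walk costs at most twice any feasible subgraph

    module LowerBound {F : TemporalEdges m L} (F⊆E : ∀ t → F t ⊆ E t) (plan : TwoPlans R R′ F) where
      open TwoPlans plan
      open HalfPlan

      key : ℕ → ℕ → Key
      key u b = (len cw u , free cw u) , (len ccw b , free ccw b)

      key-compatible : ∀ u b → compatible (key u (suc b)) (key (suc u) b) ≡ true
      key-compatible u b = ∧-true (if-true (λ h → ==-true (free-step cw u h))) (if-true (λ h → ==-true (free-step ccw b h)))

      nodeCost : ℕ → ℕ → ℚ
      nodeCost u b = wt (paid cw u) ℚ.+ wt (paid ccw b)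

      walkCost : ℕ → ℕ → ℚ
      walkCost u l = wt (concatMap (paid cw) (ups u l)) ℚ.+ wt (concatMap (paid ccw) (downs B l))

      walkCost-suc : ∀ u l → walkCost u (suc l) ≡ nodeCost u (suc l + B) ℚ.+ walkCost (suc u) l
      walkCost-suc u l = trans (cong₂ ℚ._+_ (wt-++ (paid cw u) _) (wt-++ (paid ccw (suc l + B)) _))
        (solve′ 4 (λ a b c d → ((a ⊕′ b) ⊕′ (c ⊕′ d)) ⊜ ((a ⊕′ c) ⊕′ (b ⊕′ d))) refl
          (wt (paid cw u)) (wt (concatMap (paid cw) (ups (suc u) l)))
          (wt (paid ccw (suc l + B))) (wt (concatMap (paid ccw) (downs B l))))
        where open CMSolver ℚₚ.+-0-commutativeMonoid using (_⊜_) renaming (solve to solve′; _⊕_ to _⊕′_)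

      plans-optimal : ∀ {u b p} → At u b p → ∃[ c ] ∃[ q ] ((key u b , c , q) ∈ˡ plans n p × c ℚ.≤ nodeCost u b)
      plans-optimal {u} {b} {behind , ahead} at
        with FromColumns.options-optimal u F⊆E cw (At.ahead-follows at) (At.ahead-long at)
           | FromColumns.options-optimal b F⊆E ccw (At.behind-follows at) (At.behind-long at)
      ... | c₁ , p₁ , o₁∈ , ≤₁ | c₂ , p₂ , o₂∈ , ≤₂ = c₁ ℚ.+ c₂ , (p₁ , p₂)
        , ∈-concatMap-intro (λ a → concatMap (combine n a) (options behind)) o₁∈
            (∈-concatMap-intro (combine n ((len cw u , free cw u) , c₁ , p₁)) o₂∈ combined)
        , ℚₚ.+-mono-≤ ≤₁ ≤₂
        where
        combined : (key u b , c₁ ℚ.+ c₂ , (p₁ , p₂)) ∈ˡ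
                   combine n ((len cw u , free cw u) , c₁ , p₁) ((len ccw b , free ccw b) , c₂ , p₂)
        combined rewrite ≤ᵇ-true (cover {u} {b} (At.index at)) = here refl

      -- The keys of the given plans form a walk through the layers. The table entry found at each
      -- of these keys may record other purchases, but costs no more.
      travel-optimal : ∀ {u l ps tbl e₀} → Located (suc u) l ps → e₀ ∈ˡ tbl → proj₁ e₀ ≡ key u (suc l + B) →
        ∃[ e ] (e ∈ˡ travel tbl (map (plans n) ps) × proj₁ e ≡ key (u + l) (suc B)
          × proj₁ (proj₂ e) ℚ.≤ walkCost (suc u) l ℚ.+ proj₁ (proj₂ e₀))
      travel-optimal {u} {e₀ = e₀} [] e₀∈ key≡ = e₀ , e₀∈ , trans key≡ (cong (λ v → key v (suc B)) (sym (+-identityʳ u)))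
        , ℚₚ.≤-reflexive (sym (trans (cong (ℚ._+ proj₁ (proj₂ e₀)) (ℚₚ.+-identityʳ 0ℚ)) (ℚₚ.+-identityˡ _)))
      travel-optimal {u} {suc l} {e₀ = e₀} (at ∷ located) e₀∈ key≡ with plans-optimal at
      ... | c , q , nd∈ , c≤ with TS.advance-optimal nd∈ e₀∈
              (trans (cong (λ K → compatible K (key (suc u) (suc l + B))) key≡) (key-compatible u (suc l + B)))
      ... | e₁ , e₁∈ , key₁ , e₁≤ with travel-optimal located e₁∈ key₁
      ... | e , e∈ , key′ , e≤ = e , e∈ , trans key′ (cong (λ v → key v (suc B)) (sym (+-suc u l))) , (begin
        proj₁ (proj₂ e)
          ≤⟨ e≤ ⟩
        walkCost (2 + u) l ℚ.+ proj₁ (proj₂ e₁)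
          ≤⟨ ℚₚ.+-monoʳ-≤ (walkCost (2 + u) l) (ℚₚ.≤-trans e₁≤ (ℚₚ.+-monoˡ-≤ _ c≤)) ⟩
        walkCost (2 + u) l ℚ.+ (nodeCost (suc u) (suc l + B) ℚ.+ proj₁ (proj₂ e₀))
          ≡⟨ ℚₚ.+-assoc (walkCost (2 + u) l) _ _ ⟨
        walkCost (2 + u) l ℚ.+ nodeCost (suc u) (suc l + B) ℚ.+ proj₁ (proj₂ e₀)
          ≡⟨ cong (ℚ._+ _) (trans (ℚₚ.+-comm (walkCost (2 + u) l) _) (sym (walkCost-suc (suc u) l))) ⟩
        walkCost (suc u) (suc l) ℚ.+ proj₁ (proj₂ e₀) ∎)
        where open ℚₚ.≤-Reasoning

      candidates-optimal : ∀ {k ps} → k ≡ n → Located 0 k ps →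
        ∃[ e ] (e ∈ˡ candidates (map (plans n) ps) × proj₁ (proj₂ e) ℚ.≤ totalWeight 𝒢 F ℚ.+ totalWeight 𝒢 F)
      candidates-optimal k≡n [] = ⊥-elim (case subst (2 ≤_) (sym k≡n) 2≤n of λ ())
      candidates-optimal {suc l} {p ∷ ps} k≡n (at ∷ located) with plans-optimal at
      ... | c , q₀ , s₀∈ , c≤ with travel-optimal {tbl = (key 0 (suc l + B) , c , q₀ ∷ []) ∷ []} located (here refl) refl
      ... | e , e∈ , key≡ , e≤ with TS.best-optimal (key 0 (suc l + B)) e∈
              (trans (cong (λ K → compatible K (key 0 (suc l + B))) key≡) closing)
        where
        -- After n positions both indices have changed by n, so periodicity of the plans closes the
        -- walk.
        round : key (suc l) B ≡ key 0 (suc l + B)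
        round = cong₂ _,_
          (cong₂ _,_ (trans (cong (len cw) (trans k≡n (sym (+-identityʳ n)))) (len-periodic cw 0))
                     (trans (cong (free cw) (trans k≡n (sym (+-identityʳ n)))) (free-periodic cw 0)))
          (cong₂ _,_ (sym (trans (cong (λ i → len ccw (i + B)) k≡n) (len-periodic ccw B)))
                     (sym (trans (cong (λ i → free ccw (i + B)) k≡n) (free-periodic ccw B))))
        closing : compatible (key l (suc B)) (key 0 (suc l + B)) ≡ true
        closing = trans (cong (compatible (key l (suc B))) (sym round)) (key-compatible l B)
      ... | e′ , best≡ , e′≤ = e′ , ∈-concatMap-intro (closedTours (map (plans n) ps)) s₀∈ closed , (begin
        proj₁ (proj₂ e′)
          ≤⟨ e′≤ ⟩
        proj₁ (proj₂ e)
          ≤⟨ e≤ ⟩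
        walkCost 1 l ℚ.+ c
          ≤⟨ ℚₚ.+-monoʳ-≤ (walkCost 1 l) c≤ ⟩
        walkCost 1 l ℚ.+ nodeCost 0 (suc l + B)
          ≡⟨ trans (ℚₚ.+-comm (walkCost 1 l) _) (sym (walkCost-suc 0 l)) ⟩
        walkCost 0 (suc l)
          ≤⟨ ℚₚ.+-mono-≤ (cw-cost _ (ups-distinct 0 (suc l) (≤-reflexive k≡n)))
                         (ccw-cost _ (downs-distinct B (suc l) (≤-reflexive k≡n))) ⟩
        q ℚ.+ q′
          ≡⟨ total ⟩
        totalWeight 𝒢 F ℚ.+ totalWeight 𝒢 F ∎)
        where
        open ℚₚ.≤-Reasoning
        closed : e′ ∈ˡ closedTours (map (plans n) ps) (key 0 (suc l + B) , c , q₀)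
        closed rewrite best≡ = here refl

    -- Every closed walk buys a feasible subgraph

    record TourSpec (e : El (Entry PlanKey PlanPayload)) : Set where
      field
        zs      : List TimedEdge
        payload : concatMap both (proj₂ (proj₂ e)) ≡ map code zs
        zs∈E    : All (InEdges E) zs
        weight  : proj₁ (proj₂ e) ≡ wt zs

    -- `pay` is the payload of the finished walk, kept fixed: it suffices that each plan's purchases
    -- occur in it somewhere.
    data Tour (pay : List (El PlanPayload)) : El (list Position) → Key → Key → Set where
      []   : ∀ {K} → Tour pay [] K K
      next : ∀ {p ps K K′} {nd : El Plan} → nd ∈ˡ plans n p → proj₂ (proj₂ nd) ∈ˡ pay →
             compatible K (proj₁ nd) ≡ true → Tour pay ps (proj₁ nd) K′ → Tour pay (p ∷ ps) K K′

    tour-start : ∀ {u b p nd} → At u b p → nd ∈ˡ plans n p →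
                 TourSpec (proj₁ nd , proj₁ (proj₂ nd) , proj₂ (proj₂ nd) ∷ [])
    tour-start at nd∈ = record
      { zs = zs ; payload = trans (++-identityʳ _) payload ; zs∈E = zs∈E ; weight = weight }
      where open PlanSpec (plans-sound at nd∈)

    travel-sound : ∀ {u l ps tbl e} → Located u l ps → (∀ {e₀} → e₀ ∈ˡ tbl → TourSpec e₀) →
      e ∈ˡ travel tbl (map (plans n) ps) →
      TourSpec e × ∃[ e₀ ] (e₀ ∈ˡ tbl × Tour (proj₂ (proj₂ e)) ps (proj₁ e₀) (proj₁ e)
                            × (∀ {q} → q ∈ˡ proj₂ (proj₂ e₀) → q ∈ˡ proj₂ (proj₂ e)))
    travel-sound {e = e} [] spec e∈ = spec e∈ , e , e∈ , [] , id
    travel-sound {ps = p ∷ ps} {tbl} (at ∷ located) spec e∈ = result (travel-sound located spec′ e∈)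
      where
      spec′ : ∀ {e₁} → e₁ ∈ˡ Tours.advance tbl (plans n p) → TourSpec e₁
      spec′ e₁∈ with TS.advance-sound {tbl} {plans n p} e₁∈
      ... | k , c , q , e₀ , nd∈ , e₀∈ , _ , refl = record
        { zs = N.zs ++ S.zs
        ; payload = trans (cong₂ _++_ N.payload S.payload) (sym (map-++ code N.zs S.zs))
        ; zs∈E = Allₚ.++⁺ N.zs∈E S.zs∈E
        ; weight = trans (cong₂ ℚ._+_ N.weight S.weight) (sym (wt-++ N.zs S.zs))
        }
        where
        module N = PlanSpec (plans-sound at nd∈)
        module S = TourSpec (spec e₀∈)
      result : ∀ {e} →
        TourSpec e × ∃[ e₁ ] (e₁ ∈ˡ Tours.advance tbl (plans n p) × Tour (proj₂ (proj₂ e)) ps (proj₁ e₁) (proj₁ e)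
                              × (∀ {q} → q ∈ˡ proj₂ (proj₂ e₁) → q ∈ˡ proj₂ (proj₂ e))) →
        TourSpec e × ∃[ e₀ ] (e₀ ∈ˡ tbl × Tour (proj₂ (proj₂ e)) (p ∷ ps) (proj₁ e₀) (proj₁ e)
                              × (∀ {q} → q ∈ˡ proj₂ (proj₂ e₀) → q ∈ˡ proj₂ (proj₂ e)))
      result (S , e₁ , e₁∈ , tour , keep) with TS.advance-sound {tbl} {plans n p} e₁∈
      ... | k , c , q , e₀ , nd∈ , e₀∈ , adj , refl =
        S , e₀ , e₀∈ , next nd∈ (keep (here refl)) adj tour , λ q∈ → keep (there q∈)

    -- The first key sits at index u of R, the last one at index b of R′.
    data Chain (F : TemporalEdges m L) : ℕ → ℕ → Key → ℕ → Key → Set where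
      []   : ∀ {u b K} → Chain F u b K 0 K
      next : ∀ {u b K K₁ K′ l} → compatible K K₁ ≡ true → Fact F (suc u) (l + b) K₁ →
             Chain F (suc u) b K₁ l K′ → Chain F u b K (suc l) K′

    module _ {F : TemporalEdges m L} where

      cw-step : ∀ K K₁ → compatible K K₁ ≡ true → proj₂ (proj₁ K₁) ≡ true → cwLength K ≡ suc (cwLength K₁)
      cw-step ((i , _) , _) ((i₁ , p₁) , _) h free =
        ==-sound (if-true⁻¹ {p₁} (proj₁ (∧-true⁻¹ {if p₁ then i == suc i₁ else true} h)) free)

      ccw-step : ∀ K K₁ → compatible K K₁ ≡ true → proj₂ (proj₂ K) ≡ true → ccwLength K₁ ≡ suc (ccwLength K)
      ccw-step ((i , _) , (j , q)) ((i₁ , p₁) , (j₁ , _)) h free =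
        ==-sound (if-true⁻¹ {q} (proj₂ (∧-true⁻¹ {if p₁ then i == suc i₁ else true} h)) free)

      -- A bought plan brings its own path; a free one takes the tail of its predecessor's, whose
      -- length fits by compatibility.
      cw-next : ∀ {u b K K₁} → compatible K K₁ ≡ true → Fact F (suc u) b K₁ →
                Path R F 0 u (cwLength K) → Path R F 0 (suc u) (cwLength K₁)
      cw-next {K₁ = (_ , false) , _} h fact P = Fact.cw-bought fact refl
      cw-next {K = K} {K₁@((_ , true) , _)} h fact P = tail (subst (Path R F 0 _) (cw-step K K₁ h refl) P)

      ccw-next : ∀ {u b K K₁} → compatible K K₁ ≡ true → Fact F u (suc b) K →
                 Path R′ F 0 b (ccwLength K₁) → Path R′ F 0 (suc b) (ccwLength K)
      ccw-next {K = _ , _ , false} h fact P = Fact.ccw-bought fact refl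
      ccw-next {K = K@(_ , _ , true)} {K₁} h fact P = tail (subst (Path R′ F 0 _) (ccw-step K K₁ h refl) P)

      cw-along : ∀ {u b K l K′} → Chain F u b K l K′ → Path R F 0 u (cwLength K) → Path R F 0 (l + u) (cwLength K′)
      cw-along []               P = P
      cw-along {u} {K = K} {suc l} {K′} (next {K₁ = K₁} h fact C) P =
        subst (λ v → Path R F 0 v (cwLength K′)) (+-suc l u) (cw-along C (cw-next {K = K} {K₁} h fact P))

      -- Counterclockwise paths are handed on from the end of the chain back to its beginning.
      ccw-along : ∀ {u b K l K′} → Chain F u b K l K′ → Fact F u (l + b) K →
                  Path R′ F 0 b (ccwLength K′) → Path R′ F 0 (l + b) (ccwLength K)
      ccw-along []              _    P = P
      ccw-along {K = K} (next {K₁ = K₁} h fact₁ C) fact P = ccw-next {K = K} {K₁} h fact (ccw-along C fact₁ P)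

      -- Unless something is bought on the way, the inherited length drops with every step.
      cw-or-drop : ∀ {u b K l K′} → Chain F u b K l K′ → Path R F 0 (l + u) (cwLength K′) ⊎ cwLength K ≡ l + cwLength K′
      cw-or-drop [] = inj₂ refl
      cw-or-drop {u} {l = suc l} {K′} (next {K₁ = (i , false) , _} h fact C) =
        inj₁ (subst (λ v → Path R F 0 v (cwLength K′)) (+-suc l u) (cw-along C (Fact.cw-bought fact refl)))
      cw-or-drop {u} {K = K} {l = suc l} {K′} (next {K₁ = K₁@((i , true) , _)} h fact C) =
        Sum.map (subst (λ v → Path R F 0 v (cwLength K′)) (+-suc l u)) (λ eq → trans (cw-step K K₁ h refl) (cong suc eq)) (cw-or-drop C)

      ccw-or-drop : ∀ {u b K l K′} → Chain F u b K l K′ → Fact F u (l + b) K →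
                    Path R′ F 0 (l + b) (ccwLength K) ⊎ ccwLength K′ ≡ l + ccwLength K
      ccw-or-drop [] _ = inj₂ refl
      ccw-or-drop {K = _ , _ , false} (next h fact₁ C) fact = inj₁ (Fact.ccw-bought fact refl)
      ccw-or-drop {K = K@(_ , j , true)} {suc l} (next {K₁ = K₁} h fact₁ C) fact = Sum.map
        (ccw-next {K = K} {K₁} h fact)
        (λ eq → trans eq (trans (cong (l +_) (ccw-step K K₁ h refl)) (+-suc l j)))
        (ccw-or-drop C fact₁)

      chain-covers : ∀ {u b K l K′} → Chain F u b K l K′ → Fact F u (l + b) K → u + (l + b) ~[ n ] 0 →
        Path R F 0 u (cwLength K) → Path R′ F 0 b (ccwLength K′) → ∀ k → k < l →
        Covered R R′ F (k + u)
      chain-covers {K = K} C@(next _ _ _) fact h P Q zero _ = _ , cwLength K , ccwLength K , h , P , ccw-along C fact Q , Fact.cover fact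
      chain-covers {u} {b} {K} {suc l} (next {K₁ = K₁} h₁ fact₁ C) fact h P Q (suc k) (s≤s k<l) =
        subst (Covered R R′ F) (+-suc k u)
          (chain-covers C fact₁ (~-trans (~-reflexive (sym (+-suc u (l + b)))) h) (cw-next {K = K} {K₁} h₁ fact₁ P) Q k k<l)

      -- Going round once, either a purchase on the way supplies a real path at the starting vertex,
      -- or every plan inherits and the length i of the first key satisfies i = n + i. From the
      -- starting vertex the paths are then handed on to all others.
      closed-chain-connects : ∀ {b K} → Chain F 0 b K n K → Fact F 0 (n + b) K → n + b ~[ n ] 0 → Connects 𝒢 F
      closed-chain-connects {b} {K} C fact nb = covers⇒connects o λ k k<n →
        subst (Covered R R′ F) (+-identityʳ k)
          (chain-covers C fact nb P Q k k<n)
        where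
        impossible : ∀ i → i ≢ n + i
        impossible i eq = <-irrefl eq (m<n+m i (≤-trans (s≤s z≤n) 2≤n))
        P : Path R F 0 0 (cwLength K)
        P = [ move-to (~-turn 0) , (λ eq → ⊥-elim (impossible _ eq)) ]′ (cw-or-drop C)
        Q : Path R′ F 0 b (ccwLength K)
        Q = [ move-to (~-turn b) , (λ eq → ⊥-elim (impossible _ eq)) ]′ (ccw-or-drop C fact)

      module _ {pay : List (El PlanPayload)} (bought : ∀ x → code x ∈ˡ concatMap both pay → InEdges F x) where

        bought-fact : ∀ {u b p nd} → At u b p → nd ∈ˡ plans n p → proj₂ (proj₂ nd) ∈ˡ pay → Fact F u b (proj₁ nd)
        bought-fact at nd∈ q∈ = fact F (All.tabulate λ {x} x∈ →
          bought x (∈-concatMap-intro both q∈ (subst (code x ∈ˡ_) (sym payload) (∈-map⁺ code x∈))))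
          where open PlanSpec (plans-sound at nd∈)

        -- `K₀` is the first key once more, appended so that the chain closes up.
        tour-chain : ∀ {u l ps K K′ K₀} → Located (suc u) l ps → Tour pay ps K K′ → compatible K′ K₀ ≡ true →
                     Fact F (suc (l + u)) B K₀ → Chain F u B K (suc l) K₀
        tour-chain []              []                    h fact = next h fact []
        tour-chain {u} {suc l} {K₀ = K₀} (at ∷ located) (next nd∈ q∈ adj tour) h fact =
          next adj (bought-fact at nd∈ q∈) (tour-chain located tour h (subst (λ v → Fact F (suc v) B K₀) (sym (+-suc l u)) fact))

    initial : El Plan → El (list (Entry PlanKey PlanPayload))
    initial (k , w , q) = (k , w , q ∷ []) ∷ []

    closedTours-sound : ∀ layers s₀ {e} → e ∈ˡ closedTours layers s₀ →
                        e ∈ˡ travel (initial s₀) layers × compatible (proj₁ e) (proj₁ s₀) ≡ true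
    closedTours-sound layers (k , w , q) e∈ with Tours.best k (travel ((k , w , q ∷ []) ∷ []) layers) in best≡
    closedTours-sound layers (k , w , q) (here refl) | inj₂ e = TS.best-sound k (travel ((k , w , q ∷ []) ∷ []) layers) best≡

    Sound : El (Entry PlanKey PlanPayload) → Set
    Sound e = TourSpec e × (∀ F → (∀ x → code x ∈ˡ concatMap both (proj₂ (proj₂ e)) → InEdges F x) → Connects 𝒢 F)

    closed-sound : ∀ {l p ps s₀ e} → suc l ≡ n → At 0 (suc l + B) p → Located 1 l ps → s₀ ∈ˡ plans n p →
      compatible (proj₁ e) (proj₁ s₀) ≡ true →
      TourSpec e × ∃[ e₀ ] (e₀ ∈ˡ initial s₀ × Tour (proj₂ (proj₂ e)) ps (proj₁ e₀) (proj₁ e)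
                            × (∀ {q} → q ∈ˡ proj₂ (proj₂ e₀) → q ∈ˡ proj₂ (proj₂ e))) →
      Sound e
    closed-sound {l} {s₀ = K , _ , q} k≡n at located s₀∈ closes (spec , _ , here refl , tour , keep) = spec , λ F bought →
      let fact₀ = bought-fact {F} bought at s₀∈ (keep (here refl)) in
      closed-chain-connects
        (subst (λ k → Chain F 0 B K k K) k≡n (tour-chain bought located tour closes (wrap fact₀)))
        (subst (λ k → Fact F 0 (k + B) K) k≡n fact₀) (subst (λ k → k + B ~[ n ] 0) k≡n (At.index at))
      where
      -- The first vertex is read again one turn later: index 0 becomes n in `R`, and n + `B`
      -- becomes `B` in `R′`.
      wrap : ∀ {F} → Fact F 0 (suc l + B) K → Fact F (suc (l + 0)) B K
      wrap fact = record
        { cw-bought  = λ h → move-to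
            (1 , 0 , sym (trans (cong (λ k → suc k + 0) (+-identityʳ l)) (cong (_+ 0) k≡n))) (Fact.cw-bought fact h)
        ; ccw-bought = λ h → move-to (~-trans (~-reflexive (cong (_+ B) k≡n)) (~-turn B)) (Fact.ccw-bought fact h)
        ; cover = Fact.cover fact
        }

    candidates-sound : ∀ {k ps e} → k ≡ n → Located 0 k ps → e ∈ˡ candidates (map (plans n) ps) → Sound e
    candidates-sound k≡n (_∷_ {p = p} {ps} at located) e∈ =
      let s₀ , s₀∈ , e∈′     = ∈-concatMap-elim (closedTours (map (plans n) ps)) (plans n p) e∈
          e∈travel , closes  = closedTours-sound (map (plans n) ps) s₀ e∈′
      in closed-sound k≡n at located s₀∈ closes
           (travel-sound located (λ { (here refl) → tour-start at s₀∈ }) e∈travel)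

  -- The output and its approximation guarantee

  module _ (labels : El (list Label)) where

    selected : TemporalEdges m L
    selected t = Vec.tabulate (λ e → any (isLabel (toℕ t) (toℕ e)) labels)

    selected-∈⁺ : ∀ x → code x ∈ˡ labels → InEdges selected x
    selected-∈⁺ (t , e) x∈ = lookup⇒[]= e (selected t) (trans (lookup∘tabulate _ e)
      (Equivalence.to T-≡ (any⁺ _ (lose x∈ (Equivalence.from T-≡ (∧-true (==-refl (toℕ t)) (==-refl (toℕ e))))))))

    selected-∈⁻ : ∀ {t e} → e ∈ selected t → code (t , e) ∈ˡ labels
    selected-∈⁻ {t} {e} e∈ with find (any⁻ (isLabel (toℕ t) (toℕ e)) labels
                                 (Equivalence.from T-≡ (trans (sym (lookup∘tabulate _ e)) ([]=⇒lookup e∈))))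
    ... | (t′ , e′) , x∈ , h with ∧-true⁻¹ {t′ == toℕ t} (Equivalence.to T-≡ h)
    ... | p , q with ==-sound {t′} p | ==-sound {e′} q
    ... | refl | refl = x∈

    encode-selected : encodeSolution selected ≡
      map (λ (t , row) → map (λ (e , _) → any (isLabel t e) labels) (enumerate row)) (enumerate rows)
    encode-selected = sym (trans (cong (map _) (enumerate-tabulate row)) (trans (map-tabulate _ _) (tabulate-cong λ t →
      trans (cong (map _) (enumerate-tabulate _)) (trans (map-tabulate _ _) (sym (toList-tabulate _))))))

  double : ∀ q → q ℚ.+ q ≡ (ℤ.+ 2 ℚ./ 1) ℚ.* q
  double q = trans (cong₂ ℚ._+_ (sym (ℚₚ.*-identityˡ q)) (sym (ℚₚ.*-identityˡ q))) (sym (ℚₚ.*-distribʳ-+ q ℚ.1ℚ ℚ.1ℚ))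

  module Guarantee {R : Ring underlying} (follows : Follows R 0 (map (column rows) (tour edges)))
                   (len≡ : length (map (column rows) (tour edges)) ≡ n) where
    open Oriented (opposite-Opposite R)

    layers : List (List (El Plan))
    layers = map (plans n) (positions (map (column rows) (tour edges)))

    located : Located 0 n (positions (map (column rows) (tour edges)))
    located = positions-located follows len≡

    candidate : ∀ F → Feasible 𝒢 F →
      ∃[ e ] (choice layers ≡ inj₂ e × proj₁ (proj₂ e) ℚ.≤ totalWeight 𝒢 F ℚ.+ totalWeight 𝒢 F)
    candidate F feasible =
      let e , e∈ , e≤     = LowerBound.candidates-optimal (Feasible.subgraph feasible) (twoPlans feasible (opposite-Opposite R)) refl located
          e′ , eq , e′≤   = WalksSpec.best-optimal PlanKey PlanPayload (λ _ _ → true) ((0 , false) , (0 , false)) e∈ refl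
      in e′ , eq , ℚₚ.≤-trans e′≤ e≤

    -- Labels bought several times are counted repeatedly in the cost of the entry but once in the
    -- subgraph, hence an inequality of weights.
    guarantee : ∀ labels e → TourSpec e → labels ≡ concatMap both (proj₂ (proj₂ e)) →
      (∀ F → (∀ x → code x ∈ˡ concatMap both (proj₂ (proj₂ e)) → InEdges F x) → Connects 𝒢 F) →
      Feasible 𝒢 (selected labels) × totalWeight 𝒢 (selected labels) ℚ.≤ proj₁ (proj₂ e)
    guarantee labels e spec labels≡ connects =
      record { subgraph = λ t e∈ → All.lookup zs∈E (bought⇒zs (selected-∈⁻ labels e∈))
             ; connected = connects (selected labels) λ x x∈ → selected-∈⁺ labels x (subst (code x ∈ˡ_) (sym labels≡) x∈) }
      , ℚₚ.≤-trans (totalWeight-≤ zs∈E λ t e e∈ → bought⇒zs (selected-∈⁻ labels e∈)) (ℚₚ.≤-reflexive (sym weight))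
      where
      open TourSpec spec
      bought⇒zs : ∀ {x} → code x ∈ˡ labels → x ∈ˡ zs
      bought⇒zs {x} x∈ with ∈-map⁻ code (subst (code x ∈ˡ_) (trans labels≡ payload) x∈)
      ... | y , y∈ , eq′ = subst (_∈ˡ zs) (sym (code-injective eq′)) y∈

    inj₂-injective : ∀ {S T : Set} {x : S ⊎ T} {y z : T} → x ≡ inj₂ y → x ≡ inj₂ z → y ≡ z
    inj₂-injective refl refl = refl

    approximates : TemporallyConnected 𝒢 →
      ∃[ F ] (encodeSolution F ≡
                map (λ (t , row) → map (λ (e , _) → any (isLabel t e) (purchases (choice layers))) (enumerate row))
                    (enumerate rows)
              × Feasible 𝒢 F × (∀ F* → Feasible 𝒢 F* → totalWeight 𝒢 F ℚ.≤ (ℤ.+ 2 ℚ./ 1) ℚ.* totalWeight 𝒢 F*))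
    approximates connected =
      -- The whole graph is feasible by connectivity, so candidates exist and `choice` returns one.
      let e , eq , _       = candidate E record { subgraph = λ _ → id ; connected = connected }
          e∈ , _           = WalksSpec.best-sound PlanKey PlanPayload (λ _ _ → true) ((0 , false) , (0 , false)) (candidates layers) eq
          spec , connects  = candidates-sound refl located e∈
          feasible , F≤    = guarantee (purchases (choice layers)) e spec (cong purchases eq) connects
      in selected (purchases (choice layers)) , encode-selected (purchases (choice layers)) , feasible , λ F* feasible* →
         let e′ , eq′ , e′≤ = candidate F* feasible*
         in ℚₚ.≤-trans F≤ (ℚₚ.≤-trans (ℚₚ.≤-reflexive (cong (λ e → proj₁ (proj₂ e)) (inj₂-injective eq eq′)))
              (ℚₚ.≤-trans e′≤ (ℚₚ.≤-reflexive (double (totalWeight 𝒢 F*)))))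

  solve-approximates : IsTemporalCycle 𝒢 → TemporallyConnected 𝒢 →
    ∃[ F ] (encodeSolution F ≡ solve (encode 𝒢) × Feasible 𝒢 F
            × (∀ F* → Feasible 𝒢 F* → totalWeight 𝒢 F ℚ.≤ (ℤ.+ 2 ℚ./ 1) ℚ.* totalWeight 𝒢 F*))
  solve-approximates cyc = let R , follows , len≡ = tour-correct cyc in Guarantee.approximates follows len≡

open import Data.Integer using (+_)
open import Data.Rational using (_/_)

theorem6p2 : ∃[ p ] (PolynomialTimeOn IsTemporalCycle p
    × ApproximatesMTCOn IsTemporalCycle (+ 2 / 1) p)
theorem6p2 = prog solveC , computable-polynomialTime solveC IsTemporalCycle , approximation
  where
  approximation : ApproximatesMTCOn IsTemporalCycle (+ 2 / 1) (prog solveC)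
  approximation {n} 𝒢 cyc connected =
    let 3≤n = IsCycle.3≤n cyc
        F , eq , feasible , bound = Correctness.solve-approximates 𝒢 {{ℕ.>-nonZero (≤-trans (s≤s z≤n) 3≤n)}}
                                      (≤-trans (n≤1+n 2) 3≤n) cyc connected
    in F , cost solveC (encode 𝒢)
     , subst (λ y → prog solveC ∙ encode 𝒢 ⇓ y ⟨ cost solveC (encode 𝒢) ⟩) (sym eq) (run solveC (encode 𝒢))
     , feasible , λ F* optimal → bound F* (Optimal.feasible optimal)
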